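{- Let $k\geq 1$ and $s\geq 1$ be integers and let $\alpha\in[\frac{ks}{ks+s-1},1]$ be rational. Let $\ell$ be the smallest positive integer such that $\frac{\ell}{2ks}$ and $\frac{\alpha\ell}{2ks}$ are integers. There exist integers $t_0,q_0$ such that for every integer $t\geq t_0$ and every prime power $q\geq q_0$ there exists a bipartite graph $G$ with parts $M,N$, $|M|=q^{\alpha\ell}$, $|N|=q^{\ell}$, such that $G$ is $K_{s,t}^{(2k)}$-free and \[e(G)\geq \frac12 |M|^{\frac12+\frac{1}{2k}-\frac{1}{2ks}}|N|^{\frac12}.\]
   Context: For a graph $H$ and a positive integer $k$, $H^{(k)}$ is obtained from $H$ by replacing each edge $uv$ by a path of length $k$ from $u$ to $v$, these paths being pairwise internally vertex-disjoint. $K_{s,t}$ is the complete bipartite graph with parts of sizes $s$ and $t$. -}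

module Defs where

open import Data.Nat using (ℕ; zero; suc; _+_; _*_; _∸_; _^_; _≤_; _<_; _<?_; NonZero)
open import Data.Nat.Divisibility using (_∣_)
open import Data.Nat.Primality using (Prime)
open import Data.Fin using (Fin; fromℕ<)
open import Data.Bool using (Bool; true; false; T; if_then_else_)
open import Data.List using (List; map; allFin)
open import Data.Nat.ListAction using (sum)
open import Data.Product using (Σ; ∃; ∃-syntax; _×_; _,_; proj₁; proj₂)
open import Data.Sum using (_⊎_; inj₁; inj₂)
open import Data.Empty using (⊥)
open import Relation.Nullary using (yes; no)
open import Relation.Binary.PropositionalEquality using (_≡_)

record SimpleGraph : Set₁ where
  field
    V   : Set
    Adj : V → V → Set

Contains : SimpleGraph → SimpleGraph → Set
Contains G H =
  Σ (SimpleGraph.V H → SimpleGraph.V G) λ f →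
    (∀ x y → f x ≡ f y → x ≡ y) ×
    (∀ x y → SimpleGraph.Adj H x y → SimpleGraph.Adj G (f x) (f y))

Free : SimpleGraph → SimpleGraph → Set
Free H G = Contains G H → ⊥

-- Graphs presented by their edge set: every edge e joins src e and tgt e
-- (each edge uv listed once).

record EdgeGraph : Set₁ where
  field
    V   : Set
    E   : Set
    src : E → V
    tgt : E → V

-- Subdivision H^(suc k'): every edge replaced by a path of length suc k'
-- with k' new internal vertices (pairwise disjoint paths).
module _ (H : EdgeGraph) (k' : ℕ) where
  open EdgeGraph H

  SubVertex : Set
  SubVertex = V ⊎ (E × Fin k')

  -- the i-th vertex (0 ≤ i ≤ suc k') of the path replacing e
  pathVtx : E → ℕ → SubVertex
  pathVtx e zero = inj₁ (src e)
  pathVtx e (suc j) with j <? k'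
  ... | yes p = inj₂ (e , fromℕ< p)
  ... | no _  = inj₁ (tgt e)

  SubAdj : SubVertex → SubVertex → Set
  SubAdj x y = ∃[ e ] ∃[ i ] (i ≤ k') ×
    ((x ≡ pathVtx e i × y ≡ pathVtx e (suc i)) ⊎
     (y ≡ pathVtx e i × x ≡ pathVtx e (suc i)))

-- H^(k): paths of length k = suc (k ∸ 1).  Only meaningful (and only used)
-- for k ≥ 1; for k = 0 this junk value is H^(1) = H.
subdivide : (H : EdgeGraph) (k : ℕ) → SimpleGraph
subdivide H k = record { V = SubVertex H (k ∸ 1) ; Adj = SubAdj H (k ∸ 1) }

K : ℕ → ℕ → EdgeGraph
K s t = record
  { V = Fin s ⊎ Fin t
  ; E = Fin s × Fin t
  ; src = λ e → inj₁ (proj₁ e)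
  ; tgt = λ e → inj₂ (proj₂ e)
  }

BipGraph : ℕ → ℕ → Set
BipGraph m n = Fin m → Fin n → Bool

BipAdj : ∀ {m n} → BipGraph m n → Fin m ⊎ Fin n → Fin m ⊎ Fin n → Set
BipAdj G (inj₁ x) (inj₂ y) = T (G x y)
BipAdj G (inj₂ y) (inj₁ x) = T (G x y)
BipAdj G (inj₁ _) (inj₁ _) = ⊥
BipAdj G (inj₂ _) (inj₂ _) = ⊥

asGraph : ∀ {m n} → BipGraph m n → SimpleGraph
asGraph {m} {n} G = record { V = Fin m ⊎ Fin n ; Adj = BipAdj G }

edges : ∀ {m n} → BipGraph m n → ℕ
edges {m} {n} G =
  sum (map (λ x → sum (map (λ y → if G x y then 1 else 0) (allFin n))) (allFin m))

IsPrimePower : ℕ → Set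
IsPrimePower q = ∃[ p ] ∃[ r ] Prime p × 1 ≤ r × q ≡ p ^ r

-- For α = a / b (b ≥ 1): ℓ/(2ks) and αℓ/(2ks) are integers,
-- i.e. 2ks ∣ ℓ and 2ks·b ∣ a·ℓ.
GoodL : (k s a b ℓ : ℕ) → Set
GoodL k s a b ℓ = 1 ≤ ℓ × (2 * k * s) ∣ ℓ × (2 * k * s * b) ∣ (a * ℓ)

IsSmallestL : (k s a b ℓ : ℕ) → Set
IsSmallestL k s a b ℓ = GoodL k s a b ℓ × (∀ ℓ' → GoodL k s a b ℓ' → ℓ ≤ ℓ')

{-# OPTIONS --safe #-}
-- Everything happens over ℤ modulo a prime p with q ≤ p ≤ 36 q (Chebyshev). Vertices are the
-- vectors in [q]^m and [q]^ℓ, and x, y are joined when the residues of F (x , y , r), r < c, all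
-- lie in {0 , … , 35}, where F is a random polynomial of bounded degree and p^c is roughly the
-- inverse edge density.
--
-- Fix the s roots. A tree consisting of a centre and its s paths to the roots is a solution of a
-- system of polynomial equations, and the density is such that a square subsystem can be selected
-- in which every unknown is matched with an equation of an incident edge. Solutions with
-- invertible Jacobian are bounded in number by a Bézout-type argument. A singular solution
-- comes with a kernel vector of the Jacobian; because values and directional derivatives of F at
-- distinct points are independent, singularity costs a factor 1/p beyond the O(1) expected number
-- of solutions, so T disjoint singular trees on common roots occur with probability O(p^{sℓ-T}).
-- For T large enough the first moment method yields an F with no such family and with at least
-- half of the expected number of edges. This replaces the Lang–Weil bound of the usual random
-- algebraic construction.
module Submission where

-- The window has 36 values because p ≤ 36 q: one residue is small with probability 36 / p, at least
-- 1 / q, so c equations give edge density at least q ^ -c and the change from q to p loses nothing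
-- in the edge count. A window condition becomes algebraic as a product of 36 shifted polynomials;
-- at a solution exactly one factor vanishes, so its Jacobian is that of the original equation up to
-- units. The obstacle is singular trees. A kernel vector v adds one condition per equation, but
-- such a condition is random only if v moves a coordinate which that equation sees. The matching
-- guarantees this for the equation of unknown ξ whenever v ξ is nonzero modulo p. A zero entry
-- forfeits a probability factor 1 / p, yet it also removes the p-fold choice of that entry, so
-- every entry balances. Only v up to scalars matters, and its fixed leading entry is the surplus
-- factor 1 / p. The matching exists because c is at most the dimension on either side and a path
-- has at least as many equations as unknowns; these inequalities are where the bounds on α enter.

module PrimeGaps where

  open import Data.Nat
  open import Data.Nat.Properties
  open import Data.Nat.Divisibility
  open import Data.Nat.Primality
  open import Data.Nat.Primality.Factorisation using (factorise)
  open import Data.Nat.Induction using (<-rec)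
  open import Data.Nat.Tactic.RingSolver using (solve-∀)
  open import Data.List using (List; []; _∷_)
  open import Data.List.Relation.Unary.All using ([]; _∷_)
  open import Data.Product using (∃-syntax; _×_; _,_; proj₁)
  open import Data.Sum using (_⊎_; inj₁; inj₂)
  open import Data.Empty using (⊥; ⊥-elim)
  open import Relation.Nullary using (¬_; Dec; yes; no; contradiction)
  open import Relation.Nullary.Decidable using (_×-dec_)
  open import Relation.Binary.PropositionalEquality

  -- Chebyshev-type estimates: a prime between q and 36 q.

  ^-*-distrib : ∀ a b e → (a * b) ^ e ≡ a ^ e * b ^ e
  ^-*-distrib a b zero    = refl
  ^-*-distrib a b (suc e) = trans (cong (a * b *_) (^-*-distrib a b e)) (r a b (a ^ e) (b ^ e))
    where
    r : ∀ a b x y → a * b * (x * y) ≡ a * x * (b * y)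
    r = solve-∀

  -- `binom i j` is the binomial coefficient of i + j over i; indexing by the two parts keeps
  -- subtraction out of Pascal's rule.
  binom : ℕ → ℕ → ℕ
  binom zero    _       = 1
  binom (suc _) zero    = 1
  binom (suc i) (suc j) = binom i (suc j) + binom (suc i) j

  binom-! : ∀ i j → binom i j * (i ! * j !) ≡ (i + j) !
  binom-! zero j = trans (*-identityˡ _) (*-identityˡ _)
  binom-! (suc i) zero rewrite +-identityʳ i = trans (*-identityˡ _) (*-identityʳ _)
  binom-! (suc i) (suc j) = begin
    (binom i (suc j) + binom (suc i) j) * (suc i ! * suc j !)
      ≡⟨ expand (binom i (suc j)) (binom (suc i) j) (i !) (j !) i j ⟩
    suc i * (binom i (suc j) * (i ! * suc j !)) + suc j * (binom (suc i) j * (suc i ! * j !))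
      ≡⟨ cong₂ (λ x y → suc i * x + suc j * y) (binom-! i (suc j)) (trans (binom-! (suc i) j) (cong _! (sym (+-suc i j)))) ⟩
    suc i * (i + suc j) ! + suc j * (i + suc j) !
      ≡⟨ sym (*-distribʳ-+ ((i + suc j) !) (suc i) (suc j)) ⟩
    (suc i + suc j) * (i + suc j) ! ∎
    where
    open ≡-Reasoning
    expand : ∀ x y a b i j → (x + y) * ((suc i * a) * (suc j * b)) ≡ suc i * (x * (a * (suc j * b))) + suc j * (y * ((suc i * a) * b))
    expand = solve-∀

  fact*fact≢0 : ∀ i j → NonZero (i ! * j !)
  fact*fact≢0 i j = m*n≢0 (i !) (j !) {{i !≢0}} {{j !≢0}}

  binom-absorbˡ : ∀ i j → suc i * binom (suc i) j ≡ suc (i + j) * binom i j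
  binom-absorbˡ i j = *-cancelʳ-≡ _ _ (i ! * j !) {{fact*fact≢0 i j}} (begin
    suc i * binom (suc i) j * (i ! * j !) ≡⟨ shuffle i (binom (suc i) j) (i !) (j !) ⟩
    binom (suc i) j * (suc i ! * j !)     ≡⟨ binom-! (suc i) j ⟩
    suc (i + j) * (i + j) !               ≡⟨ cong (suc (i + j) *_) (sym (binom-! i j)) ⟩
    suc (i + j) * (binom i j * (i ! * j !)) ≡⟨ sym (*-assoc (suc (i + j)) (binom i j) _) ⟩
    suc (i + j) * binom i j * (i ! * j !) ∎)
    where
    open ≡-Reasoning
    shuffle : ∀ i x a b → suc i * x * (a * b) ≡ x * ((suc i * a) * b)
    shuffle = solve-∀

  binom-absorbʳ : ∀ i j → suc j * binom i (suc j) ≡ suc (i + j) * binom i j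
  binom-absorbʳ i j = *-cancelʳ-≡ _ _ (i ! * j !) {{fact*fact≢0 i j}} (begin
    suc j * binom i (suc j) * (i ! * j !) ≡⟨ shuffle j (binom i (suc j)) (i !) (j !) ⟩
    binom i (suc j) * (i ! * suc j !)     ≡⟨ binom-! i (suc j) ⟩
    (i + suc j) !                         ≡⟨ cong _! (+-suc i j) ⟩
    suc (i + j) * (i + j) !               ≡⟨ cong (suc (i + j) *_) (sym (binom-! i j)) ⟩
    suc (i + j) * (binom i j * (i ! * j !)) ≡⟨ sym (*-assoc (suc (i + j)) (binom i j) _) ⟩
    suc (i + j) * binom i j * (i ! * j !) ∎)
    where
    open ≡-Reasoning
    shuffle : ∀ j x a b → suc j * x * (a * b) ≡ x * (a * (suc j * b))
    shuffle = solve-∀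

  binom≥1 : ∀ i j → 1 ≤ binom i j
  binom≥1 zero    j       = ≤-refl
  binom≥1 (suc i) zero    = ≤-refl
  binom≥1 (suc i) (suc j) = ≤-trans (binom≥1 i (suc j)) (m≤m+n _ _)

  binom≤2^ : ∀ i j → binom i j ≤ 2 ^ (i + j)
  binom≤2^ zero j = m^n>0 2 j
  binom≤2^ (suc i) zero = m^n>0 2 (suc i + 0)
  binom≤2^ (suc i) (suc j) = ≤-trans (+-mono-≤ (binom≤2^ i (suc j)) (≤-trans (binom≤2^ (suc i) j) (≤-reflexive (cong (2 ^_) (sym (+-suc i j))))))
    (≤-reflexive (cong (2 ^ (i + suc j) +_) (sym (+-identityʳ _))))

  binom-sucʳ : ∀ i j → binom i j ≤ binom i (suc j)
  binom-sucʳ zero j = ≤-refl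
  binom-sucʳ (suc i) zero = binom≥1 (suc i) 1
  binom-sucʳ (suc i) (suc j) = m≤n+m (binom (suc i) (suc j)) (binom i (suc (suc j)))

  binom-sucˡ : ∀ i j → binom i j ≤ binom (suc i) j
  binom-sucˡ zero zero = ≤-refl
  binom-sucˡ (suc i) zero = ≤-refl
  binom-sucˡ zero (suc j) = m≤m+n 1 _
  binom-sucˡ (suc i) (suc j) = m≤m+n _ _

  -- Pascal's rule splits the central coefficient into two neighbours, each at least the previous
  -- central coefficient.
  2^≤binom : ∀ h → 2 ^ h ≤ binom h h
  2^≤binom zero = ≤-refl
  2^≤binom (suc h) = +-mono-≤ (≤-trans (2^≤binom h) (binom-sucʳ h h))
    (≤-trans (≤-reflexive (+-identityʳ _)) (≤-trans (2^≤binom h) (binom-sucˡ h h)))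

  -- The reciprocals 1 / ((i+j+1) binom i j) form Leibniz's harmonic triangle, in which
  -- each entry is the difference of two entries whose denominators divide D by induction.
  leibniz-∣ : ∀ i j {D} → (∀ x → 1 ≤ x → x ≤ suc (i + j) → x ∣ D) → suc (i + j) * binom i j ∣ D
  leibniz-∣ zero j {D} cm = subst (_∣ D) (sym (*-identityʳ (suc j))) (cm (suc j) (s≤s z≤n) ≤-refl)
  leibniz-∣ (suc i) j {D} cm with leibniz-∣ i j {D} (λ x 1≤x x≤ → cm x 1≤x (≤-trans x≤ (n≤1+n _)))
                              | leibniz-∣ i (suc j) {D} (λ x 1≤x x≤ → cm x 1≤x (≤-trans x≤ (≤-reflexive (cong suc (+-suc i j)))))
  ... | divides A eqA | divides A' eqA' = divides (A ∸ A') (*-cancelʳ-≡ _ _ (suc i) final)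
    where
    n = suc (i + j)
    a = n * binom i j
    a≢0 : NonZero a
    a≢0 = m*n≢0 n (binom i j) {{_}} {{>-nonZero (binom≥1 i j)}}
    open ≡-Reasoning
    -- A and A' are D times two adjacent entries of the triangle. Absorption gives their ratio, so A
    -- ∸ A' is D times the third entry.
    ratio : suc n * A' ≡ suc j * A
    ratio = *-cancelˡ-≡ _ _ a {{a≢0}} (begin
      a * (suc n * A')                  ≡⟨ r₁ a n A' ⟩
      A' * (suc n * a)                  ≡⟨ cong (λ z → A' * (suc n * z)) (sym (binom-absorbʳ i j)) ⟩
      A' * (suc n * (suc j * binom i (suc j))) ≡⟨ cong (λ z → A' * (suc z * (suc j * binom i (suc j)))) (sym (+-suc i j)) ⟩
      A' * (suc (i + suc j) * (suc j * binom i (suc j))) ≡⟨ r₂ A' (suc (i + suc j)) (suc j) (binom i (suc j)) ⟩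
      suc j * (A' * (suc (i + suc j) * binom i (suc j))) ≡⟨ cong (suc j *_) (sym eqA') ⟩
      suc j * D                         ≡⟨ cong (suc j *_) eqA ⟩
      suc j * (A * a)                   ≡⟨ r₃ j A a ⟩
      a * (suc j * A) ∎)
      where
      r₁ : ∀ a n A → a * (suc n * A) ≡ A * (suc n * a)
      r₁ = solve-∀
      r₂ : ∀ x y z w → x * (y * (z * w)) ≡ z * (x * (y * w))
      r₂ = solve-∀
      r₃ : ∀ j A a → suc j * (A * a) ≡ a * (suc j * A)
      r₃ = solve-∀
    diff : suc n * (A ∸ A') ≡ suc i * A
    diff = begin
      suc n * (A ∸ A')          ≡⟨ *-distribˡ-∸ (suc n) A A' ⟩
      suc n * A ∸ suc n * A'    ≡⟨ cong (suc n * A ∸_) ratio ⟩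
      suc n * A ∸ suc j * A     ≡⟨ cong (_∸ suc j * A) (split i j A) ⟩
      suc i * A + suc j * A ∸ suc j * A ≡⟨ m+n∸n≡m (suc i * A) (suc j * A) ⟩
      suc i * A ∎
      where
      split : ∀ i j A → suc (suc (i + j)) * A ≡ suc i * A + suc j * A
      split = solve-∀
    final : D * suc i ≡ (A ∸ A') * (suc n * binom (suc i) j) * suc i
    final = begin
      D * suc i                ≡⟨ cong (_* suc i) eqA ⟩
      A * a * suc i            ≡⟨ s₁ A a i ⟩
      a * (suc i * A)          ≡⟨ cong (a *_) (sym diff) ⟩
      a * (suc n * (A ∸ A'))   ≡⟨ cong (_* (suc n * (A ∸ A'))) (sym (binom-absorbˡ i j)) ⟩
      suc i * binom (suc i) j * (suc n * (A ∸ A')) ≡⟨ s₂ (suc i) (binom (suc i) j) (suc n) (A ∸ A') ⟩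
      (A ∸ A') * (suc n * binom (suc i) j) * suc i ∎
      where
      s₁ : ∀ A a i → A * a * suc i ≡ a * (suc i * A)
      s₁ = solve-∀
      s₂ : ∀ x y z w → x * y * (z * w) ≡ w * (z * y) * x
      s₂ = solve-∀

  -- Primorials and common multiples.

  primePart : ℕ → ℕ
  primePart x with prime? x
  ... | yes _ = x
  ... | no  _ = 1

  -- The primes range over the interval (lo , lo + len].
  primorial : ℕ → ℕ → ℕ
  primorial lo zero      = 1
  primorial lo (suc len) = primePart (lo + suc len) * primorial lo len

  primePart-prime : ∀ {p} → Prime p → primePart p ≡ p
  primePart-prime {p} pp with prime? p
  ... | yes _ = refl
  ... | no ¬p = contradiction pp ¬p

  ∤1 : ∀ {p} → Prime p → ¬ p ∣ 1
  ∤1 pp p∣1 = ¬prime[1] (subst Prime (∣1⇒≡1 p∣1) pp)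

  ∣primePart⇒≡ : ∀ {p x} → Prime p → p ∣ primePart x → p ≡ x × Prime x
  ∣primePart⇒≡ {p} {x} pp p∣ with prime? x
  ... | no _ = contradiction p∣ (∤1 pp)
  ... | yes px with prime⇒irreducible px p∣
  ...   | inj₁ refl = contradiction pp ¬prime[1]
  ...   | inj₂ eq = eq , px

  ∣primorial⇒≤ : ∀ {p} lo len → Prime p → p ∣ primorial lo len → p ≤ lo + len
  ∣primorial⇒≤ lo zero pp p∣ = contradiction p∣ (∤1 pp)
  ∣primorial⇒≤ lo (suc len) pp p∣ with euclidsLemma (primePart (lo + suc len)) (primorial lo len) pp p∣
  ... | inj₁ d = ≤-reflexive (proj₁ (∣primePart⇒≡ {x = lo + suc len} pp d))
  ... | inj₂ d = ≤-trans (∣primorial⇒≤ lo len pp d) (+-monoʳ-≤ lo (n≤1+n len))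

  ∣primorial : ∀ {p} lo len → Prime p → lo < p → p ≤ lo + len → p ∣ primorial lo len
  ∣primorial lo zero pp lo<p p≤ = contradiction (≤-trans p≤ (≤-reflexive (+-identityʳ lo))) (<⇒≱ lo<p)
  ∣primorial {p} lo (suc len) pp lo<p p≤ with p ≟ lo + suc len
  ... | yes refl = ∣m⇒∣m*n _ (∣-reflexive (sym (primePart-prime pp)))
  ... | no p≢ = ∣n⇒∣m*n (primePart (lo + suc len)) (∣primorial lo len pp lo<p (≤-pred (≤-trans (≤∧≢⇒< p≤ p≢) (≤-reflexive (+-suc lo len)))))

  prime-*-∣ : ∀ {p z X} → Prime p → ¬ p ∣ z → z ∣ X → p ∣ X → p * z ∣ X
  prime-*-∣ {p} {z} pp p∤z (divides w refl) p∣X with euclidsLemma w z pp p∣X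
  ... | inj₁ p∣w = *-monoˡ-∣ z p∣w
  ... | inj₂ p∣z = contradiction p∣z p∤z

  -- Divisors accumulate because the next prime exceeds every prime factor of the product so far.
  primorial-∣ : ∀ lo len {X} → (∀ {p} → Prime p → lo < p → p ≤ lo + len → p ∣ X) → primorial lo len ∣ X
  primorial-∣ lo zero h = 1∣ _
  primorial-∣ lo (suc len) {X} h with prime? (lo + suc len)
  ... | no _ = subst (_∣ X) (sym (+-identityʳ _)) (primorial-∣ lo len (λ pp lo<p p≤ → h pp lo<p (≤-trans p≤ (+-monoʳ-≤ lo (n≤1+n len)))))
  ... | yes px = prime-*-∣ px
        (λ d → <⇒≱ (≤-reflexive (sym (+-suc lo len))) (∣primorial⇒≤ lo len px d))
        (primorial-∣ lo len (λ pp lo<p p≤ → h pp lo<p (≤-trans p≤ (+-monoʳ-≤ lo (n≤1+n len)))))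
        (h px (≤-trans (s≤s (m≤m+n lo len)) (≤-reflexive (sym (+-suc lo len)))) ≤-refl)

  primorial-+ : ∀ n l → primorial 0 (n + l) ≡ primorial n l * primorial 0 n
  primorial-+ n zero rewrite +-identityʳ n = sym (*-identityˡ _)
  primorial-+ n (suc l) rewrite +-suc n l = trans (cong (primePart (suc (n + l)) *_) (primorial-+ n l)) (sym (*-assoc (primePart (suc (n + l))) (primorial n l) _))

  primorial-empty : ∀ n l → (∀ {p} → Prime p → n < p → p ≤ n + l → ⊥) → primorial n l ≡ 1
  primorial-empty n zero h = refl
  primorial-empty n (suc l) h with prime? (n + suc l)
  ... | yes pp = ⊥-elim (h pp (≤-trans (s≤s (m≤m+n n l)) (≤-reflexive (sym (+-suc n l)))) ≤-refl)
  ... | no _ = trans (+-identityʳ _) (primorial-empty n l (λ pp n<p p≤ → h pp n<p (≤-trans p≤ (+-monoʳ-≤ n (n≤1+n l)))))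

  prime∣!⇒≤ : ∀ {p} n → Prime p → p ∣ n ! → p ≤ n
  prime∣!⇒≤ zero pp d = contradiction d (∤1 pp)
  prime∣!⇒≤ (suc n) pp d with euclidsLemma (suc n) (n !) pp d
  ... | inj₁ d₁ = ∣⇒≤ d₁
  ... | inj₂ d₂ = ≤-trans (prime∣!⇒≤ n pp d₂) (n≤1+n n)

  ∣! : ∀ {x} n → 1 ≤ x → x ≤ n → x ∣ n !
  ∣! zero 1≤x x≤0 = contradiction (≤-trans 1≤x x≤0) (λ ())
  ∣! {x} (suc n) 1≤x x≤ with x ≟ suc n
  ... | yes refl = m∣m*n _
  ... | no x≢ = ∣n⇒∣m*n (suc n) (∣! n 1≤x (≤-pred (≤∧≢⇒< x≤ x≢)))

  prime∣binom : ∀ {p} n → Prime p → n < p → p ≤ n + n → p ∣ binom n n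
  prime∣binom {p} n pp n<p p≤ with euclidsLemma (binom n n) (n ! * n !) pp (subst (p ∣_) (sym (binom-! n n)) (∣! (n + n) (≤-trans (s≤s z≤n) n<p) p≤))
  ... | inj₁ d = d
  ... | inj₂ d with euclidsLemma (n !) (n !) pp d
  ...   | inj₁ d' = contradiction (prime∣!⇒≤ n pp d') (<⇒≱ n<p)
  ...   | inj₂ d' = contradiction (prime∣!⇒≤ n pp d') (<⇒≱ n<p)

  -- Doubling: the primes between x and 2 x all divide `binom x x`, which is at most 4 ^ x. Powers
  -- of two are what the argument at n = 4 ^ e calls for.
  primorial≤4^ : ∀ j → primorial 0 (2 ^ j) ≤ 4 ^ (2 ^ j)
  primorial≤4^ zero = ≤ᵇ⇒≤ _ _ _
  primorial≤4^ (suc j) = begin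
    primorial 0 (x + (x + 0))       ≡⟨ cong (λ y → primorial 0 (x + y)) (+-identityʳ x) ⟩
    primorial 0 (x + x)             ≡⟨ primorial-+ x x ⟩
    primorial x x * primorial 0 x   ≤⟨ *-mono-≤ (≤-trans (∣⇒≤ {{>-nonZero (binom≥1 x x)}} (primorial-∣ x x (prime∣binom x))) (binom≤2^ x x)) (primorial≤4^ j) ⟩
    2 ^ (x + x) * 4 ^ x             ≡⟨ cong (_* 4 ^ x) (trans (cong (2 ^_) (cong (x +_) (sym (+-identityʳ x)))) (sym (^-*-assoc 2 2 x))) ⟩
    4 ^ x * 4 ^ x                   ≡⟨ sym (^-distribˡ-+-* 4 x x) ⟩
    4 ^ (x + x)                     ≡⟨ cong (λ y → 4 ^ (x + y)) (sym (+-identityʳ x)) ⟩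
    4 ^ (x + (x + 0)) ∎
    where
    open ≤-Reasoning
    x = 2 ^ j

  -- Prime factors are moved in one at a time: a prime already dividing z leaves z and joins the
  -- square, any other joins z, which thus stays a product of distinct primes.
  square-part : ∀ {N} j → 1 ≤ j → j ≤ N → ∃[ y ] ∃[ z ] j ≡ y * y * z × z ∣ primorial 0 N
  square-part {N} = <-rec (λ j → 1 ≤ j → j ≤ N → ∃[ y ] ∃[ z ] j ≡ y * y * z × z ∣ primorial 0 N) step
    where
    step : ∀ j → (∀ {i} → i < j → 1 ≤ i → i ≤ N → ∃[ y ] ∃[ z ] i ≡ y * y * z × z ∣ primorial 0 N) →
           1 ≤ j → j ≤ N → ∃[ y ] ∃[ z ] j ≡ y * y * z × z ∣ primorial 0 N
    step j rec 1≤j j≤N with factorise j {{>-nonZero 1≤j}}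
    ... | record { factors = [] ; isFactorisation = eq } = 1 , 1 , eq , 1∣ _
    ... | record { factors = p ∷ ps ; isFactorisation = eq ; factorsPrime = pp ∷ pps } = go
      where
      j' = Data.List.foldr _*_ 1 ps
      instance
        j'≢0 : NonZero j'
        j'≢0 = productOfPrimes≢0 pps
      j'<j : j' < j
      j'<j = subst (j' <_) (trans (*-comm j' p) (sym eq)) (m<m*n j' p (nonTrivial⇒n>1 p {{prime⇒nonTrivial pp}}))
      p≤N : p ≤ N
      p≤N = ≤-trans (∣⇒≤ {{>-nonZero 1≤j}} (divides j' (trans eq (*-comm p j')))) j≤N
      go : ∃[ y ] ∃[ z ] j ≡ y * y * z × z ∣ primorial 0 N
      go with rec j'<j (>-nonZero⁻¹ j') (≤-trans (<⇒≤ j'<j) j≤N)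
      ... | y , z , eq' , z∣ with p ∣? z
      ...   | no p∤z = y , p * z , trans eq (trans (cong (p *_) eq') (r p y z)) , prime-*-∣ pp p∤z z∣ (∣primorial 0 N pp (≤-trans (s≤s z≤n) (nonTrivial⇒n>1 p {{prime⇒nonTrivial pp}})) p≤N)
        where
        r : ∀ p y z → p * (y * y * z) ≡ y * y * (p * z)
        r = solve-∀
      ...   | yes (divides z' refl) = p * y , z' , trans eq (trans (cong (p *_) eq') (r p y z')) , ∣-trans (m∣m*n p) z∣
        where
        r : ∀ p y z → p * (y * y * (z * p)) ≡ p * y * (p * y) * z
        r = solve-∀

  !≤^ : ∀ {M} n → n ≤ M → n ! ≤ M ^ n
  !≤^ zero _ = ≤-refl
  !≤^ (suc n) n<M = *-mono-≤ n<M (!≤^ n (<⇒≤ n<M))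

  -- A substitute for the least common multiple. In j = y * y * z, the part z divides the primorial
  -- and y * y ≤ N < M * M puts y below M, so y divides M !. The extra factor is harmless since M is
  -- only of order √N.
  common-multiple : ∀ N M → N < M * M → ∀ j → 1 ≤ j → j ≤ N → j ∣ primorial 0 N * (M ! * M !)
  common-multiple N M N<M² j 1≤j j≤N with square-part j 1≤j j≤N
  ... | y , z , refl , z∣P = subst (_∣ primorial 0 N * (M ! * M !)) (*-comm z (y * y)) (*-pres-∣ z∣P (*-pres-∣ y∣ y∣))
    where
    y≤M : y ≤ M
    y≤M with y ≤? M
    ... | yes h = h
    ... | no h = contradiction (≤-trans (*-mono-≤ (<⇒≤ (≰⇒> h)) (<⇒≤ (≰⇒> h))) (≤-trans (m≤m*n (y * y) z {{z≢0}}) j≤N)) (<⇒≱ N<M²)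
      where
      z≢0 : NonZero z
      z≢0 = m*n≢0⇒n≢0 (y * y) {{>-nonZero 1≤j}}
    1≤y : 1 ≤ y
    1≤y = >-nonZero⁻¹ y {{m*n≢0⇒m≢0 y {{m*n≢0⇒m≢0 (y * y) {{>-nonZero 1≤j}}}}}}
    y∣ : y ∣ M !
    y∣ = ∣! M 1≤y y≤M

  4[2+e]<2^e : ∀ {e} → 6 ≤ e → 4 * (2 + e) < 2 ^ e
  4[2+e]<2^e 6≤e = go (≤⇒≤′ 6≤e)
    where
    open ≤-Reasoning
    r : ∀ i → 4 * (2 + suc i) ≡ 4 * (2 + i) + 4
    r = solve-∀
    go : ∀ {e} → 6 ≤′ e → 4 * (2 + e) < 2 ^ e
    go ≤′-refl = ≤ᵇ⇒≤ 33 64 _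
    go (≤′-step {e} 6≤′e) = begin-strict
      4 * (2 + suc e)     ≡⟨ r e ⟩
      4 * (2 + e) + 4     <⟨ +-mono-<-≤ (go 6≤′e) (^-monoʳ-≤ 2 (≤-trans (≤ᵇ⇒≤ 2 6 _) (≤′⇒≤ 6≤′e))) ⟩
      2 ^ e + 2 ^ e       ≡⟨ cong (2 ^ e +_) (sym (+-identityʳ _)) ⟩
      2 ^ suc e ∎

  -- A nonzero common multiple of 1, ..., 2 h + 1 is at least (2 h + 1) times the central
  -- coefficient, hence at least 2 ^ h = 2 ^ (4 n). Without primes in the interval the primorial is
  -- at most 4 ^ n, and the square of M ! stays below 4 ^ n as well.
  no-gap : ∀ e → 6 ≤ e → (∀ {p} → Prime p → 4 ^ e < p → p ≤ 4 ^ e + suc (7 * 4 ^ e) → ⊥) → ⊥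
  no-gap e 6≤e none = <⇒≱ big small
    where
    open ≤-Reasoning
    n = 4 ^ e
    h = 4 * n
    -- M * M = 16 n exceeds N = 8 n + 1, and a power of two makes M ^ M comparable with 2 ^ h.
    M = 2 ^ (2 + e)
    N = n + suc (7 * n)
    X = primorial 0 N * (M ! * M !)
    x²≡n : 2 ^ e * 2 ^ e ≡ n
    x²≡n = sym (^-*-distrib 2 2 e)
    M²≡ : M * M ≡ 16 * n
    M²≡ = trans (t (2 ^ e)) (cong (16 *_) x²≡n)
      where
      t : ∀ x → 2 * (2 * x) * (2 * (2 * x)) ≡ 16 * (x * x)
      t = solve-∀
    N≡ : N ≡ suc (h + h)
    N≡ = t n
      where
      t : ∀ n → n + suc (7 * n) ≡ suc (4 * n + 4 * n)
      t = solve-∀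
    N<M² : N < M * M
    N<M² = begin-strict
      N ≡⟨ t n ⟩
      1 + 8 * n <⟨ s≤s (+-monoˡ-≤ (8 * n) (m^n>0 4 e)) ⟩
      suc (n + 8 * n) ≤⟨ +-monoˡ-≤ (n + 8 * n) (m^n>0 4 e) ⟩
      n + (n + 8 * n) ≤⟨ m≤m+n _ (6 * n) ⟩
      n + (n + 8 * n) + 6 * n ≡⟨ t' n ⟩
      16 * n ≡⟨ sym M²≡ ⟩
      M * M ∎
      where
      t : ∀ n → n + suc (7 * n) ≡ 1 + 8 * n
      t = solve-∀
      t' : ∀ n → n + (n + 8 * n) + 6 * n ≡ 16 * n
      t' = solve-∀
    X≢0 : NonZero X
    X≢0 = m*n≢0 (primorial 0 N) (M ! * M !) {{P≢0 N}} {{fact*fact≢0 M M}}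
      where
      part≢0 : ∀ x → NonZero x → NonZero (primePart x)
      part≢0 x nz with prime? x
      ... | yes _ = nz
      ... | no _ = _
      P≢0 : ∀ N → NonZero (primorial 0 N)
      P≢0 zero = _
      P≢0 (suc N) = m*n≢0 (primePart (suc N)) (primorial 0 N) {{part≢0 (suc N) _}} {{P≢0 N}}
    lower : 2 ^ h ≤ X
    lower = begin
      2 ^ h ≤⟨ 2^≤binom h ⟩
      binom h h ≤⟨ m≤n*m (binom h h) (suc (h + h)) ⟩
      suc (h + h) * binom h h ≤⟨ ∣⇒≤ {{X≢0}} (leibniz-∣ h h (λ x 1≤x x≤ → common-multiple N M N<M² x 1≤x (≤-trans x≤ (≤-reflexive (sym N≡))))) ⟩
      X ∎
    P≤ : primorial 0 N ≤ 2 ^ (2 * n)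
    P≤ = begin
      primorial 0 N ≡⟨ primorial-+ n (suc (7 * n)) ⟩
      primorial n (suc (7 * n)) * primorial 0 n ≡⟨ cong (_* primorial 0 n) (primorial-empty n (suc (7 * n)) none) ⟩
      1 * primorial 0 n ≡⟨ *-identityˡ _ ⟩
      primorial 0 n ≡⟨ cong (primorial 0) n≡ ⟩
      primorial 0 (2 ^ (2 * e)) ≤⟨ primorial≤4^ (2 * e) ⟩
      4 ^ (2 ^ (2 * e)) ≡⟨ cong (4 ^_) (sym n≡) ⟩
      4 ^ n ≡⟨ ^-*-assoc 2 2 n ⟩
      2 ^ (2 * n) ∎
      where
      n≡ : n ≡ 2 ^ (2 * e)
      n≡ = ^-*-assoc 2 2 e
    M!≤ : M ! ≤ 2 ^ ((2 + e) * M)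
    M!≤ = ≤-trans (!≤^ M ≤-refl) (≤-reflexive (^-*-assoc 2 (2 + e) M))
    small : 2 ^ h ≤ 2 ^ (2 * n + ((2 + e) * M + (2 + e) * M))
    small = begin
      2 ^ h ≤⟨ lower ⟩
      primorial 0 N * (M ! * M !) ≤⟨ *-mono-≤ P≤ (*-mono-≤ M!≤ M!≤) ⟩
      2 ^ (2 * n) * (2 ^ ((2 + e) * M) * 2 ^ ((2 + e) * M)) ≡⟨ cong (2 ^ (2 * n) *_) (sym (^-distribˡ-+-* 2 ((2 + e) * M) _)) ⟩
      2 ^ (2 * n) * 2 ^ ((2 + e) * M + (2 + e) * M) ≡⟨ sym (^-distribˡ-+-* 2 (2 * n) _) ⟩
      2 ^ (2 * n + ((2 + e) * M + (2 + e) * M)) ∎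
    big : 2 ^ (2 * n + ((2 + e) * M + (2 + e) * M)) < 2 ^ h
    big = ^-monoʳ-< 2 ≤-refl (begin-strict
      2 * n + ((2 + e) * M + (2 + e) * M) ≡⟨ t n e (2 ^ e) ⟩
      2 * n + 2 * (4 * (2 + e)) * 2 ^ e <⟨ +-monoʳ-< (2 * n) (*-monoˡ-< (2 ^ e) {{m^n≢0 2 e}} (*-monoʳ-< 2 (4[2+e]<2^e 6≤e))) ⟩
      2 * n + 2 * 2 ^ e * 2 ^ e ≡⟨ cong (2 * n +_) (trans (*-assoc 2 (2 ^ e) (2 ^ e)) (cong (2 *_) x²≡n)) ⟩
      2 * n + 2 * n ≡⟨ t' n ⟩
      h ∎)
      where
      t : ∀ n e x → 2 * n + ((2 + e) * (2 * (2 * x)) + (2 + e) * (2 * (2 * x))) ≡ 2 * n + 2 * (4 * (2 + e)) * x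
      t = solve-∀
      t' : ∀ n → 2 * n + 2 * n ≡ 4 * n
      t' = solve-∀

  ∃-below? : {P : ℕ → Set} → (∀ x → Dec (P x)) → ∀ b → (∃[ x ] P x) ⊎ (∀ x → x ≤ b → ¬ P x)
  ∃-below? P? zero with P? 0
  ... | yes px = inj₁ (0 , px)
  ... | no ¬p = inj₂ λ { zero z≤n → ¬p }
  ∃-below? P? (suc b) with P? (suc b) | ∃-below? P? b
  ... | yes px | _ = inj₁ (suc b , px)
  ... | no _ | inj₁ r = inj₁ r
  ... | no ¬p | inj₂ none = inj₂ λ x x≤ → go x x≤
    where
    go : ∀ x → x ≤ suc b → ¬ _
    go x x≤ with x ≟ suc b
    ... | yes refl = ¬p
    ... | no x≢ = none x (≤-pred (≤∧≢⇒< x≤ x≢))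

  prime-after-power : ∀ e → 6 ≤ e → ∃[ p ] Prime p × 4 ^ e < p × p ≤ 9 * 4 ^ e
  prime-after-power e 6≤e with ∃-below? (λ x → prime? x ×-dec ((4 ^ e <? x) ×-dec (x ≤? 9 * 4 ^ e))) (9 * 4 ^ e)
  ... | inj₁ r = r
  ... | inj₂ none = ⊥-elim (no-gap e 6≤e (λ {p} pp n<p p≤ → none p (≤-trans p≤ le) (pp , n<p , ≤-trans p≤ le)))
    where
    open ≤-Reasoning
    n = 4 ^ e
    t : ∀ n → n + (n + 7 * n) ≡ 9 * n
    t = solve-∀
    le : n + suc (7 * n) ≤ 9 * n
    le = begin
      n + suc (7 * n) ≤⟨ +-monoʳ-≤ n (+-monoˡ-≤ (7 * n) (m^n>0 4 e)) ⟩
      n + (n + 7 * n) ≡⟨ t n ⟩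
      9 * n ∎

  power-bracket : ∀ q e → 4 ^ e ≤ q → ∃[ d ] e ≤ d × 4 ^ d ≤ q × q ≤ 4 * 4 ^ d
  power-bracket q e q≥ = up q e q≥ (≤-trans (n≤4^ q) (^-monoʳ-≤ 4 (≤-trans (m≤m+n q e) (n≤1+n _))))
    where
    n≤4^ : ∀ n → n ≤ 4 ^ n
    n≤4^ zero = z≤n
    n≤4^ (suc n) = ≤-trans (+-mono-≤ (m^n>0 4 n) (n≤4^ n)) (+-monoʳ-≤ (4 ^ n) (m≤m+n (4 ^ n) _))
    up : ∀ fuel e → 4 ^ e ≤ q → q ≤ 4 ^ suc (fuel + e) → ∃[ d ] e ≤ d × 4 ^ d ≤ q × q ≤ 4 * 4 ^ d
    up zero e lo hi = e , ≤-refl , lo , hi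
    up (suc fuel) e lo hi with 4 ^ suc e ≤? q
    ... | no ¬lo = e , ≤-refl , lo , <⇒≤ (≰⇒> ¬lo)
    ... | yes lo' with up fuel (suc e) lo' (≤-trans hi (≤-reflexive (cong (λ x → 4 ^ suc x) (sym (+-suc fuel e)))))
    ...   | d , e<d , r = d , <⇒≤ e<d , r

  -- The prime is taken just after the power of 4 following q; 36 is 4, from the bracketing of q,
  -- times 9, from the gap bound.
  prime-in-[q,36q] : ∀ q → 4 ^ 6 ≤ q → ∃[ p ] Prime p × q ≤ p × p ≤ 36 * q
  prime-in-[q,36q] q q≥ with power-bracket q 6 q≥
  ... | d , 6≤d , lo , hi with prime-after-power (suc d) (≤-trans 6≤d (n≤1+n d))
  ...   | p , pp , n<p , p≤ = p , pp , ≤-trans hi (<⇒≤ n<p) , (begin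
    p              ≤⟨ p≤ ⟩
    9 * (4 * 4 ^ d) ≡⟨ sym (*-assoc 9 4 (4 ^ d)) ⟩
    36 * 4 ^ d     ≤⟨ *-monoʳ-≤ 36 lo ⟩
    36 * q ∎)
    where open ≤-Reasoning

-- Integer polynomials and a Bézout-type bound modulo p.

module NonsingularZeros where

  open import Data.Nat as ℕ using (ℕ; zero; suc; z≤n; s≤s)
  import Data.Nat.Properties as ℕₚ
  open import Data.Integer using (ℤ; +_; -_; 0ℤ; 1ℤ; _+_; _*_; _-_; _^_; _≟_)
  import Data.Integer as ℤ
  import Data.Integer.Properties as ℤₚ
  open import Data.Integer.Divisibility.Signed hiding (quotient)
  open import Data.Integer.Tactic.RingSolver using (solve-∀)
  open import Algebra.Properties.Semiring.Sum ℤₚ.+-*-semiring using (sum; sum-remove; sum-cong-≗; *-distribˡ-sum; *-distribʳ-sum)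
  open import Data.Fin using (Fin; zero; suc; toℕ; fromℕ<; punchIn; punchOut; combine; remQuot; finToFun; funToFin; _↑ˡ_; _↑ʳ_; quotient; remainder)
  import Data.Fin.Properties as Finₚ
  open import Data.Vec using (Vec; []; _∷_; tabulate)
  open import Data.Vec.Relation.Unary.All using (All; []; _∷_)
  open import Data.Vec.Functional using (insertAt) renaming (_∷_ to _∷ᶠ_)
  open import Data.Vec.Functional.Properties using (insertAt-lookup; insertAt-punchIn)
  open import Data.Product using (Σ; ∃-syntax; _×_; _,_; proj₁; proj₂)
  open import Data.Sum using (_⊎_; inj₁; inj₂; [_,_]′)
  open import Data.Empty using (⊥)
  open import Function using (_∘_; id)
  open import Relation.Nullary using (¬_; yes; no; contradiction; ¬?)
  open import Relation.Nullary.Decidable using (decidable-stable)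
  open import Relation.Binary.PropositionalEquality
  import Data.Nat.Divisibility as ℕ∣
  open import Data.Nat.Primality using (Prime; euclidsLemma; prime⇒nonZero; prime⇒nonTrivial)
  open import Data.Integer.DivMod using (_%ℕ_; _/ℕ_; n%ℕd<d; a≡a%ℕn+[a/ℕn]*n)
  import Data.Nat.Tactic.RingSolver as ℕSolver
  import Data.Vec.Relation.Unary.All.Properties as Allₚ
  open import Relation.Binary.Definitions using (tri<; tri≈; tri>)
  open PrimeGaps using (^-*-distrib)

  infixl 6 _⊕_
  infixl 7 _⊗_

  -- Expressions over ℤ and not over the field of p elements: the same polynomial is later studied
  -- modulo p, p² and arbitrary powers of p.
  data Poly (I : Set) : Set where
    con : ℤ → Poly I
    var : I → Poly I
    _⊕_ _⊗_ : Poly I → Poly I → Poly I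

  module _ {I : Set} where

    ⟦_⟧ : Poly I → (I → ℤ) → ℤ
    ⟦ con c ⟧ x = c
    ⟦ var i ⟧ x = x i
    ⟦ f ⊕ g ⟧ x = ⟦ f ⟧ x + ⟦ g ⟧ x
    ⟦ f ⊗ g ⟧ x = ⟦ f ⟧ x * ⟦ g ⟧ x

    -- An upper bound read off the expression; cancellation of leading terms is not noticed.
    deg : Poly I → ℕ
    deg (con _) = 0
    deg (var _) = 1
    deg (f ⊕ g) = deg f ℕ.⊔ deg g
    deg (f ⊗ g) = deg f ℕ.+ deg g

    ∂ : Poly I → (I → ℤ) → (I → ℤ) → ℤ
    ∂ (con _) x v = 0ℤ
    ∂ (var i) x v = v i
    ∂ (f ⊕ g) x v = ∂ f x v + ∂ g x v
    ∂ (f ⊗ g) x v = ∂ f x v * ⟦ g ⟧ x + ⟦ f ⟧ x * ∂ g x v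

    ⟦⟧-cong : ∀ f {x y} → x ≗ y → ⟦ f ⟧ x ≡ ⟦ f ⟧ y
    ⟦⟧-cong (con _) e = refl
    ⟦⟧-cong (var i) e = e i
    ⟦⟧-cong (f ⊕ g) e = cong₂ _+_ (⟦⟧-cong f e) (⟦⟧-cong g e)
    ⟦⟧-cong (f ⊗ g) e = cong₂ _*_ (⟦⟧-cong f e) (⟦⟧-cong g e)

    ∂-cong : ∀ f x {v w} → v ≗ w → ∂ f x v ≡ ∂ f x w
    ∂-cong (con _) x e = refl
    ∂-cong (var i) x e = e i
    ∂-cong (f ⊕ g) x e = cong₂ _+_ (∂-cong f x e) (∂-cong g x e)
    ∂-cong (f ⊗ g) x e = cong₂ _+_ (cong (_* ⟦ g ⟧ x) (∂-cong f x e)) (cong (⟦ f ⟧ x *_) (∂-cong g x e))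

    ∂-linear : ∀ f x a v w → ∂ f x (λ i → a * v i + w i) ≡ a * ∂ f x v + ∂ f x w
    ∂-linear (con _) x a v w = r a
      where
      r : ∀ a → 0ℤ ≡ a * 0ℤ + 0ℤ
      r = solve-∀
    ∂-linear (var i) x a v w = refl
    ∂-linear (f ⊕ g) x a v w = trans (cong₂ _+_ (∂-linear f x a v w) (∂-linear g x a v w)) (r a (∂ f x v) (∂ f x w) (∂ g x v) (∂ g x w))
      where
      r : ∀ a b c d e → a * b + c + (a * d + e) ≡ a * (b + d) + (c + e)
      r = solve-∀
    ∂-linear (f ⊗ g) x a v w = trans (cong₂ (λ s t → s * ⟦ g ⟧ x + ⟦ f ⟧ x * t) (∂-linear f x a v w) (∂-linear g x a v w))
        (r a (∂ f x v) (∂ f x w) (∂ g x v) (∂ g x w) (⟦ f ⟧ x) (⟦ g ⟧ x))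
      where
      r : ∀ a b c d e f g → (a * b + c) * g + f * (a * d + e) ≡ a * (b * g + f * d) + (c * g + f * e)
      r = solve-∀

    ∂-zero : ∀ f x → ∂ f x (λ _ → 0ℤ) ≡ 0ℤ
    ∂-zero (con _) x = refl
    ∂-zero (var i) x = refl
    ∂-zero (f ⊕ g) x rewrite ∂-zero f x | ∂-zero g x = refl
    ∂-zero (f ⊗ g) x rewrite ∂-zero f x | ∂-zero g x = r (⟦ f ⟧ x) (⟦ g ⟧ x)
      where
      r : ∀ a b → 0ℤ * b + a * 0ℤ ≡ 0ℤ
      r = solve-∀

    ∂-scale : ∀ f x a v → ∂ f x (λ i → a * v i) ≡ a * ∂ f x v
    ∂-scale f x a v = trans (∂-cong f x (λ i → sym (ℤₚ.+-identityʳ _))) (trans (∂-linear f x a v (λ _ → 0ℤ)) (trans (cong (_+_ (a * ∂ f x v)) (∂-zero f x)) (ℤₚ.+-identityʳ _)))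

    ∂-sub : ∀ f x v w → ∂ f x (λ i → v i - w i) ≡ ∂ f x v - ∂ f x w
    ∂-sub f x v w = trans (∂-cong f x (λ i → r (v i) (w i))) (trans (∂-linear f x (- 1ℤ) w v) (sym (r (∂ f x v) (∂ f x w))))
      where
      r : ∀ a b → a - b ≡ - 1ℤ * b + a
      r = solve-∀

    -- Used with d = p: modulo p² a displacement by p v changes the value by p times the derivative
    -- along v, whatever the remainder is.
    taylor : ∀ f x d v → ∃[ r ] ⟦ f ⟧ (λ i → x i + d * v i) ≡ ⟦ f ⟧ x + d * (∂ f x v + d * r)
    taylor (con c) x d v = 0ℤ , r c d
      where
      r : ∀ c d → c ≡ c + d * (0ℤ + d * 0ℤ)
      r = solve-∀
    taylor (var i) x d v = 0ℤ , r (x i) d (v i)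
      where
      r : ∀ x d v → x + d * v ≡ x + d * (v + d * 0ℤ)
      r = solve-∀
    taylor (f ⊕ g) x d v with taylor f x d v | taylor g x d v
    ... | s , eq | t , eq' = s + t , trans (cong₂ _+_ eq eq') (r (⟦ f ⟧ x) (⟦ g ⟧ x) d (∂ f x v) (∂ g x v) s t)
      where
      r : ∀ f g d F G s t → f + d * (F + d * s) + (g + d * (G + d * t)) ≡ f + g + d * (F + G + d * (s + t))
      r = solve-∀
    taylor (f ⊗ g) x d v with taylor f x d v | taylor g x d v
    ... | s , eq | t , eq' = ⟦ f ⟧ x * t + s * ⟦ g ⟧ x + (∂ f x v + d * s) * (∂ g x v + d * t) , trans (cong₂ _*_ eq eq') (r (⟦ f ⟧ x) (⟦ g ⟧ x) d (∂ f x v) (∂ g x v) s t)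
      where
      r : ∀ f g d F G s t → (f + d * (F + d * s)) * (g + d * (G + d * t)) ≡ f * g + d * (F * g + f * G + d * (f * t + s * g + (F + d * s) * (G + d * t)))
      r = solve-∀

    ⟦⟧-cong-mod : ∀ f {d x y} → (∀ i → d ∣ x i - y i) → d ∣ ⟦ f ⟧ x - ⟦ f ⟧ y
    ⟦⟧-cong-mod (con c) h = subst (_ ∣_) (sym (ℤₚ.+-inverseʳ c)) (divides 0ℤ refl)
    ⟦⟧-cong-mod (var i) h = h i
    ⟦⟧-cong-mod (f ⊕ g) {d} {x} {y} h = subst (d ∣_) (r (⟦ f ⟧ x) (⟦ g ⟧ x) (⟦ f ⟧ y) (⟦ g ⟧ y)) (∣m∣n⇒∣m+n (⟦⟧-cong-mod f h) (⟦⟧-cong-mod g h))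
      where
      r : ∀ a b c d → a - c + (b - d) ≡ a + b - (c + d)
      r = solve-∀
    ⟦⟧-cong-mod (f ⊗ g) {d} {x} {y} h = subst (d ∣_) (r (⟦ f ⟧ x) (⟦ g ⟧ x) (⟦ f ⟧ y) (⟦ g ⟧ y)) (∣m∣n⇒∣m+n (∣m⇒∣m*n (⟦ g ⟧ x) (⟦⟧-cong-mod f h)) (∣n⇒∣m*n (⟦ f ⟧ y) (⟦⟧-cong-mod g h)))
      where
      r : ∀ a b c d → (a - c) * b + c * (b - d) ≡ a * b - c * d
      r = solve-∀

    sumP prodP : ∀ {n} → (Fin n → Poly I) → Poly I
    sumP {zero}  f = con 0ℤ
    sumP {suc n} f = f zero ⊕ sumP (f ∘ suc)
    prodP {zero}  f = con 1ℤ
    prodP {suc n} f = f zero ⊗ prodP (f ∘ suc)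

    powP : Poly I → ℕ → Poly I
    powP f zero    = con 1ℤ
    powP f (suc e) = f ⊗ powP f e

    ⟦sumP⟧ : ∀ {n} (f : Fin n → Poly I) x → ⟦ sumP f ⟧ x ≡ sum (λ i → ⟦ f i ⟧ x)
    ⟦sumP⟧ {zero}  f x = refl
    ⟦sumP⟧ {suc n} f x = cong (_+_ (⟦ f zero ⟧ x)) (⟦sumP⟧ (f ∘ suc) x)

    deg-sumP : ∀ {n D} (f : Fin n → Poly I) → (∀ i → deg (f i) ℕ.≤ D) → deg (sumP f) ℕ.≤ D
    deg-sumP {zero}  f h = z≤n
    deg-sumP {suc n} f h = ℕₚ.⊔-lub (h zero) (deg-sumP (f ∘ suc) (h ∘ suc))

    deg-prodP : ∀ {n D} (f : Fin n → Poly I) → (∀ i → deg (f i) ℕ.≤ D) → deg (prodP f) ℕ.≤ n ℕ.* D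
    deg-prodP {zero}  f h = z≤n
    deg-prodP {suc n} f h = ℕₚ.+-mono-≤ (h zero) (deg-prodP (f ∘ suc) (h ∘ suc))

    deg-powP : ∀ {D} f e → deg f ℕ.≤ D → deg (powP f e) ℕ.≤ e ℕ.* D
    deg-powP f zero    h = z≤n
    deg-powP f (suc e) h = ℕₚ.+-mono-≤ h (deg-powP f e h)

  module _ {I J : Set} where

    _⟪_⟫ : Poly I → (I → Poly J) → Poly J
    con c   ⟪ σ ⟫ = con c
    var i   ⟪ σ ⟫ = σ i
    (f ⊕ g) ⟪ σ ⟫ = f ⟪ σ ⟫ ⊕ g ⟪ σ ⟫
    (f ⊗ g) ⟪ σ ⟫ = f ⟪ σ ⟫ ⊗ g ⟪ σ ⟫

    ⟦⟪⟫⟧ : ∀ f σ x → ⟦ f ⟪ σ ⟫ ⟧ x ≡ ⟦ f ⟧ (λ i → ⟦ σ i ⟧ x)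
    ⟦⟪⟫⟧ (con c) σ x = refl
    ⟦⟪⟫⟧ (var i) σ x = refl
    ⟦⟪⟫⟧ (f ⊕ g) σ x = cong₂ _+_ (⟦⟪⟫⟧ f σ x) (⟦⟪⟫⟧ g σ x)
    ⟦⟪⟫⟧ (f ⊗ g) σ x = cong₂ _*_ (⟦⟪⟫⟧ f σ x) (⟦⟪⟫⟧ g σ x)

    deg-⟪⟫ : ∀ f σ → (∀ i → deg (σ i) ℕ.≤ 1) → deg (f ⟪ σ ⟫) ℕ.≤ deg f
    deg-⟪⟫ (con c) σ h = z≤n
    deg-⟪⟫ (var i) σ h = h i
    deg-⟪⟫ (f ⊕ g) σ h = ℕₚ.⊔-mono-≤ (deg-⟪⟫ f σ h) (deg-⟪⟫ g σ h)
    deg-⟪⟫ (f ⊗ g) σ h = ℕₚ.+-mono-≤ (deg-⟪⟫ f σ h) (deg-⟪⟫ g σ h)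

  -- Linear algebra over ℤ

  sum-zero : ∀ {n} (t : Fin n → ℤ) → (∀ j → t j ≡ 0ℤ) → sum t ≡ 0ℤ
  sum-zero {zero}  t h = refl
  sum-zero {suc n} t h = cong₂ _+_ (h zero) (sum-zero (t ∘ suc) (h ∘ suc))

  -- Elimination without fractions: rows are multiplied by the pivot before column zero is cleared,
  -- so all coefficients stay integral.
  dependence : ∀ G {N} → G ℕ.< N → (M : Fin N → Fin G → ℤ) →
    Σ (Fin N → ℤ) λ c → (∃[ j ] c j ≢ 0ℤ) × (∀ g → sum (λ j → c j * M j g) ≡ 0ℤ)
  dependence zero {suc N} _ M = (λ _ → 1ℤ) , (zero , (λ ())) , λ ()
  dependence (suc G) {suc N} (s≤s G<N) M with Finₚ.any? (λ j → ¬? (M j zero ≟ 0ℤ))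
  ... | no none with dependence G (ℕₚ.m<n⇒m<1+n G<N) (λ j → M j ∘ suc)
  ...   | c , nz , rel = c , nz , λ where
          zero → sum-zero _ (λ j → trans (cong (c j *_) (decidable-stable (M j zero ≟ 0ℤ) (λ ne → none (j , ne)))) (ℤₚ.*-zeroʳ (c j)))
          (suc g) → rel g
  dependence (suc G) {suc N} (s≤s G<N) M | yes (j₀ , π≢0) = c , nz , rel
    where
    π = M j₀ zero
    X : Fin N → Fin (suc G) → ℤ
    X j = M (punchIn j₀ j)
    Y : Fin N → Fin G → ℤ
    Y j g = π * X j (suc g) - X j zero * M j₀ (suc g)
    reduced : Σ (Fin N → ℤ) λ c → (∃[ j ] c j ≢ 0ℤ) × (∀ g → sum (λ j → c j * Y j g) ≡ 0ℤ)
    reduced = dependence G G<N Y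
    c' = proj₁ reduced
    S : Fin (suc G) → ℤ
    S g = sum (λ j → c' j * X j g)
    -- The coefficient of the pivot row is chosen to cancel column zero; the other columns then
    -- reduce to the relation for `Y`.
    c = insertAt (λ j → π * c' j) j₀ (- S zero)
    sum-reduced : ∀ {n} (c x m : Fin n → ℤ) y →
      sum (λ j → c j * (π * x j - m j * y)) ≡ π * sum (λ j → c j * x j) - sum (λ j → c j * m j) * y
    sum-reduced {zero} c x m y = r π y
      where
      r : ∀ a b → 0ℤ ≡ a * 0ℤ - 0ℤ * b
      r = solve-∀
    sum-reduced {suc n} c x m y = trans (cong (_+_ (c zero * (π * x zero - m zero * y))) (sum-reduced (c ∘ suc) (x ∘ suc) (m ∘ suc) y))
        (r (c zero) (x zero) (m zero) y (sum (λ j → c (suc j) * x (suc j))) (sum (λ j → c (suc j) * m (suc j))) π)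
      where
      r : ∀ c x m y s t π → c * (π * x - m * y) + (π * s - t * y) ≡ π * (c * x + s) - (c * m + t) * y
      r = solve-∀
    total : ∀ g → sum (λ j → c j * M j g) ≡ - S zero * M j₀ g + π * S g
    total g = trans (sum-remove {i = j₀} (λ j → c j * M j g)) (cong₂ _+_ (cong (_* M j₀ g) (insertAt-lookup _ j₀ _))
      (trans (sum-cong-≗ (λ j → trans (cong (_* X j g) (insertAt-punchIn _ j₀ _ j)) (ℤₚ.*-assoc π (c' j) (X j g)))) (sym (*-distribˡ-sum π (λ j → c' j * X j g)))))
    rel : ∀ g → sum (λ j → c j * M j g) ≡ 0ℤ
    rel zero = trans (total zero) (r π (S zero))
      where
      r : ∀ a b → - b * a + a * b ≡ 0ℤ
      r = solve-∀
    rel (suc g) = trans (total (suc g)) (trans (r (S zero) (M j₀ (suc g)) π (S (suc g)))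
        (trans (sym (sum-reduced c' (λ j → X j (suc g)) (λ j → X j zero) (M j₀ (suc g)))) (proj₂ (proj₂ reduced) g)))
      where
      r : ∀ s m π t → - s * m + π * t ≡ π * t - s * m
      r = solve-∀
    nz : ∃[ j ] c j ≢ 0ℤ
    nz with proj₁ (proj₂ reduced)
    ... | j , c'j≢0 = punchIn j₀ j , λ e → nonzero (ℤₚ.i*j≡0⇒i≡0∨j≡0 π (trans (sym (insertAt-punchIn (λ j → π * c' j) j₀ (- S zero) j)) e))
      where
      nonzero : π ≡ 0ℤ ⊎ c' j ≡ 0ℤ → ⊥
      nonzero (inj₁ e) = π≢0 e
      nonzero (inj₂ e) = c'j≢0 e

  -- Univariate polynomials

  -- True of a prime and also of 0, for which divisibility by d means vanishing: one root count
  -- serves both residues modulo p and integers.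
  PrimeLike : ℤ → Set
  PrimeLike d = ∀ a b → d ∣ a * b → d ∣ a ⊎ d ∣ b

  horner : ∀ {n} → Vec ℤ n → ℤ → ℤ
  horner []       z = 0ℤ
  horner (c ∷ cs) z = c + z * horner cs z

  divideOut : ∀ {n} → Vec ℤ (suc n) → ℤ → Vec ℤ n
  divideOut (c ∷ [])         r = []
  divideOut (c ∷ cs@(_ ∷ _)) r = horner cs r ∷ divideOut cs r

  horner-divideOut : ∀ {n} (cs : Vec ℤ (suc n)) r z → horner cs z ≡ horner cs r + (z - r) * horner (divideOut cs r) z
  horner-divideOut (c ∷ []) r z = e c r z
    where
    e : ∀ c r z → c + z * 0ℤ ≡ c + r * 0ℤ + (z - r) * 0ℤ
    e = solve-∀
  horner-divideOut (c ∷ cs@(_ ∷ _)) r z = trans (cong (λ t → c + z * t) (horner-divideOut cs r z)) (e c r z (horner cs r) (horner (divideOut cs r) z))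
    where
    e : ∀ c r z h q → c + z * (h + (z - r) * q) ≡ c + r * h + (z - r) * (h + z * q)
    e = solve-∀

  divideOut-∣ : ∀ {n d} (cs : Vec ℤ (suc n)) r → All (d ∣_) (divideOut cs r) → d ∣ horner cs r → All (d ∣_) cs
  divideOut-∣ {d = d} (c ∷ []) r [] h = subst (d ∣_) (e c r) h ∷ []
    where
    e : ∀ c r → c + r * 0ℤ ≡ c
    e = solve-∀
  divideOut-∣ (c ∷ cs@(_ ∷ _)) r (h₀ ∷ hs) h = ∣m+n∣n⇒∣m h (∣n⇒∣m*n r h₀) ∷ divideOut-∣ cs r hs h₀

  -- Dividing out the last root keeps the earlier ones, because d divides no difference between two
  -- of the points; the quotient has one coefficient fewer.
  coefficients-∣ : ∀ {d} → PrimeLike d → ∀ {n} (cs : Vec ℤ n) → (∀ k → 0 ℕ.< k → k ℕ.< n → ¬ d ∣ + k) →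
    (∀ i → i ℕ.< n → d ∣ horner cs (+ i)) → All (d ∣_) cs
  coefficients-∣ pd [] _ _ = []
  coefficients-∣ {d} pd {suc n} cs@(_ ∷ _) sep h = divideOut-∣ cs (+ n) (coefficients-∣ pd (divideOut cs (+ n)) (λ k 0<k k<n → sep k 0<k (ℕₚ.m<n⇒m<1+n k<n)) root) (h n ℕₚ.≤-refl)
    where
    root : ∀ i → i ℕ.< n → d ∣ horner (divideOut cs (+ n)) (+ i)
    root i i<n with pd (+ i - + n) _ (∣m+n∣m⇒∣n (subst (d ∣_) (horner-divideOut cs (+ n) (+ i)) (h i (ℕₚ.m<n⇒m<1+n i<n))) (h n ℕₚ.≤-refl))
    ... | inj₂ r = r
    ... | inj₁ r = contradiction (subst (d ∣_) eq (∣m⇒∣-m r)) (sep (n ℕ.∸ i) (ℕₚ.m<n⇒0<n∸m i<n) (s≤s (ℕₚ.m∸n≤m n i)))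
      where
      e : ∀ a b → - (a - b) ≡ b - a
      e = solve-∀
      eq : - (+ i - + n) ≡ + (n ℕ.∸ i)
      eq = trans (e (+ i) (+ n)) (trans (ℤₚ.m-n≡m⊖n n i) (ℤₚ.⊖-≥ (ℕₚ.<⇒≤ i<n)))

  -- A property of functions, so that sums and products need no bookkeeping of coefficient vectors;
  -- these are extracted only for counting roots.
  IsPoly : ℕ → (ℤ → ℤ) → Set
  IsPoly zero    f = ∃[ a ] ∀ z → f z ≡ a
  IsPoly (suc D) f = ∃[ a ] ∃[ g ] IsPoly D g × (∀ z → f z ≡ a + z * g z)

  isPoly-suc : ∀ D {f} → IsPoly D f → IsPoly (suc D) f
  isPoly-suc zero (a , e) = a , (λ _ → 0ℤ) , (0ℤ , λ _ → refl) , λ z → trans (e z) (r a z)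
    where
    r : ∀ a z → a ≡ a + z * 0ℤ
    r = solve-∀
  isPoly-suc (suc D) (a , g , h , e) = a , g , isPoly-suc D h , e

  isPoly-≤ : ∀ {D E f} → D ℕ.≤′ E → IsPoly D f → IsPoly E f
  isPoly-≤ ℕ.≤′-refl h = h
  isPoly-≤ (ℕ.≤′-step D≤E) h = isPoly-suc _ (isPoly-≤ D≤E h)

  isPoly-+ : ∀ D {f g} → IsPoly D f → IsPoly D g → IsPoly D (λ z → f z + g z)
  isPoly-+ zero (a , e) (b , e') = a + b , λ z → cong₂ _+_ (e z) (e' z)
  isPoly-+ (suc D) (a , f , h , e) (b , g , h' , e') = a + b , (λ z → f z + g z) , isPoly-+ D h h' , λ z → trans (cong₂ _+_ (e z) (e' z)) (r a b z (f z) (g z))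
    where
    r : ∀ a b z f g → a + z * f + (b + z * g) ≡ a + b + z * (f + g)
    r = solve-∀

  isPoly-scale : ∀ D c {f} → IsPoly D f → IsPoly D (λ z → c * f z)
  isPoly-scale zero c (a , e) = c * a , λ z → cong (c *_) (e z)
  isPoly-scale (suc D) c (a , f , h , e) = c * a , (λ z → c * f z) , isPoly-scale D c h , λ z → trans (cong (c *_) (e z)) (r c a z (f z))
    where
    r : ∀ c a z f → c * (a + z * f) ≡ c * a + z * (c * f)
    r = solve-∀

  isPoly-ext : ∀ D {f g} → (∀ z → f z ≡ g z) → IsPoly D f → IsPoly D g
  isPoly-ext zero e (a , e') = a , λ z → trans (sym (e z)) (e' z)
  isPoly-ext (suc D) e (a , h , p , e') = a , h , p , λ z → trans (sym (e z)) (e' z)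

  isPoly-* : ∀ D E {f g} → IsPoly D f → IsPoly E g → IsPoly (D ℕ.+ E) (λ z → f z * g z)
  isPoly-* zero E {f} {g} (a , e) h = isPoly-ext E (λ z → cong (_* g z) (sym (e z))) (isPoly-scale E a h)
  isPoly-* (suc D) E {f} {g} (a , f' , h , e) h' = isPoly-ext (suc (D ℕ.+ E)) (λ z → trans (r a z (f' z) (g z)) (cong (_* g z) (sym (e z))))
    (isPoly-+ (suc (D ℕ.+ E)) (isPoly-≤ (ℕₚ.≤⇒≤′ (ℕₚ.≤-trans (ℕₚ.m≤n+m E D) (ℕₚ.n≤1+n _))) (isPoly-scale E a h')) (0ℤ , (λ z → f' z * g z) , isPoly-* D E h h' , λ z → refl))
    where
    r : ∀ a z f g → a * g + (0ℤ + z * (f * g)) ≡ (a + z * f) * g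
    r = solve-∀

  isPoly-horner : ∀ D {f} → IsPoly D f → ∃[ cs ] ∀ z → f z ≡ horner {suc D} cs z
  isPoly-horner zero (a , e) = a ∷ [] , λ z → trans (e z) (r a z)
    where
    r : ∀ a z → a ≡ a + z * 0ℤ
    r = solve-∀
  isPoly-horner (suc D) (a , g , h , e) with isPoly-horner D h
  ... | cs , e' = a ∷ cs , λ z → trans (e z) (cong (λ t → a + z * t) (e' z))

  ∣0 : ∀ d → d ∣ 0ℤ
  ∣0 d = divides 0ℤ refl

  primeLike-0 : PrimeLike 0ℤ
  primeLike-0 a b h with ℤₚ.i*j≡0⇒i≡0∨j≡0 a (0∣⇒≡0 h)
  ... | inj₁ e = inj₁ (subst (0ℤ ∣_) (sym e) (∣0 0ℤ))
  ... | inj₂ e = inj₂ (subst (0ℤ ∣_) (sym e) (∣0 0ℤ))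

  isPoly-zero : ∀ D {f} → IsPoly D f → (∀ i → i ℕ.≤ D → f (+ i) ≡ 0ℤ) → ∀ z → f z ≡ 0ℤ
  isPoly-zero D {f} h vanish z with isPoly-horner D h
  ... | cs , e = trans (e z) (zeros cs (coefficients-∣ primeLike-0 cs nz λ i i<n → subst (0ℤ ∣_) (trans (sym (vanish i (ℕₚ.≤-pred i<n))) (e (+ i))) (∣0 0ℤ)))
    where
    nz : ∀ k → 0 ℕ.< k → k ℕ.< suc D → ¬ 0ℤ ∣ + k
    nz (suc k) _ _ d with 0∣⇒≡0 d
    ... | ()
    zeros : ∀ {n} (cs : Vec ℤ n) → All (0ℤ ∣_) cs → horner cs z ≡ 0ℤ
    zeros [] [] = refl
    zeros (c ∷ cs) (h ∷ hs) rewrite 0∣⇒≡0 h | zeros cs hs = trans (ℤₚ.+-identityˡ _) (ℤₚ.*-zeroʳ z)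

  isPoly-⟦⟧ : ∀ {n} (P : Poly (Fin (suc n))) x → IsPoly (deg P) (λ z → ⟦ P ⟧ (z ∷ᶠ x))
  isPoly-⟦⟧ (con c) x = c , λ _ → refl
  isPoly-⟦⟧ (var zero) x = 0ℤ , (λ _ → 1ℤ) , (1ℤ , λ _ → refl) , λ z → r z
    where
    r : ∀ z → z ≡ 0ℤ + z * 1ℤ
    r = solve-∀
  isPoly-⟦⟧ (var (suc i)) x = isPoly-suc 0 (x i , λ _ → refl)
  isPoly-⟦⟧ (f ⊕ g) x = isPoly-+ _ (isPoly-≤ (ℕₚ.≤⇒≤′ (ℕₚ.m≤m⊔n (deg f) (deg g))) (isPoly-⟦⟧ f x)) (isPoly-≤ (ℕₚ.≤⇒≤′ (ℕₚ.m≤n⊔m (deg f) (deg g))) (isPoly-⟦⟧ g x))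
  isPoly-⟦⟧ (f ⊗ g) x = isPoly-* (deg f) (deg g) (isPoly-⟦⟧ f x) (isPoly-⟦⟧ g x)

  -- Fixing the first coordinate at a grid value leaves a polynomial that vanishes by induction, so
  -- in the first coordinate there are more roots than the degree allows. A polynomial identity thus
  -- amounts to finitely many linear equations.
  grid-zero : ∀ n (P : Poly (Fin n)) {Δ} → deg P ℕ.≤ Δ →
    (∀ (g : Fin n → Fin (suc Δ)) → ⟦ P ⟧ (λ i → + toℕ (g i)) ≡ 0ℤ) → ∀ x → ⟦ P ⟧ x ≡ 0ℤ
  grid-zero zero P deg≤ h x = trans (⟦⟧-cong P (λ ())) (h (λ ()))
  grid-zero (suc n) P {Δ} deg≤ h x = trans (⟦⟧-cong P (λ { zero → refl ; (suc i) → refl })) (isPoly-zero Δ (isPoly-≤ (ℕₚ.≤⇒≤′ deg≤) (isPoly-⟦⟧ P (x ∘ suc))) slice (x zero))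
    where
    fix : ℤ → Fin (suc n) → Poly (Fin n)
    fix z zero    = con z
    fix z (suc i) = var i
    fix-deg : ∀ z i → deg (fix z i) ℕ.≤ 1
    fix-deg z zero    = z≤n
    fix-deg z (suc i) = ℕₚ.≤-refl
    ⟦fix⟧ : ∀ z y → ⟦ P ⟪ fix z ⟫ ⟧ y ≡ ⟦ P ⟧ (z ∷ᶠ y)
    ⟦fix⟧ z y = trans (⟦⟪⟫⟧ P (fix z) y) (⟦⟧-cong P (λ { zero → refl ; (suc i) → refl }))
    slice : ∀ i → i ℕ.≤ Δ → ⟦ P ⟧ (+ i ∷ᶠ x ∘ suc) ≡ 0ℤ
    slice i i≤Δ = trans (sym (⟦fix⟧ (+ i) (x ∘ suc))) (grid-zero n (P ⟪ fix (+ i) ⟫) (ℕₚ.≤-trans (deg-⟪⟫ P (fix (+ i)) (fix-deg (+ i))) deg≤)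
      (λ g → trans (⟦fix⟧ (+ i) _) (trans (⟦⟧-cong P (λ { zero → cong +_ (sym (Finₚ.toℕ-fromℕ< (s≤s i≤Δ))) ; (suc j) → refl })) (h (fromℕ< (s≤s i≤Δ) ∷ᶠ g)))) (x ∘ suc))

  sum-+ : ∀ m {n} (t : Fin (m ℕ.+ n) → ℤ) → sum t ≡ sum (λ i → t (i ↑ˡ n)) + sum (λ j → t (m ↑ʳ j))
  sum-+ zero    t = sym (ℤₚ.+-identityˡ _)
  sum-+ (suc m) t = trans (cong (_+_ (t zero)) (sum-+ m (t ∘ suc))) (sym (ℤₚ.+-assoc (t zero) _ _))

  sum-combine : ∀ m n (t : Fin (m ℕ.* n) → ℤ) → sum t ≡ sum (λ i → sum (λ j → t (combine {m} {n} i j)))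
  sum-combine zero    n t = refl
  sum-combine (suc m) n t = trans (sum-+ n t) (cong (_+_ (sum (λ j → t (j ↑ˡ (m ℕ.* n))))) (sum-combine m n (λ i → t (n ↑ʳ i))))

  ∣-sum : ∀ {n d} (t : Fin n → ℤ) → (∀ i → d ∣ t i) → d ∣ sum t
  ∣-sum {zero}  t h = ∣0 _
  ∣-sum {suc n} t h = ∣m∣n⇒∣m+n (h zero) (∣-sum (t ∘ suc) (h ∘ suc))

  horner-tabulate : ∀ n (c : Fin n → ℤ) z → horner (tabulate c) z ≡ sum (λ a → c a * z ^ toℕ a)
  horner-tabulate zero c z = refl
  horner-tabulate (suc n) c z = cong₂ _+_ (sym (ℤₚ.*-identityʳ (c zero)))
    (trans (cong (z *_) (horner-tabulate n (c ∘ suc) z)) (trans (*-distribˡ-sum z (λ a → c (suc a) * z ^ toℕ a)) (sum-cong-≗ {x = λ a → z * (c (suc a) * z ^ toℕ a)} {y = λ a → c (suc a) * (z * z ^ toℕ a)} (λ a → r z (c (suc a)) (z ^ toℕ a)))))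
    where
    r : ∀ z c w → z * (c * w) ≡ c * (z * w)
    r = solve-∀

  -- Exponent vectors with entries ≤ A are numbered by Fin (suc A ^ n).

  monomial : ∀ {I : Set} A {n} → (Fin n → Poly I) → Fin (suc A ℕ.^ n) → Poly I
  monomial A {zero}  f a = con 1ℤ
  monomial A {suc n} f a = powP (f zero) (toℕ (quotient {suc A} (suc A ℕ.^ n) a)) ⊗ monomial A (f ∘ suc) (remainder {suc A} (suc A ℕ.^ n) a)

  monomialAt : ∀ A {n} → (Fin n → ℤ) → Fin (suc A ℕ.^ n) → ℤ
  monomialAt A {zero}  w a = 1ℤ
  monomialAt A {suc n} w a = w zero ^ toℕ (quotient {suc A} (suc A ℕ.^ n) a) * monomialAt A (w ∘ suc) (remainder {suc A} (suc A ℕ.^ n) a)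

  ⟦powP⟧ : ∀ {I : Set} (f : Poly I) e x → ⟦ powP f e ⟧ x ≡ ⟦ f ⟧ x ^ e
  ⟦powP⟧ f zero    x = refl
  ⟦powP⟧ f (suc e) x = cong (⟦ f ⟧ x *_) (⟦powP⟧ f e x)

  ⟦monomial⟧ : ∀ {I : Set} A {n} (f : Fin n → Poly I) a x → ⟦ monomial A f a ⟧ x ≡ monomialAt A (λ ξ → ⟦ f ξ ⟧ x) a
  ⟦monomial⟧ A {zero}  f a x = refl
  ⟦monomial⟧ A {suc n} f a x = cong₂ _*_ (⟦powP⟧ (f zero) (toℕ (quotient {suc A} (suc A ℕ.^ n) a)) x) (⟦monomial⟧ A (f ∘ suc) (remainder {suc A} (suc A ℕ.^ n) a) x)

  deg-monomial : ∀ {I : Set} A {n R} (f : Fin n → Poly I) a → (∀ ξ → deg (f ξ) ℕ.≤ R) → deg (monomial A f a) ℕ.≤ n ℕ.* (A ℕ.* R)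
  deg-monomial A {zero}  f a h = z≤n
  deg-monomial A {suc n} {R} f a h = ℕₚ.+-mono-≤ (ℕₚ.≤-trans (deg-powP (f zero) e (h zero)) (ℕₚ.*-monoˡ-≤ R (ℕₚ.≤-pred (Finₚ.toℕ<n (quotient {suc A} (suc A ℕ.^ n) a))))) (deg-monomial A (f ∘ suc) (remainder {suc A} (suc A ℕ.^ n) a) (h ∘ suc))
    where e = toℕ (quotient {suc A} (suc A ℕ.^ n) a)

  ^-distrib-* : ∀ a b e → (a * b) ^ e ≡ a ^ e * b ^ e
  ^-distrib-* a b zero    = refl
  ^-distrib-* a b (suc e) = trans (cong (a * b *_) (^-distrib-* a b e)) (r a b (a ^ e) (b ^ e))
    where
    r : ∀ a b x y → a * b * (x * y) ≡ a * x * (b * y)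
    r = solve-∀

  monomialAt-* : ∀ A {n} (u w : Fin n → ℤ) a → monomialAt A (λ ξ → u ξ * w ξ) a ≡ monomialAt A u a * monomialAt A w a
  monomialAt-* A {zero}  u w a = refl
  monomialAt-* A {suc n} u w a = trans (cong₂ _*_ (^-distrib-* (u zero) (w zero) e) (monomialAt-* A (u ∘ suc) (w ∘ suc) _)) (r (u zero ^ e) (w zero ^ e) (monomialAt A (u ∘ suc) a') (monomialAt A (w ∘ suc) a'))
    where
    e = toℕ (quotient {suc A} (suc A ℕ.^ n) a)
    a' = remainder {suc A} (suc A ℕ.^ n) a
    r : ∀ a b x y → a * b * (x * y) ≡ a * x * (b * y)
    r = solve-∀

  monomialAt-cong : ∀ A {n} {u w : Fin n → ℤ} a → u ≗ w → monomialAt A u a ≡ monomialAt A w a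
  monomialAt-cong A {zero}  a h = refl
  monomialAt-cong A {suc n} a h = cong₂ _*_ (cong (_^ toℕ (quotient {suc A} (suc A ℕ.^ n) a)) (h zero)) (monomialAt-cong A _ (h ∘ suc))

  monomialAt-combine : ∀ A {n} (w : Fin (suc n) → ℤ) e a → monomialAt A w (combine {suc A} {suc A ℕ.^ n} e a) ≡ w zero ^ toℕ e * monomialAt A (w ∘ suc) a
  monomialAt-combine A {n} w e a = cong (λ r → w zero ^ toℕ (proj₁ r) * monomialAt A (w ∘ suc) (proj₂ r)) (Finₚ.remQuot-combine {suc A} {suc A ℕ.^ n} e a)

  -- For fixed remaining variables the sum is a polynomial in the first variable with suc A
  -- coefficients; each of them is again such a sum in one variable fewer.
  multi-coefficients-∣ : ∀ {d} → PrimeLike d → ∀ {A} → (∀ k → 0 ℕ.< k → k ℕ.< suc A → ¬ d ∣ + k) →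
    ∀ n (c : Fin (suc A ℕ.^ n) → ℤ) → (∀ w → d ∣ sum (λ a → c a * monomialAt A {n} w a)) → ∀ a → d ∣ c a
  multi-coefficients-∣ {d} pd sep zero c h zero = subst (d ∣_) (r (c zero)) (h (λ ()))
    where
    r : ∀ c → c * 1ℤ + 0ℤ ≡ c
    r = solve-∀
  multi-coefficients-∣ {d} pd {A} sep (suc n) c h a =
    subst (λ a → d ∣ c a) (Finₚ.combine-remQuot {suc A} (suc A ℕ.^ n) a)
      (multi-coefficients-∣ pd sep n (λ a' → c (combine e a')) (λ w → Allₚ.tabulate⁻ {f = q w} (slice w) e) (proj₂ (remQuot {suc A} (suc A ℕ.^ n) a)))
    where
    N = suc A ℕ.^ n
    e = proj₁ (remQuot {suc A} N a)
    q : (Fin n → ℤ) → Fin (suc A) → ℤ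
    q w e = sum (λ a' → c (combine {suc A} {N} e a') * monomialAt A w a')
    cons : ℤ → (Fin n → ℤ) → Fin (suc n) → ℤ
    cons z w zero    = z
    cons z w (suc i) = w i
    factor : ∀ z w → sum (λ a → c a * monomialAt A (cons z w) a) ≡ horner (tabulate (q w)) z
    factor z w = trans (sum-combine (suc A) N (λ a → c a * monomialAt A (cons z w) a)) (trans (sum-cong-≗ {x = λ e → sum (λ a' → c (combine {suc A} {N} e a') * monomialAt A (cons z w) (combine {suc A} {N} e a'))} {y = λ e → q w e * z ^ toℕ e} inner) (sym (horner-tabulate (suc A) (q w) z)))
      where
      r : ∀ c x y → c * (x * y) ≡ c * y * x
      r = solve-∀
      inner : ∀ e → sum (λ a' → c (combine {suc A} {N} e a') * monomialAt A (cons z w) (combine {suc A} {N} e a')) ≡ q w e * z ^ toℕ e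
      inner e = trans (sum-cong-≗ (λ a' → trans (cong (c (combine {suc A} {N} e a') *_) (monomialAt-combine A (cons z w) e a')) (r (c (combine {suc A} {N} e a')) (z ^ toℕ e) (monomialAt A w a')))) (sym (*-distribʳ-sum (z ^ toℕ e) (λ a' → c (combine {suc A} {N} e a') * monomialAt A w a')))
    slice : ∀ w → All (d ∣_) (tabulate (q w))
    slice w = coefficients-∣ pd (tabulate (q w)) sep (λ i _ → subst (d ∣_) (factor (+ i) w) (h (cons (+ i) w)))

  injective⇒surjective : ∀ {N} (f : Fin N → Fin N) → (∀ {x y} → f x ≡ f y → x ≡ y) → ∀ y → ∃[ x ] f x ≡ y
  injective⇒surjective {suc N} f inj y with Finₚ.any? (λ x → f x Finₚ.≟ y)
  ... | yes r = r
  ... | no none = contradiction (Finₚ.injective⇒≤ {f = λ x → punchOut (ne x)} (λ {a} {b} e → inj (Finₚ.punchOut-injective (ne a) (ne b) e))) ℕₚ.1+n≰n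
    where
    ne : ∀ x → y ≢ f x
    ne x e = none (x , sym e)

  -- A record, so that a and b can be inferred.
  record Mod (d a b : ℤ) : Set where
    constructor modulo
    field ∣-diff : d ∣ a - b

  Mod-trans : ∀ {d a b c} → Mod d a b → Mod d b c → Mod d a c
  Mod-trans {d} {a} {b} {c} (modulo h) (modulo h') = modulo (subst (d ∣_) (r a b c) (∣m∣n⇒∣m+n h h'))
    where
    r : ∀ a b c → a - b + (b - c) ≡ a - c
    r = solve-∀

  Mod-sym : ∀ {d a b} → Mod d a b → Mod d b a
  Mod-sym {d} {a} {b} (modulo h) = modulo (subst (d ∣_) (r a b) (∣m⇒∣-m h))
    where
    r : ∀ a b → - (a - b) ≡ b - a
    r = solve-∀

  Mod-∣ : ∀ {d a b} → Mod d a b → d ∣ a → d ∣ b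
  Mod-∣ {d} {a} {b} (modulo h) h' = subst (d ∣_) (r a b) (∣m∣n⇒∣m-n h' h)
    where
    r : ∀ a b → a - (a - b) ≡ b
    r = solve-∀

  module _ {p : ℕ} (pp : Prime p) where

    primeLike-prime : PrimeLike (+ p)
    primeLike-prime a b h with euclidsLemma ℤ.∣ a ∣ ℤ.∣ b ∣ pp (subst (p ℕ∣.∣_) (ℤₚ.abs-* a b) (∣⇒∣ᵤ h))
    ... | inj₁ d = inj₁ (∣ᵤ⇒∣ d)
    ... | inj₂ d = inj₂ (∣ᵤ⇒∣ d)

    ∤-small : ∀ k → 0 ℕ.< k → k ℕ.< p → ¬ + p ∣ + k
    ∤-small (suc k) _ k<p d = ℕₚ.<⇒≱ k<p (ℕ∣.∣⇒≤ (∣⇒∣ᵤ d))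

    private instance
      p≢0 : ℕ.NonZero p
      p≢0 = prime⇒nonZero pp

    residue : ℤ → Fin p
    residue z = fromℕ< (n%ℕd<d z p)

    residue-≡ : ∀ z → Mod (+ p) z (+ toℕ (residue z))
    residue-≡ z = modulo (divides (z /ℕ p) (trans (cong₂ _-_ (a≡a%ℕn+[a/ℕn]*n z p) (cong +_ (Finₚ.toℕ-fromℕ< (n%ℕd<d z p)))) (r (+ (z %ℕ p)) ((z /ℕ p) * + p))))
      where
      r : ∀ a b → a + b - a ≡ b
      r = solve-∀

    residue-eq : ∀ {a b} → residue a ≡ residue b → Mod (+ p) a b
    residue-eq {a} {b} e = Mod-trans (residue-≡ a) (subst (λ r → Mod (+ p) (+ toℕ r) b) (sym e) (Mod-sym (residue-≡ b)))

    Mod⇒≡ : ∀ (a b : Fin p) → Mod (+ p) (+ toℕ a) (+ toℕ b) → a ≡ b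
    Mod⇒≡ a b h with ℕₚ.<-cmp (toℕ a) (toℕ b)
    ... | tri≈ _ e _ = Finₚ.toℕ-injective e
    ... | tri< a<b _ _ = contradiction (subst (+ p ∣_) (trans (ℤₚ.m-n≡m⊖n (toℕ b) (toℕ a)) (ℤₚ.⊖-≥ (ℕₚ.<⇒≤ a<b))) (Mod.∣-diff (Mod-sym h)))
        (∤-small (toℕ b ℕ.∸ toℕ a) (ℕₚ.m<n⇒0<n∸m a<b) (ℕₚ.≤-<-trans (ℕₚ.m∸n≤m (toℕ b) (toℕ a)) (Finₚ.toℕ<n b)))
    ... | tri> _ _ b<a = contradiction (subst (+ p ∣_) (trans (ℤₚ.m-n≡m⊖n (toℕ a) (toℕ b)) (ℤₚ.⊖-≥ (ℕₚ.<⇒≤ b<a))) (Mod.∣-diff h))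
        (∤-small (toℕ a ℕ.∸ toℕ b) (ℕₚ.m<n⇒0<n∸m b<a) (ℕₚ.≤-<-trans (ℕₚ.m∸n≤m (toℕ a) (toℕ b)) (Finₚ.toℕ<n a)))

    -- Trivial kernel makes the affine map injective on the p ^ n residue vectors, and an injective
    -- self-map of a finite set is onto. Hence the local coordinates at a nonsingular zero take all
    -- residues.
    affine-surjective : ∀ {n} (f : Fin n → Poly (Fin n)) x (t : Fin n → ℤ) →
      (∀ v → (∀ ξ → + p ∣ ∂ (f ξ) x v) → ∀ ξ → + p ∣ v ξ) →
      ∀ w → ∃[ v ] ∀ ξ → Mod (+ p) (t ξ + ∂ (f ξ) x v) (w ξ)
    affine-surjective {n} f x t inj w = digits y , λ ξ → residue-eq {t ξ + ∂ (f ξ) x (digits y)} {w ξ} (begin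
        residue (t ξ + ∂ (f ξ) x (digits y)) ≡⟨ sym (Finₚ.finToFun-funToFin (image y) ξ) ⟩
        finToFun (φ y) ξ                     ≡⟨ cong (λ z → finToFun z ξ) (proj₂ hit) ⟩
        finToFun (funToFin (residue ∘ w)) ξ  ≡⟨ Finₚ.finToFun-funToFin (residue ∘ w) ξ ⟩
        residue (w ξ) ∎)
      where
      open ≡-Reasoning
      digits : Fin (p ℕ.^ n) → Fin n → ℤ
      digits y ξ = + toℕ (finToFun y ξ)
      image : Fin (p ℕ.^ n) → Fin n → Fin p
      image y ξ = residue (t ξ + ∂ (f ξ) x (digits y))
      φ : Fin (p ℕ.^ n) → Fin (p ℕ.^ n)
      φ y = funToFin (image y)
      φ-inj : ∀ {y y'} → φ y ≡ φ y' → y ≡ y'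
      φ-inj {y} {y'} e = trans (sym (Finₚ.funToFin-finToFin {n} y)) (trans (funToFin-cong (λ ξ → Mod⇒≡ (finToFun y ξ) (finToFun y' ξ) (modulo (inj (λ ξ → digits y ξ - digits y' ξ) ker ξ)))) (Finₚ.funToFin-finToFin {n} y'))
        where
        funToFin-cong : ∀ {n} {g h : Fin n → Fin p} → g ≗ h → funToFin g ≡ funToFin h
        funToFin-cong {zero} e = refl
        funToFin-cong {suc n} e = cong₂ combine (e zero) (funToFin-cong (e ∘ suc))
        r : ∀ t a b → t + a - (t + b) ≡ a - b
        r = solve-∀
        ker : ∀ ξ → + p ∣ ∂ (f ξ) x (λ ξ → digits y ξ - digits y' ξ)
        ker ξ = subst (+ p ∣_) (trans (r (t ξ) (∂ (f ξ) x (digits y)) (∂ (f ξ) x (digits y'))) (sym (∂-sub (f ξ) x (digits y) (digits y'))))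
          (Mod.∣-diff (residue-eq {t ξ + ∂ (f ξ) x (digits y)} {t ξ + ∂ (f ξ) x (digits y')} (trans (sym (Finₚ.finToFun-funToFin (image y) ξ)) (trans (cong (λ z → finToFun z ξ) e) (Finₚ.finToFun-funToFin (image y') ξ)))))
      hit = injective⇒surjective φ φ-inj (funToFin (residue ∘ w))
      y = proj₁ hit

    prodP-∣ : ∀ {I : Set} {n} (f : Fin n → Poly I) x i → + p ∣ ⟦ f i ⟧ x → + p ∣ ⟦ prodP f ⟧ x
    prodP-∣ f x zero    h = ∣m⇒∣m*n _ h
    prodP-∣ f x (suc i) h = ∣n⇒∣m*n (⟦ f zero ⟧ x) (prodP-∣ (f ∘ suc) x i h)

    ∤1ℤ : ¬ + p ∣ 1ℤ
    ∤1ℤ = ∤-small 1 (s≤s z≤n) (ℕ.nonTrivial⇒n>1 p {{prime⇒nonTrivial pp}})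

    prodP-∤ : ∀ {I : Set} {n} (f : Fin n → Poly I) x → (∀ i → ¬ + p ∣ ⟦ f i ⟧ x) → ¬ + p ∣ ⟦ prodP f ⟧ x
    prodP-∤ {n = zero}  f x h = ∤1ℤ
    prodP-∤ {n = suc n} f x h d with primeLike-prime (⟦ f zero ⟧ x) (⟦ prodP (f ∘ suc) ⟧ x) d
    ... | inj₁ d₀ = h zero d₀
    ... | inj₂ d₁ = prodP-∤ (f ∘ suc) x (h ∘ suc) d₁

    isolate-∣ : ∀ {m} (t : Fin m → ℤ) i → sum t ≡ 0ℤ → (∀ l → l ≢ i → + p ∣ t l) → + p ∣ t i
    isolate-∣ {suc m} t i eq h = ∣m+n∣n⇒∣m {m = t i} {n = sum (λ l → t (punchIn i l))} (subst (+ p ∣_) (trans (sym eq) (sum-remove {i = i} t)) (∣0 (+ p))) (∣-sum (λ l → t (punchIn i l)) (λ l → h (punchIn i l) (Finₚ.punchInᵢ≢i i l)))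

    not-∣-all-powers : ∀ z → z ≢ 0ℤ → (∀ N → (+ p) ^ N ∣ z) → ⊥
    not-∣-all-powers z z≢0 h = ℕₚ.<⇒≱ (n<p^n ℤ.∣ z ∣) (subst (ℕ._≤ ℤ.∣ z ∣) (abs-^ ℤ.∣ z ∣) (ℕ∣.∣⇒≤ {{ℕ.≢-nonZero (λ e → z≢0 (ℤₚ.∣i∣≡0⇒i≡0 e))}} (∣⇒∣ᵤ (h ℤ.∣ z ∣))))
      where
      abs-^ : ∀ N → ℤ.∣ (+ p) ^ N ∣ ≡ p ℕ.^ N
      abs-^ zero    = refl
      abs-^ (suc N) = trans (ℤₚ.abs-* (+ p) ((+ p) ^ N)) (cong (p ℕ.*_) (abs-^ N))
      n<p^n : ∀ n → n ℕ.< p ℕ.^ n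
      n<p^n zero    = s≤s z≤n
      n<p^n (suc n) = ℕₚ.≤-<-trans (n<p^n n) (ℕₚ.^-monoʳ-< p (ℕ.nonTrivial⇒n>1 p {{prime⇒nonTrivial pp}}) (ℕₚ.n<1+n n))

    module _ {n R K : ℕ} (K-big : suc (n ℕ.* R) ℕ.^ n ℕ.< K) (K<p : K ℕ.< p)
      (f : Fin n → Poly (Fin n)) (deg-f : ∀ ξ → deg (f ξ) ℕ.≤ R)
      (ζ : Fin K → Fin n → ℤ)
      (separated : ∀ i l → i ≢ l → ∃[ κ ] ¬ + p ∣ ζ i κ - ζ l κ)
      (vanishing : ∀ i ξ → + p ∣ ⟦ f ξ ⟧ (ζ i))
      (nonsingular : ∀ i v → (∀ ξ → + p ∣ ∂ (f ξ) (ζ i) v) → ∀ ξ → + p ∣ v ξ) where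

      private
        h-factor : Fin K → Fin K → Poly (Fin n)
        h-factor i l with i Finₚ.≟ l
        ... | yes _ = con 1ℤ
        ... | no i≢l = var κ ⊕ con (- ζ l κ)
          where κ = proj₁ (separated i l i≢l)

        -- An indicator of the i-th zero modulo p: each factor is a coordinate difference that
        -- separates `ζ i` from another zero, so `h i` is a unit near `ζ i` and divisible by p near
        -- the others.
        h : Fin K → Poly (Fin n)
        h i = prodP (h-factor i)

        deg-h-factor : ∀ i l → deg (h-factor i l) ℕ.≤ 1
        deg-h-factor i l with i Finₚ.≟ l
        ... | yes _ = z≤n
        ... | no _ = ℕₚ.≤-refl

        near : Fin K → (Fin n → ℤ) → Fin n → ℤ
        near i v ξ = ζ i ξ + + p * v ξ

        h-off : ∀ l i v → l ≢ i → + p ∣ ⟦ h l ⟧ (near i v)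
        h-off l i v l≢i = prodP-∣ (h-factor l) (near i v) i fact
          where
          r : ∀ a b c → a + b * c + - a ≡ c * b
          r = solve-∀
          fact : + p ∣ ⟦ h-factor l i ⟧ (near i v)
          fact with l Finₚ.≟ i
          ... | yes e = contradiction e l≢i
          ... | no ne = divides (v κ) (r (ζ i κ) (+ p) (v κ))
            where κ = proj₁ (separated l i ne)

        h-on : ∀ i v → ¬ + p ∣ ⟦ h i ⟧ (near i v)
        h-on i v = prodP-∤ (h-factor i) (near i v) fact
          where
          r : ∀ a b c d → a + b * c + - d ≡ c * b + (a - d)
          r = solve-∀
          fact : ∀ l → ¬ + p ∣ ⟦ h-factor i l ⟧ (near i v)
          fact l d with i Finₚ.≟ l
          ... | yes _ = ∤1ℤ d
          ... | no ne = proj₂ (separated i l ne) (∣m+n∣m⇒∣n (subst (+ p ∣_) (r (ζ i κ) (+ p) (v κ) (ζ l κ)) d) (divides (v κ) refl))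
            where κ = proj₁ (separated i l ne)

        S = suc K ℕ.^ n
        Δ = K ℕ.* 1 ℕ.+ n ℕ.* (K ℕ.* R)

        basis : Fin (K ℕ.* S) → Poly (Fin n)
        basis j = h (proj₁ (remQuot {K} S j)) ⊗ monomial K f (proj₂ (remQuot {K} S j))

        deg-basis : ∀ j → deg (basis j) ℕ.≤ Δ
        deg-basis j = ℕₚ.+-mono-≤ (deg-prodP (h-factor i) (deg-h-factor i)) (deg-monomial K f (proj₂ (remQuot {K} S j)) deg-f)
          where i = proj₁ (remQuot {K} S j)

        gridPoint : Fin (suc Δ ℕ.^ n) → Fin n → ℤ
        gridPoint g ξ = + toℕ (finToFun g ξ)

        -- Since Δ + 1 ≤ (n R + 1) (K + 1), the grid has at most (n R + 1) ^ n (K + 1) ^ n points,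
        -- against K (K + 1) ^ n basis functions. This is the origin of the bound on K.
        few-equations : suc Δ ℕ.^ n ℕ.< K ℕ.* S
        few-equations = begin-strict
          suc Δ ℕ.^ n                            ≤⟨ ℕₚ.^-monoˡ-≤ n (ℕₚ.≤-trans (ℕₚ.m≤m+n (suc Δ) (n ℕ.* R)) (ℕₚ.≤-reflexive (r n R K))) ⟩
          (suc (n ℕ.* R) ℕ.* suc K) ℕ.^ n        ≡⟨ ^-*-distrib (suc (n ℕ.* R)) (suc K) n ⟩
          suc (n ℕ.* R) ℕ.^ n ℕ.* suc K ℕ.^ n    <⟨ ℕₚ.*-monoˡ-< (suc K ℕ.^ n) {{ℕₚ.m^n≢0 (suc K) n}} K-big ⟩
          K ℕ.* suc K ℕ.^ n                      ∎
          where
          open ℕₚ.≤-Reasoning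
          r : ∀ n R K → suc (K ℕ.* 1 ℕ.+ n ℕ.* (K ℕ.* R)) ℕ.+ n ℕ.* R ≡ suc (n ℕ.* R) ℕ.* suc K
          r = ℕSolver.solve-∀

        relation : Σ (Fin (K ℕ.* S) → ℤ) λ c → (∃[ j ] c j ≢ 0ℤ) × (∀ g → sum (λ j → c j * ⟦ basis j ⟧ (gridPoint g)) ≡ 0ℤ)
        relation = dependence (suc Δ ℕ.^ n) few-equations (λ j g → ⟦ basis j ⟧ (gridPoint g))

        c : Fin K → Fin S → ℤ
        c i a = proj₁ relation (combine i a)

        values : (Fin n → ℤ) → Fin n → ℤ
        values x ξ = ⟦ f ξ ⟧ x

        relation-everywhere : ∀ x → sum (λ i → sum (λ a → c i a * (⟦ h i ⟧ x * monomialAt K (values x) a))) ≡ 0ℤ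
        relation-everywhere x = begin
          sum (λ i → sum (λ a → c i a * (⟦ h i ⟧ x * monomialAt K (values x) a)))
            ≡⟨ sum-cong-≗ {x = λ i → sum (λ a → c i a * (⟦ h i ⟧ x * monomialAt K (values x) a))} {y = λ i → sum (λ a → c i a * ⟦ basis (combine i a) ⟧ x)}
                 (λ i → sum-cong-≗ {x = λ a → c i a * (⟦ h i ⟧ x * monomialAt K (values x) a)} {y = λ a → c i a * ⟦ basis (combine i a) ⟧ x} (λ a → cong (c i a *_) (term i a))) ⟩
          sum (λ i → sum (λ a → c i a * ⟦ basis (combine i a) ⟧ x))
            ≡⟨ sym (sum-combine K S (λ j → proj₁ relation j * ⟦ basis j ⟧ x)) ⟩
          sum (λ j → proj₁ relation j * ⟦ basis j ⟧ x)
            ≡⟨ sym (⟦sumP⟧ terms x) ⟩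
          ⟦ sumP terms ⟧ x
            ≡⟨ grid-zero n (sumP terms) (deg-sumP terms deg-basis) on-grid x ⟩
          0ℤ ∎
          where
          open ≡-Reasoning
          terms : Fin (K ℕ.* S) → Poly (Fin n)
          terms j = con (proj₁ relation j) ⊗ basis j
          on-grid : ∀ g → ⟦ sumP terms ⟧ (λ i → + toℕ (g i)) ≡ 0ℤ
          on-grid g = trans (⟦⟧-cong (sumP terms) (λ i → cong (λ a → + toℕ a) (sym (Finₚ.finToFun-funToFin g i)))) (trans (⟦sumP⟧ terms (gridPoint (funToFin g))) (proj₂ (proj₂ relation) (funToFin g)))
          term : ∀ i a → ⟦ h i ⟧ x * monomialAt K (values x) a ≡ ⟦ basis (combine i a) ⟧ x
          term i a = trans (cong (⟦ h i ⟧ x *_) (sym (⟦monomial⟧ K f a x))) (cong (λ r → ⟦ h (proj₁ r) ⟧ x * ⟦ monomial K f (proj₂ r) ⟧ x) (sym (Finₚ.remQuot-combine {K} {S} i a)))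

        weight : Fin S → ℤ
        weight = monomialAt K {n} (λ _ → + p)

        f/p : Fin K → Fin n → ℤ
        f/p i ξ = _∣_.quotient (vanishing i ξ)

        -- At a zero modulo p both the value and the first-order change carry a factor p. The
        -- quotient u is the local coordinate, and its residue is an affine function of v.
        scaled : ∀ i v → ∃[ u ] (∀ ξ → values (near i v) ξ ≡ + p * u ξ) × (∀ ξ → Mod (+ p) (u ξ) (f/p i ξ + ∂ (f ξ) (ζ i) v))
        scaled i v = (λ ξ → f/p i ξ + (∂ (f ξ) (ζ i) v + + p * rem ξ)) , (λ ξ → trans (proj₂ (taylor (f ξ) (ζ i) (+ p) v)) (trans (cong (_+ + p * (∂ (f ξ) (ζ i) v + + p * rem ξ)) (_∣_.equality (vanishing i ξ))) (r₁ (f/p i ξ) (+ p) (∂ (f ξ) (ζ i) v + + p * rem ξ)))) ,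
            (λ ξ → modulo (divides (rem ξ) (r₂ (f/p i ξ) (∂ (f ξ) (ζ i) v) (+ p) (rem ξ))))
          where
          rem : Fin n → ℤ
          rem ξ = proj₁ (taylor (f ξ) (ζ i) (+ p) v)
          r₁ : ∀ q p d → q * p + p * d ≡ p * (q + d)
          r₁ = solve-∀
          r₂ : ∀ q d p r → q + (d + p * r) - (q + d) ≡ r * p
          r₂ = solve-∀

        p^≢0 : ∀ N → (+ p) ^ N ≢ 0ℤ
        p^≢0 N e = ℕ.≢-nonZero⁻¹ p (ℤₚ.+-injective (ℤₚ.i^n≡0⇒i≡0 (+ p) N e))

        module Step (N : ℕ) (e : Fin K → Fin S → ℤ) (e-eq : ∀ l a → weight a * c l a ≡ e l a * (+ p) ^ N) where

          P : ℤ
          P = (+ p) ^ N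

          Q : Fin K → (Fin n → ℤ) → ℤ
          Q l w = sum (λ a → e l a * monomialAt K w a)

          entry : ∀ (H : ℤ) (u y : Fin n → ℤ) → (∀ ξ → y ξ ≡ + p * u ξ) → ∀ l a →
            P * (H * (e l a * monomialAt K u a)) ≡ c l a * (H * monomialAt K y a)
          entry H u y y≡pu l a = begin
            P * (H * (e l a * M))           ≡⟨ r P H (e l a) M ⟩
            e l a * P * (H * M)             ≡⟨ cong (_* (H * M)) (sym (e-eq l a)) ⟩
            weight a * c l a * (H * M)      ≡⟨ r' (weight a) (c l a) H M ⟩
            c l a * (H * (weight a * M))    ≡⟨ cong (λ t → c l a * (H * t)) (sym (monomialAt-* K (λ _ → + p) u a)) ⟩
            c l a * (H * monomialAt K (λ ξ → + p * u ξ) a) ≡⟨ cong (λ t → c l a * (H * t)) (monomialAt-cong K {n} {λ ξ → + p * u ξ} {y} a (λ ξ → sym (y≡pu ξ))) ⟩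
            c l a * (H * monomialAt K y a) ∎
            where
            open ≡-Reasoning
            M = monomialAt K u a
            r : ∀ P h e m → P * (h * (e * m)) ≡ e * P * (h * m)
            r = solve-∀
            r' : ∀ w c h m → w * c * (h * m) ≡ c * (h * (w * m))
            r' = solve-∀

          row : ∀ (H : ℤ) (u y : Fin n → ℤ) → (∀ ξ → y ξ ≡ + p * u ξ) → ∀ l →
            P * (H * Q l u) ≡ sum (λ a → c l a * (H * monomialAt K y a))
          row H u y y≡pu l = begin
            P * (H * Q l u)
              ≡⟨ cong (P *_) (*-distribˡ-sum H (λ a → e l a * monomialAt K u a)) ⟩
            P * sum (λ a → H * (e l a * monomialAt K u a))
              ≡⟨ *-distribˡ-sum P (λ a → H * (e l a * monomialAt K u a)) ⟩
            sum (λ a → P * (H * (e l a * monomialAt K u a)))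
              ≡⟨ sum-cong-≗ {x = λ a → P * (H * (e l a * monomialAt K u a))} {y = λ a → c l a * (H * monomialAt K y a)} (entry H u y y≡pu l) ⟩
            sum (λ a → c l a * (H * monomialAt K y a)) ∎
            where open ≡-Reasoning

          -- Putting f = p u turns the monomial f ^ a into `weight a` times u ^ a, so the relation
          -- acquires the common factor p ^ N, which cancels over ℤ.
          total : ∀ (x u : Fin n → ℤ) → (∀ ξ → values x ξ ≡ + p * u ξ) → sum (λ l → ⟦ h l ⟧ x * Q l u) ≡ 0ℤ
          total x u y≡pu = ℤₚ.*-cancelˡ-≡ P (sum (λ l → ⟦ h l ⟧ x * Q l u)) 0ℤ {{ℤ.≢-nonZero (p^≢0 N)}} (begin
            P * sum (λ l → ⟦ h l ⟧ x * Q l u)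
              ≡⟨ *-distribˡ-sum P (λ l → ⟦ h l ⟧ x * Q l u) ⟩
            sum (λ l → P * (⟦ h l ⟧ x * Q l u))
              ≡⟨ sum-cong-≗ {x = λ l → P * (⟦ h l ⟧ x * Q l u)} {y = λ l → sum (λ a → c l a * (⟦ h l ⟧ x * monomialAt K (values x) a))} (λ l → row (⟦ h l ⟧ x) u (values x) y≡pu l) ⟩
            sum (λ l → sum (λ a → c l a * (⟦ h l ⟧ x * monomialAt K (values x) a)))
              ≡⟨ relation-everywhere x ⟩
            0ℤ
              ≡⟨ sym (ℤₚ.*-zeroʳ P) ⟩
            P * 0ℤ ∎)
            where open ≡-Reasoning

          -- Near `ζ i` every `h l` with l ≢ i is divisible by p while `h i` is not, so the i-th
          -- inner sum alone survives modulo p.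
          Q-scaled : ∀ i v → + p ∣ Q i (proj₁ (scaled i v))
          Q-scaled i v = [ (λ d → contradiction d (h-on i v)) , id ]′ (primeLike-prime (⟦ h i ⟧ x) (Q i u)
              (isolate-∣ (λ l → ⟦ h l ⟧ x * Q l u) i (total x u (proj₁ (proj₂ (scaled i v)))) (λ l l≢i → ∣m⇒∣m*n (Q l u) (h-off l i v l≢i))))
            where
            x u : Fin n → ℤ
            x = near i v
            u = proj₁ (scaled i v)

          QP : Fin K → Poly (Fin n)
          QP i = sumP (λ a → con (e i a) ⊗ monomial K var a)

          ⟦QP⟧ : ∀ i w → ⟦ QP i ⟧ w ≡ Q i w
          ⟦QP⟧ i w = trans (⟦sumP⟧ (λ a → con (e i a) ⊗ monomial K var a) w) (sum-cong-≗ {x = λ a → e i a * ⟦ monomial K var a ⟧ w} {y = λ a → e i a * monomialAt K w a} (λ a → cong (e i a *_) (⟦monomial⟧ K var a w)))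

          -- Nonsingularity lets v be chosen so that the local coordinates have the residues of any
          -- prescribed w.
          Q-everywhere : ∀ i w → + p ∣ Q i w
          Q-everywhere i w = subst (+ p ∣_) (⟦QP⟧ i w) (Mod-∣ congruent (subst (+ p ∣_) (sym (⟦QP⟧ i u)) (Q-scaled i v)))
            where
            hit : ∃[ v ] ∀ ξ → Mod (+ p) (f/p i ξ + ∂ (f ξ) (ζ i) v) (w ξ)
            hit = affine-surjective f (ζ i) (f/p i) (nonsingular i) w
            v u : Fin n → ℤ
            v = proj₁ hit
            u = proj₁ (scaled i v)
            congruent : Mod (+ p) (⟦ QP i ⟧ u) (⟦ QP i ⟧ w)
            congruent = modulo (⟦⟧-cong-mod (QP i) {+ p} {u} {w} (λ ξ → Mod.∣-diff (Mod-trans (proj₂ (proj₂ (scaled i v)) ξ) (proj₂ hit ξ))))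

          p∣e : ∀ i a → + p ∣ e i a
          p∣e i = multi-coefficients-∣ primeLike-prime {K} (λ k 0<k k<sK → ∤-small k 0<k (ℕₚ.≤-<-trans (ℕₚ.≤-pred k<sK) K<p)) n (e i) (Q-everywhere i)

        descent : ∀ N i a → (+ p) ^ N ∣ weight a * c i a
        descent zero    i a = divides (weight a * c i a) (sym (ℤₚ.*-identityʳ (weight a * c i a)))
        descent (suc N) i a = subst ((+ p) ^ suc N ∣_) (sym (_∣_.equality (descent N i a)))
          (*-monoˡ-∣ ((+ p) ^ N) (Step.p∣e N (λ l a → _∣_.quotient (descent N l a)) (λ l a → _∣_.equality (descent N l a)) i a))

      -- More than Bézout-many zeros would force a relation among the functions h i * f ^ a, since
      -- these are too many for their degree. Near ζ i they are p ^ |a| times monomials in local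
      -- coordinates, so every coefficient of the relation is divisible by all powers of p.
      nonsingular-zeros-bounded : ⊥
      nonsingular-zeros-bounded = not-∣-all-powers (weight a * c i a) nz (λ N → descent N i a)
        where
        j : Fin (K ℕ.* S)
        j = proj₁ (proj₁ (proj₂ relation))
        i = proj₁ (remQuot {K} S j)
        a = proj₂ (remQuot {K} S j)
        monomialAt≢0 : ∀ m (a : Fin (suc K ℕ.^ m)) → monomialAt K {m} (λ _ → + p) a ≢ 0ℤ
        monomialAt≢0 zero    a ()
        monomialAt≢0 (suc m) a e = [ p^≢0 (toℕ x) , monomialAt≢0 m y ]′
            (ℤₚ.i*j≡0⇒i≡0∨j≡0 ((+ p) ^ toℕ x) {monomialAt K {m} (λ _ → + p) y} e)
          where
          x = quotient {suc K} (suc K ℕ.^ m) a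
          y = remainder {suc K} (suc K ℕ.^ m) a
        nz : weight a * c i a ≢ 0ℤ
        nz e = [ monomialAt≢0 n a , (λ e₂ → proj₂ (proj₁ (proj₂ relation)) (trans (cong (proj₁ relation) (sym (Finₚ.combine-remQuot {K} S j))) e₂)) ]′
          (ℤₚ.i*j≡0⇒i≡0∨j≡0 (weight a) {c i a} e)

-- Random polynomials and the independence of their values and derivatives.

module RandomPolynomials where

  open import Data.Nat as ℕ using (ℕ; zero; suc; z≤n; s≤s)
  import Data.Nat.Properties as ℕₚ
  open import Data.Nat.ListAction using (sum)
  open import Data.Nat.Primality using (Prime; prime⇒nonZero)
  import Data.Nat.Tactic.RingSolver as ℕSolver
  open import Data.Integer using (ℤ; +_; -_; 0ℤ; 1ℤ; _+_; _*_; _-_)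
  import Data.Integer.Properties as ℤₚ
  open import Data.Integer.DivMod using (_%ℕ_; n%ℕd<d)
  open import Data.Integer.Divisibility.Signed hiding (quotient)
  open import Data.Integer.Tactic.RingSolver using (solve-∀)
  open import Data.Fin using (toℕ; fromℕ<)
  import Data.Fin.Properties as Finₚ
  open import Data.List using (List; []; _∷_; _++_; map; concatMap; length; upTo)
  import Data.List.Properties as Listₚ
  open import Data.List.Membership.Propositional using (_∈_; find)
  open import Data.List.Membership.Propositional.Properties using (∈-map⁺; ∈-concatMap⁺; ∈-upTo⁺; ∈-upTo⁻)
  open import Data.List.Relation.Unary.Any as Any using (Any; here; there)
  open import Data.List.Relation.Unary.All as All using (All; []; _∷_)
  import Data.List.Relation.Unary.All.Properties as Allₗ
  open import Data.List.Relation.Unary.AllPairs as AllPairs using (AllPairs; []; _∷_)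
  import Data.List.Relation.Unary.Unique.Propositional.Properties as Uniqueₚ
  open import Data.Product using (∃-syntax; _×_; _,_; proj₁; proj₂)
  open import Data.Sum using (inj₁; inj₂)
  open import Data.Bool using (Bool; true; false; T; if_then_else_)
  open import Function using (_∘_)
  open import Relation.Nullary using (¬_; Dec; yes; no; contradiction)
  open import Relation.Nullary.Decidable using (_×-dec_)
  open import Relation.Binary.PropositionalEquality
  open import Data.Unit using (tt)
  open NonsingularZeros

  -- Sums over lists

  ∑ : {A : Set} → List A → (A → ℕ) → ℕ
  ∑ xs f = sum (map f xs)

  module _ {A : Set} where

    ∑-cong : ∀ (xs : List A) {f g : A → ℕ} → (∀ x → f x ≡ g x) → ∑ xs f ≡ ∑ xs g
    ∑-cong []       h = refl
    ∑-cong (x ∷ xs) h = cong₂ ℕ._+_ (h x) (∑-cong xs h)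

    ∑-mono : ∀ (xs : List A) {f g : A → ℕ} → (∀ x → f x ℕ.≤ g x) → ∑ xs f ℕ.≤ ∑ xs g
    ∑-mono []       h = z≤n
    ∑-mono (x ∷ xs) h = ℕₚ.+-mono-≤ (h x) (∑-mono xs h)

    ∑-+ : ∀ (xs : List A) (f g : A → ℕ) → ∑ xs (λ x → f x ℕ.+ g x) ≡ ∑ xs f ℕ.+ ∑ xs g
    ∑-+ []       f g = refl
    ∑-+ (x ∷ xs) f g = trans (cong (f x ℕ.+ g x ℕ.+_) (∑-+ xs f g)) (r (f x) (g x) (∑ xs f) (∑ xs g))
      where
      r : ∀ a b c d → a ℕ.+ b ℕ.+ (c ℕ.+ d) ≡ a ℕ.+ c ℕ.+ (b ℕ.+ d)
      r = ℕSolver.solve-∀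

    ∑-* : ∀ (xs : List A) c (f : A → ℕ) → ∑ xs (λ x → c ℕ.* f x) ≡ c ℕ.* ∑ xs f
    ∑-* []       c f = sym (ℕₚ.*-zeroʳ c)
    ∑-* (x ∷ xs) c f = trans (cong (c ℕ.* f x ℕ.+_) (∑-* xs c f)) (sym (ℕₚ.*-distribˡ-+ c (f x) (∑ xs f)))

    ∑-const : ∀ (xs : List A) c → ∑ xs (λ _ → c) ≡ length xs ℕ.* c
    ∑-const []       c = refl
    ∑-const (x ∷ xs) c = cong (c ℕ.+_) (∑-const xs c)

    ∑-++ : ∀ (xs ys : List A) (f : A → ℕ) → ∑ (xs ++ ys) f ≡ ∑ xs f ℕ.+ ∑ ys f
    ∑-++ []       ys f = refl
    ∑-++ (x ∷ xs) ys f = trans (cong (f x ℕ.+_) (∑-++ xs ys f)) (sym (ℕₚ.+-assoc (f x) (∑ xs f) (∑ ys f)))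

    ∑-term : ∀ {xs : List A} {x} (f : A → ℕ) → x ∈ xs → f x ℕ.≤ ∑ xs f
    ∑-term f (here refl) = ℕₚ.m≤m+n _ _
    ∑-term {y ∷ xs} f (there h) = ℕₚ.≤-trans (∑-term f h) (ℕₚ.m≤n+m _ (f y))

    ∑≤∑⇒∃ : ∀ (xs : List A) (f g : A → ℕ) → 1 ℕ.≤ length xs → ∑ xs f ℕ.≤ ∑ xs g → ∃[ x ] x ∈ xs × f x ℕ.≤ g x
    ∑≤∑⇒∃ (x ∷ xs) f g _ = pick x xs
      where
      pick : ∀ x xs → ∑ (x ∷ xs) f ℕ.≤ ∑ (x ∷ xs) g → ∃[ y ] y ∈ x ∷ xs × f y ℕ.≤ g y
      pick x [] h = x , here refl , subst₂ ℕ._≤_ (ℕₚ.+-identityʳ (f x)) (ℕₚ.+-identityʳ (g x)) h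
      pick x (y ∷ ys) h with f x ℕ.≤? g x
      ... | yes fx≤gx = x , here refl , fx≤gx
      ... | no fx≰gx with pick y ys (ℕₚ.+-cancelˡ-≤ (g x) _ _ (ℕₚ.≤-trans (ℕₚ.+-monoˡ-≤ (∑ (y ∷ ys) f) (ℕₚ.<⇒≤ (ℕₚ.≰⇒> fx≰gx))) h))
      ...   | z , z∈ , r = z , there z∈ , r

  module _ {A B : Set} where

    ∑-map : ∀ (xs : List A) (k : A → B) (f : B → ℕ) → ∑ (map k xs) f ≡ ∑ xs (f ∘ k)
    ∑-map xs k f = cong sum (sym (Listₚ.map-∘ xs))

    ∑-concatMap : ∀ (xs : List A) (k : A → List B) (f : B → ℕ) → ∑ (concatMap k xs) f ≡ ∑ xs (λ x → ∑ (k x) f)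
    ∑-concatMap []       k f = refl
    ∑-concatMap (x ∷ xs) k f = trans (∑-++ (k x) (concatMap k xs) f) (cong (∑ (k x) f ℕ.+_) (∑-concatMap xs k f))

    ∑-swap : ∀ (xs : List A) (ys : List B) (f : A → B → ℕ) → ∑ xs (λ x → ∑ ys (f x)) ≡ ∑ ys (λ y → ∑ xs (λ x → f x y))
    ∑-swap []       ys f = sym (trans (∑-const ys 0) (ℕₚ.*-zeroʳ (length ys)))
    ∑-swap (x ∷ xs) ys f = trans (cong (∑ ys (f x) ℕ.+_) (∑-swap xs ys f)) (sym (∑-+ ys (f x) (λ y → ∑ xs (λ x → f x y))))

  ind : {P : Set} → Dec P → ℕ
  ind (yes _) = 1
  ind (no _)  = 0

  ind≤1 : ∀ {P : Set} (d : Dec P) → ind d ℕ.≤ 1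
  ind≤1 (yes _) = s≤s z≤n
  ind≤1 (no _)  = z≤n

  ind-yes : ∀ {P : Set} (d : Dec P) → P → ind d ≡ 1
  ind-yes (yes _) _ = refl
  ind-yes (no ¬p) p = contradiction p ¬p

  ind-no : ∀ {P : Set} (d : Dec P) → ¬ P → ind d ≡ 0
  ind-no (yes p) ¬p = contradiction p ¬p
  ind-no (no _)  _  = refl

  ind-mono : ∀ {P Q : Set} (d : Dec P) (e : Dec Q) → (P → Q) → ind d ℕ.≤ ind e
  ind-mono (yes p) e f = ℕₚ.≤-reflexive (sym (ind-yes e (f p)))
  ind-mono (no _)  e f = z≤n

  ∑-ind-unique : ∀ {A : Set} {P : A → Set} (P? : ∀ x → Dec (P x)) (xs : List A) → AllPairs _≢_ xs →
    (∀ {x y} → P x → P y → x ∈ xs → y ∈ xs → x ≡ y) → ∑ xs (ind ∘ P?) ℕ.≤ 1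
  ∑-ind-unique P? [] _ _ = z≤n
  ∑-ind-unique {P = P} P? (x ∷ xs) (x∉ ∷ un) h with P? x
  ... | no _ = ∑-ind-unique P? xs un (λ px py x∈ y∈ → h px py (there x∈) (there y∈))
  ... | yes px = s≤s (ℕₚ.≤-reflexive (none xs x∉ (λ py y∈ → h px py (here refl) (there y∈))))
    where
    none : ∀ ys → All (x ≢_) ys → (∀ {y} → P y → y ∈ ys → x ≡ y) → ∑ ys (ind ∘ P?) ≡ 0
    none [] _ _ = refl
    none (y ∷ ys) (x≢y ∷ ne) k = cong₂ ℕ._+_ (ind-no (P? y) (λ py → x≢y (k py (here refl)))) (none ys ne (λ py y∈ → k py (there y∈)))

  upTo-unique : ∀ n → AllPairs _≢_ (upTo n)
  upTo-unique n = Uniqueₚ.upTo⁺ n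

  -- The random polynomial

  module _ {I : Set} (p : ℕ) where

    -- A sample space with multiplicities: one entry per choice of coefficients. The generators may
    -- be dependent, as probabilities are computed by varying one coefficient at a time.
    combinations : List (Poly I) → List (Poly I)
    combinations []       = con 0ℤ ∷ []
    combinations (b ∷ bs) = concatMap (λ y → map (λ P → con (+ y) ⊗ b ⊕ P) (combinations bs)) (upTo p)

    ∑-combinations : ∀ b bs (φ : Poly I → ℕ) → ∑ (combinations (b ∷ bs)) φ ≡ ∑ (upTo p) (λ y → ∑ (combinations bs) (λ P → φ (con (+ y) ⊗ b ⊕ P)))
    ∑-combinations b bs φ = trans (∑-concatMap (upTo p) (λ y → map (λ P → con (+ y) ⊗ b ⊕ P) (combinations bs)) φ)
      (∑-cong (upTo p) (λ y → ∑-map (combinations bs) (λ P → con (+ y) ⊗ b ⊕ P) φ))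

    -- Stated through values, because the summands accumulated around b change the expression of
    -- `h y` but not the shape of its values.
    Line : Poly I → (ℕ → Poly I) → Poly I → Set
    Line b h P = ∀ y x → ⟦ h y ⟧ x ≡ + y * ⟦ b ⟧ x + ⟦ P ⟧ x

    -- Fubini: an inequality between sums along every line in direction b integrates over the sample space.
    along-lines : ∀ {b bs} → b ∈ bs → ∀ (φ ψ : Poly I → ℕ) A B →
      (∀ h P → Line b h P → A ℕ.* ∑ (upTo p) (φ ∘ h) ℕ.≤ B ℕ.* ∑ (upTo p) (ψ ∘ h)) →
      A ℕ.* ∑ (combinations bs) φ ℕ.≤ B ℕ.* ∑ (combinations bs) ψ
    along-lines {b} {bs = .b ∷ bs} (here refl) φ ψ A B hyp = begin
      A ℕ.* ∑ (combinations (b ∷ bs)) φ  ≡⟨ cong (A ℕ.*_) (expand φ) ⟩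
      A ℕ.* ∑ (combinations bs) (λ P → ∑ (upTo p) (λ y → φ (con (+ y) ⊗ b ⊕ P))) ≡⟨ sym (∑-* (combinations bs) A _) ⟩
      ∑ (combinations bs) (λ P → A ℕ.* ∑ (upTo p) (λ y → φ (con (+ y) ⊗ b ⊕ P))) ≤⟨ ∑-mono (combinations bs) (λ P → hyp (λ y → con (+ y) ⊗ b ⊕ P) P (λ _ _ → refl)) ⟩
      ∑ (combinations bs) (λ P → B ℕ.* ∑ (upTo p) (λ y → ψ (con (+ y) ⊗ b ⊕ P))) ≡⟨ ∑-* (combinations bs) B _ ⟩
      B ℕ.* ∑ (combinations bs) (λ P → ∑ (upTo p) (λ y → ψ (con (+ y) ⊗ b ⊕ P))) ≡⟨ cong (B ℕ.*_) (sym (expand ψ)) ⟩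
      B ℕ.* ∑ (combinations (b ∷ bs)) ψ  ∎
      where
      open ℕₚ.≤-Reasoning
      expand : ∀ φ → ∑ (combinations (b ∷ bs)) φ ≡ ∑ (combinations bs) (λ P → ∑ (upTo p) (λ y → φ (con (+ y) ⊗ b ⊕ P)))
      expand φ = trans (∑-combinations b bs φ) (∑-swap (upTo p) (combinations bs) (λ y P → φ (con (+ y) ⊗ b ⊕ P)))
    along-lines {b} {b' ∷ bs} (there b∈) φ ψ A B hyp = begin
      A ℕ.* ∑ (combinations (b' ∷ bs)) φ ≡⟨ cong (A ℕ.*_) (∑-combinations b' bs φ) ⟩
      A ℕ.* ∑ (upTo p) (λ z → ∑ (combinations bs) (λ P → φ (con (+ z) ⊗ b' ⊕ P))) ≡⟨ sym (∑-* (upTo p) A _) ⟩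
      ∑ (upTo p) (λ z → A ℕ.* ∑ (combinations bs) (λ P → φ (con (+ z) ⊗ b' ⊕ P))) ≤⟨ ∑-mono (upTo p) (λ z → along-lines b∈ _ _ A B (shifted z)) ⟩
      ∑ (upTo p) (λ z → B ℕ.* ∑ (combinations bs) (λ P → ψ (con (+ z) ⊗ b' ⊕ P))) ≡⟨ ∑-* (upTo p) B _ ⟩
      B ℕ.* ∑ (upTo p) (λ z → ∑ (combinations bs) (λ P → ψ (con (+ z) ⊗ b' ⊕ P))) ≡⟨ cong (B ℕ.*_) (sym (∑-combinations b' bs ψ)) ⟩
      B ℕ.* ∑ (combinations (b' ∷ bs)) ψ ∎
      where
      open ℕₚ.≤-Reasoning
      r : ∀ z b' y b P → z * b' + (y * b + P) ≡ y * b + (z * b' + P)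
      r = solve-∀
      shifted : ∀ z h P → Line b h P → A ℕ.* ∑ (upTo p) (λ y → φ (con (+ z) ⊗ b' ⊕ h y)) ℕ.≤ B ℕ.* ∑ (upTo p) (λ y → ψ (con (+ z) ⊗ b' ⊕ h y))
      shifted z h P line = hyp (λ y → con (+ z) ⊗ b' ⊕ h y) (con (+ z) ⊗ b' ⊕ P) (λ y x → trans (cong (_+_ (+ z * ⟦ b' ⟧ x)) (line y x)) (r (+ z) (⟦ b' ⟧ x) (+ y) (⟦ b ⟧ x) (⟦ P ⟧ x)))

    combinations-nonempty : 1 ℕ.≤ p → ∀ bs → 1 ℕ.≤ length (combinations bs)
    combinations-nonempty 1≤p [] = s≤s z≤n
    combinations-nonempty 1≤p (b ∷ bs) = subst (1 ℕ.≤_) (trans (sym (∑-combinations b bs (λ _ → 1))) one) le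
      where
      one : ∑ (combinations (b ∷ bs)) (λ _ → 1) ≡ length (combinations (b ∷ bs))
      one = trans (∑-const (combinations (b ∷ bs)) 1) (ℕₚ.*-identityʳ _)
      le : 1 ℕ.≤ ∑ (upTo p) (λ y → ∑ (combinations bs) (λ P → 1))
      le = ℕₚ.≤-trans (ℕₚ.≤-trans (combinations-nonempty 1≤p bs) (ℕₚ.≤-reflexive (sym (trans (∑-const (combinations bs) 1) (ℕₚ.*-identityʳ _))))) (∑-term (λ y → ∑ (combinations bs) (λ P → 1)) (∈-upTo⁺ 1≤p))

    combinations-deg : ∀ {R} bs → All (λ b → deg b ℕ.≤ R) bs → All (λ P → deg P ℕ.≤ R) (combinations bs)
    combinations-deg [] [] = z≤n ∷ []
    combinations-deg {R} (b ∷ bs) (hb ∷ hs) = Allₗ.concat⁺ (Allₗ.map⁺ (All.universal (λ y → Allₗ.map⁺ (All.map (λ hP → ℕₚ.⊔-lub hb hP) (combinations-deg bs hs))) (upTo p)))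

  codeP : {I : Set} → I × ℕ → Poly I
  codeP (ι , e) = var ι ⊕ con (- + e)

  -- Padding with factors 1 brings every product of at most R letters to length exactly R. With the
  -- words themselves as generators, each interpolation product is literally one of them.
  word : {I : Set} → ℕ → List (I × ℕ) → Poly I
  word zero    _        = con 1ℤ
  word (suc R) []       = con 1ℤ ⊗ word R []
  word (suc R) (c ∷ cs) = codeP c ⊗ word R cs

  codeProduct : {I : Set} → List (I × ℕ) → (I → ℤ) → ℤ
  codeProduct []             x = 1ℤ
  codeProduct ((ι , e) ∷ cs) x = (x ι - + e) * codeProduct cs x

  ⟦word⟧ : {I : Set} → ∀ R (cs : List (I × ℕ)) x → length cs ℕ.≤ R → ⟦ word R cs ⟧ x ≡ codeProduct cs x
  ⟦word⟧ zero    []       x _ = refl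
  ⟦word⟧ (suc R) []       x _ = trans (ℤₚ.*-identityˡ _) (⟦word⟧ R [] x z≤n)
  ⟦word⟧ (suc R) ((ι , e) ∷ cs) x (s≤s h) = cong ((x ι - + e) *_) (⟦word⟧ R cs x h)

  module _ {I : Set} (vars : List I) (p : ℕ) where

    letters : List (Poly I)
    letters = con 1ℤ ∷ concatMap (λ ι → map (λ e → codeP (ι , e)) (upTo p)) vars

    words : ℕ → List (Poly I)
    words zero    = con 1ℤ ∷ []
    words (suc R) = concatMap (λ l → map (l ⊗_) (words R)) letters

    Admissible : I × ℕ → Set
    Admissible (ι , e) = ι ∈ vars × e ℕ.< p

    word∈words : ∀ R (cs : List (I × ℕ)) → All Admissible cs → word R cs ∈ words R
    word∈words zero    cs h = here refl
    word∈words (suc R) [] h = ∈-concatMap⁺ (λ l → map (l ⊗_) (words R)) {xs = letters} (here (∈-map⁺ (con 1ℤ ⊗_) (word∈words R [] [])))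
    word∈words (suc R) ((ι , e) ∷ cs) ((ι∈ , e<p) ∷ h) = ∈-concatMap⁺ (λ l → map (l ⊗_) (words R)) {xs = letters}
      (Any.map (λ { refl → ∈-map⁺ (codeP (ι , e) ⊗_) (word∈words R cs h) }) letter∈)
      where
      letter∈ : codeP (ι , e) ∈ letters
      letter∈ = there (∈-concatMap⁺ (λ ι → map (λ e → codeP (ι , e)) (upTo p)) (Any.map (λ { refl → ∈-map⁺ (λ e → codeP (ι , e)) (∈-upTo⁺ e<p) }) ι∈))

    words-deg : ∀ R → All (λ b → deg b ℕ.≤ R) (words R)
    words-deg zero    = z≤n ∷ []
    words-deg (suc R) = Allₗ.concat⁺ (Allₗ.map⁺ (All.map (λ hl → Allₗ.map⁺ (All.map (λ hw → ℕₚ.+-mono-≤ hl hw) (words-deg R))) letters-deg))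
      where
      letters-deg : All (λ l → deg l ℕ.≤ 1) letters
      letters-deg = z≤n ∷ Allₗ.concat⁺ (Allₗ.map⁺ (All.universal (λ ι → Allₗ.map⁺ (All.universal (λ e → ℕₚ.≤-refl) (upTo p))) vars))

  ind-<-∑ : ∀ v B → ind (v ℕ.<? B) ≡ ∑ (upTo B) (λ w → ind (v ℕ.≟ w))
  ind-<-∑ v B with v ℕ.<? B
  ... | yes v<B = ℕₚ.≤-antisym (ℕₚ.≤-trans (ℕₚ.≤-reflexive (sym (ind-yes (v ℕ.≟ v) refl))) (∑-term (λ w → ind (v ℕ.≟ w)) (∈-upTo⁺ v<B)))
                    (∑-ind-unique (v ℕ.≟_) (upTo B) (upTo-unique B) (λ e e' _ _ → trans (sym e) e'))
  ... | no v≮B = sym (none (upTo B) (λ w∈ e → v≮B (subst (ℕ._< B) (sym e) (∈-upTo⁻ w∈))))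
    where
    none : ∀ ws → (∀ {w} → w ∈ ws → v ≢ w) → ∑ ws (λ w → ind (v ℕ.≟ w)) ≡ 0
    none [] h = refl
    none (w ∷ ws) h = cong₂ ℕ._+_ (ind-no (v ℕ.≟ w) (h (here refl))) (none ws (h ∘ there))

  length-upTo≡ : ∀ n → ∑ (upTo n) (λ _ → 1) ≡ n
  length-upTo≡ n = trans (∑-const (upTo n) 1) (trans (ℕₚ.*-identityʳ _) (Listₚ.length-upTo n))

  ∑-congᵐ : ∀ {A : Set} (xs : List A) {f g : A → ℕ} → (∀ {x} → x ∈ xs → f x ≡ g x) → ∑ xs f ≡ ∑ xs g
  ∑-congᵐ []       h = refl
  ∑-congᵐ (x ∷ xs) h = cong₂ ℕ._+_ (h (here refl)) (∑-congᵐ xs (h ∘ there))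

  module Sampling {p : ℕ} (pp : Prime p) {I : Set} (vars : List I) (R B : ℕ) (B≤p : B ℕ.≤ p) where

    private
      instance
        p≢0 : ℕ.NonZero p
        p≢0 = prime⇒nonZero pp

      1≤p : 1 ℕ.≤ p
      1≤p = ℕ.>-nonZero⁻¹ p

    Ω : List (Poly I)
    Ω = combinations p (words vars p R)

    Mod-ℕ⇒≡ : ∀ {y z} → y ℕ.< p → z ℕ.< p → Mod (+ p) (+ y) (+ z) → y ≡ z
    Mod-ℕ⇒≡ {y} {z} y<p z<p h = trans (sym (Finₚ.toℕ-fromℕ< y<p)) (trans (cong toℕ (Mod⇒≡ pp (fromℕ< y<p) (fromℕ< z<p) (subst₂ (λ a b → Mod (+ p) (+ a) (+ b)) (sym (Finₚ.toℕ-fromℕ< y<p)) (sym (Finₚ.toℕ-fromℕ< z<p)) h))) (Finₚ.toℕ-fromℕ< z<p))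

    cancel-unit : ∀ {β} → ¬ + p ∣ β → ∀ y z → + p ∣ (y - z) * β → Mod (+ p) y z
    cancel-unit {β} p∤β y z h with primeLike-prime pp (y - z) β h
    ... | inj₁ d = modulo d
    ... | inj₂ d = contradiction d p∤β

    module _ {α β : ℤ} (p∤β : ¬ + p ∣ β) where

      private
        value : ℕ → ℕ
        value y = (+ y * β + α) %ℕ p

        value-residue : ∀ y → toℕ (residue pp (+ y * β + α)) ≡ value y
        value-residue y = Finₚ.toℕ-fromℕ< (n%ℕd<d (+ y * β + α) p)

        r : ∀ y z β α → y * β + α - (z * β + α) ≡ (y - z) * β
        r = solve-∀

        same-residue : ∀ y z → residue pp (+ y * β + α) ≡ residue pp (+ z * β + α) → Mod (+ p) (+ y) (+ z)
        same-residue y z e = cancel-unit p∤β (+ y) (+ z) (subst (+ p ∣_) (r (+ y) (+ z) β α) (Mod.∣-diff (residue-eq pp {+ y * β + α} {+ z * β + α} e)))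

        value-injective : ∀ {y z} → y ℕ.< p → z ℕ.< p → value y ≡ value z → y ≡ z
        value-injective {y} {z} y<p z<p e = Mod-ℕ⇒≡ y<p z<p (same-residue y z (Finₚ.toℕ-injective (trans (value-residue y) (trans e (sym (value-residue z))))))

        value-surjective : ∀ w → w ℕ.< p → ∃[ y ] y ℕ.< p × value y ≡ w
        value-surjective w w<p = toℕ (proj₁ hit) , Finₚ.toℕ<n (proj₁ hit) , trans (sym (value-residue (toℕ (proj₁ hit)))) (trans (cong toℕ (proj₂ hit)) (Finₚ.toℕ-fromℕ< w<p))
          where
          hit = injective⇒surjective (λ y → residue pp (+ toℕ y * β + α)) (λ {y} {z} e → Mod⇒≡ pp y z (same-residue (toℕ y) (toℕ z) e)) (fromℕ< w<p)

      -- Multiplication by the unit β and translation by α permute the residues, so each of the B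
      -- window values is taken exactly once.
      affine-value-count : ∑ (upTo p) (λ y → ind (value y ℕ.<? B)) ≡ B
      affine-value-count = begin
        ∑ (upTo p) (λ y → ind (value y ℕ.<? B))                        ≡⟨ ∑-cong (upTo p) (λ y → ind-<-∑ (value y) B) ⟩
        ∑ (upTo p) (λ y → ∑ (upTo B) (λ w → ind (value y ℕ.≟ w)))      ≡⟨ ∑-swap (upTo p) (upTo B) (λ y w → ind (value y ℕ.≟ w)) ⟩
        ∑ (upTo B) (λ w → ∑ (upTo p) (λ y → ind (value y ℕ.≟ w)))      ≡⟨ ∑-congᵐ (upTo B) (λ w∈ → once _ (ℕₚ.<-≤-trans (∈-upTo⁻ w∈) B≤p)) ⟩
        ∑ (upTo B) (λ _ → 1)                                           ≡⟨ length-upTo≡ B ⟩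
        B ∎
        where
        open ≡-Reasoning
        once : ∀ w → w ℕ.< p → ∑ (upTo p) (λ y → ind (value y ℕ.≟ w)) ≡ 1
        once w w<p = ℕₚ.≤-antisym (∑-ind-unique (λ y → value y ℕ.≟ w) (upTo p) (upTo-unique p) (λ e e' x∈ y∈ → value-injective (∈-upTo⁻ x∈) (∈-upTo⁻ y∈) (trans e (sym e'))))
          (ℕₚ.≤-trans (ℕₚ.≤-reflexive (sym (ind-yes (value (proj₁ s) ℕ.≟ w) (proj₂ (proj₂ s))))) (∑-term (λ y → ind (value y ℕ.≟ w)) (∈-upTo⁺ (proj₁ (proj₂ s)))))
          where s = value-surjective w w<p

    Small : Poly I → (I → ℤ) → Set
    Small F x = (⟦ F ⟧ x %ℕ p) ℕ.< B

    small? : ∀ F x → Dec (Small F x)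
    small? F x = (⟦ F ⟧ x %ℕ p) ℕ.<? B

    Invariant : Poly I → (Poly I → Set) → Set
    Invariant b C = ∀ h P → Line p b h P → ∀ y z → C (h y) → C (h z)

    module _ {b : Poly I} (b∈ : b ∈ words vars p R) (x : I → ℤ) (p∤b : ¬ + p ∣ ⟦ b ⟧ x)
      {C : Poly I → Set} (C? : ∀ F → Dec (C F)) (inv : Invariant b C) where

      private
        both? : ∀ F → Dec (Small F x × C F)
        both? F = small? F x ×-dec C? F

        line-equal : ∀ h P → Line p b h P → p ℕ.* ∑ (upTo p) (ind ∘ both? ∘ h) ≡ B ℕ.* ∑ (upTo p) (ind ∘ C? ∘ h)
        line-equal h P line with C? (h 0)
        ... | no ¬c = trans (cong (p ℕ.*_) (trans (∑-cong (upTo p) (λ y → ind-no (both? (h y)) (λ s → ¬c (inv h P line y 0 (proj₂ s))))) zeros))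
                      (trans (ℕₚ.*-zeroʳ p) (trans (sym (ℕₚ.*-zeroʳ B)) (cong (B ℕ.*_) (sym (trans (∑-cong (upTo p) (λ y → ind-no (C? (h y)) (λ s → ¬c (inv h P line y 0 s)))) zeros)))))
          where
          zeros : ∑ (upTo p) (λ _ → 0) ≡ 0
          zeros = trans (∑-const (upTo p) 0) (ℕₚ.*-zeroʳ (length (upTo p)))
        ... | yes c = begin
            p ℕ.* ∑ (upTo p) (ind ∘ both? ∘ h) ≡⟨ cong (p ℕ.*_) (∑-cong (upTo p) same) ⟩
            p ℕ.* ∑ (upTo p) (λ y → ind (((+ y * ⟦ b ⟧ x + ⟦ P ⟧ x) %ℕ p) ℕ.<? B)) ≡⟨ cong (p ℕ.*_) (affine-value-count {⟦ P ⟧ x} p∤b) ⟩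
            p ℕ.* B                            ≡⟨ ℕₚ.*-comm p B ⟩
            B ℕ.* p                            ≡⟨ cong (B ℕ.*_) (sym (trans (∑-cong (upTo p) (λ y → ind-yes (C? (h y)) (inv h P line 0 y c))) (length-upTo≡ p))) ⟩
            B ℕ.* ∑ (upTo p) (ind ∘ C? ∘ h) ∎
          where
          open ≡-Reasoning
          same : ∀ y → ind (both? (h y)) ≡ ind (((+ y * ⟦ b ⟧ x + ⟦ P ⟧ x) %ℕ p) ℕ.<? B)
          same y = ℕₚ.≤-antisym (ind-mono (both? (h y)) _ (λ s → subst (λ v → (v %ℕ p) ℕ.< B) (line y x) (proj₁ s)))
            (ind-mono _ (both? (h y)) (λ s → subst (λ v → (v %ℕ p) ℕ.< B) (sym (line y x)) s , inv h P line 0 y c))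

      -- On a line in direction b the event C is constant, and exactly B of the p members are small
      -- at x. An equality is kept because the edge count needs this probability from below.
      small-step : p ℕ.* ∑ Ω (ind ∘ both?) ≡ B ℕ.* ∑ Ω (ind ∘ C?)
      small-step = ℕₚ.≤-antisym
        (along-lines p b∈ (ind ∘ both?) (ind ∘ C?) p B (λ h P line → ℕₚ.≤-reflexive (line-equal h P line)))
        (along-lines p b∈ (ind ∘ C?) (ind ∘ both?) B p (λ h P line → ℕₚ.≤-reflexive (sym (line-equal h P line))))

    module _ {b : Poly I} (b∈ : b ∈ words vars p R)
      {C D : Poly I → Set} (C? : ∀ F → Dec (C F)) (D? : ∀ F → Dec (D F))
      (unique : ∀ h P → Line p b h P → ∀ {y z} → y ℕ.< p → z ℕ.< p → D (h y) → D (h z) → y ≡ z)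
      (spread : ∀ h P → Line p b h P → ∀ y z → D (h y) → C (h z)) where

      -- A line contains at most one member with D, and as soon as there is one, all p members
      -- satisfy C.
      unique-step : p ℕ.* ∑ Ω (ind ∘ D?) ℕ.≤ 1 ℕ.* ∑ Ω (ind ∘ C?)
      unique-step = along-lines p b∈ (ind ∘ D?) (ind ∘ C?) p 1 on-line
        where
        on-line : ∀ h P → Line p b h P → p ℕ.* ∑ (upTo p) (ind ∘ D? ∘ h) ℕ.≤ 1 ℕ.* ∑ (upTo p) (ind ∘ C? ∘ h)
        on-line h P line with Any.any? (D? ∘ h) (upTo p)
        ... | no none = ℕₚ.≤-trans (ℕₚ.≤-reflexive (trans (cong (p ℕ.*_) (trans (∑-congᵐ (upTo p) {g = λ _ → 0} (λ {y} y∈ → ind-no (D? (h y)) (λ d → none (Any.map (λ { refl → d }) y∈)))) (trans (∑-const (upTo p) 0) (ℕₚ.*-zeroʳ (length (upTo p)))))) (ℕₚ.*-zeroʳ p))) z≤n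
        ... | yes some with find some
        ...   | y , _ , d = ℕₚ.≤-trans (ℕₚ.*-monoʳ-≤ p (∑-ind-unique (D? ∘ h) (upTo p) (upTo-unique p) (λ d d' x∈ y∈ → unique h P line (∈-upTo⁻ x∈) (∈-upTo⁻ y∈) d d')))
                (ℕₚ.≤-reflexive (trans (ℕₚ.*-identityʳ p) (trans (sym (trans (∑-cong (upTo p) (λ z → ind-yes (C? (h z)) (spread h P line y z d))) (length-upTo≡ p))) (sym (ℕₚ.*-identityˡ _)))))

    -- A value condition at `pt` together with a derivative condition along `dir`. In a `live` row
    -- the direction is guaranteed to be nonzero modulo p, so the derivative condition can be
    -- charged a factor 1 / p.
    record Row : Set where
      field
        pt dir : I → ℕ
        live   : Bool

    open Row

    at : Row → I → ℤ
    at r ι = + pt r ι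

    nudged : Row → I → ℤ
    nudged r ι = + pt r ι + + p * + dir r ι

    -- The derivative in the given direction vanishes modulo p, expressed through values of F alone.
    Flat : Poly I → Row → Set
    Flat F r = + p * + p ∣ ⟦ F ⟧ (nudged r) - ⟦ F ⟧ (at r)

    Sat₁ : Poly I → Row → Set
    Sat₁ F r = Small F (at r) × Flat F r

    Sat : List Row → Poly I → Set
    Sat rs F = All (Sat₁ F) rs

    sat? : ∀ rs F → Dec (Sat rs F)
    sat? rs F = All.all? (λ r → small? F (at r) ×-dec ((+ p * + p) ∣? (⟦ F ⟧ (nudged r) - ⟦ F ⟧ (at r)))) rs

    Separated : Row → Row → Set
    Separated r r' = Any (λ ι → ¬ + p ∣ + pt r ι - + pt r' ι) vars

    Reduced : Row → Set
    Reduced r = ∀ ι → pt r ι ℕ.< p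

    Moving : Row → Set
    Moving r = T (live r) → Any (λ ι → ¬ + p ∣ + dir r ι) vars

    -- The factor p given back where the derivative condition is not charged.
    weight : Row → ℕ
    weight r = if live r then 1 else p

    weights : List Row → ℕ
    weights []       = 1
    weights (r ∷ rs) = weight r ℕ.* weights rs

    -- The squares make the Newton polynomial and its derivative vanish at the other rows.
    newton : ∀ r rs → All (Separated r) rs → List (I × ℕ)
    newton r []        []       = []
    newton r (r' ∷ rs) (s ∷ ss) = (ι , pt r' ι) ∷ (ι , pt r' ι) ∷ newton r rs ss
      where ι = proj₁ (find s)

    length-newton : ∀ r rs (ss : All (Separated r) rs) → length (newton r rs ss) ≡ 2 ℕ.* length rs
    length-newton r []        []       = refl
    length-newton r (r' ∷ rs) (s ∷ ss) = trans (cong (suc ∘ suc) (length-newton r rs ss)) (sym (ℕₚ.*-suc 2 (length rs)))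

    newton-admissible : ∀ r rs (ss : All (Separated r) rs) → All Reduced rs → All (Admissible vars p) (newton r rs ss)
    newton-admissible r []        []       []         = []
    newton-admissible r (r' ∷ rs) (s ∷ ss) (red ∷ reds) = ok ∷ ok ∷ newton-admissible r rs ss reds
      where ok = proj₁ (proj₂ (find s)) , red _

    -- Arbitrary x congruent to the point of r are allowed since both that point and its nudged
    -- version occur.
    newton-unit : ∀ r rs (ss : All (Separated r) rs) x → (∀ ι → Mod (+ p) (x ι) (+ pt r ι)) → ¬ + p ∣ codeProduct (newton r rs ss) x
    newton-unit r []        []       x h d = ∤1ℤ pp d
    newton-unit r (r' ∷ rs) (s ∷ ss) x h d with primeLike-prime pp (x ι - + pt r' ι) _ d
      where ι = proj₁ (find s)
    ... | inj₁ d₁ = proj₂ (proj₂ (find s)) (Mod.∣-diff (Mod-trans (Mod-sym (h (proj₁ (find s)))) (modulo d₁)))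
    ... | inj₂ d₂ with primeLike-prime pp (x (proj₁ (find s)) - + pt r' (proj₁ (find s))) _ d₂
    ...   | inj₁ d₁ = proj₂ (proj₂ (find s)) (Mod.∣-diff (Mod-trans (Mod-sym (h (proj₁ (find s)))) (modulo d₁)))
    ...   | inj₂ d₃ = newton-unit r rs ss x h d₃

    newton-at : ∀ r {r'} rs (ss : All (Separated r) rs) → r' ∈ rs → codeProduct (newton r rs ss) (at r') ≡ 0ℤ
    newton-at r (r' ∷ rs) (s ∷ ss) (here refl) = trans (cong (_* ((+ pt r' ι - + pt r' ι) * codeProduct (newton r rs ss) (at r'))) (ℤₚ.+-inverseʳ (+ pt r' ι))) refl
      where ι = proj₁ (find s)
    newton-at r {r' = r'} (r'' ∷ rs) (s ∷ ss) (there r'∈) = trans (cong (λ z → a * (a * z)) (newton-at r rs ss r'∈)) (e a)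
      where
      a = at r' (proj₁ (find s)) - + pt r'' (proj₁ (find s))
      e : ∀ a → a * (a * 0ℤ) ≡ 0ℤ
      e = solve-∀

    newton-nudged : ∀ r {r'} rs (ss : All (Separated r) rs) → r' ∈ rs → + p * + p ∣ codeProduct (newton r rs ss) (nudged r')
    newton-nudged r (r' ∷ rs) (s ∷ ss) (here refl) = divides (+ dir r' ι * (+ dir r' ι * codeProduct (newton r rs ss) (nudged r'))) (e (+ pt r' ι) (+ p) (+ dir r' ι) (codeProduct (newton r rs ss) (nudged r')))
      where
      ι = proj₁ (find s)
      e : ∀ a p d c → (a + p * d - a) * ((a + p * d - a) * c) ≡ d * (d * c) * (p * p)
      e = solve-∀
    newton-nudged r {r' = r'} (r'' ∷ rs) (s ∷ ss) (there r'∈) = ∣n⇒∣m*n a (∣n⇒∣m*n a (newton-nudged r rs ss r'∈))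
      where a = nudged r' (proj₁ (find s)) - + pt r'' (proj₁ (find s))

    module _ (b : Poly I) (h : ℕ → Poly I) (P : Poly I) (line : Line p b h P) (r' : Row) (zero-at : ⟦ b ⟧ (at r') ≡ 0ℤ) where

      small-invariant : ∀ y z → Small (h y) (at r') → Small (h z) (at r')
      small-invariant y z = subst (λ v → (v %ℕ p) ℕ.< B) (trans (value y) (sym (value z)))
        where
        value : ∀ y → ⟦ h y ⟧ (at r') ≡ ⟦ P ⟧ (at r')
        value y = trans (line y (at r')) (trans (cong (λ t → + y * t + ⟦ P ⟧ (at r')) zero-at) (trans (cong (_+ ⟦ P ⟧ (at r')) (ℤₚ.*-zeroʳ (+ y))) (ℤₚ.+-identityˡ _)))

      flat-invariant : + p * + p ∣ ⟦ b ⟧ (nudged r') → ∀ y z → Flat (h y) r' → Flat (h z) r'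
      flat-invariant d y z fl = subst (+ p * + p ∣_) (sym (diff z)) (∣m∣n⇒∣m+n (∣n⇒∣m*n (+ z) d) (∣m+n∣m⇒∣n (subst (+ p * + p ∣_) (diff y) fl) (∣n⇒∣m*n (+ y) d)))
        where
        e : ∀ y b P Q → y * b + P - (y * 0ℤ + Q) ≡ y * b + (P - Q)
        e = solve-∀
        diff : ∀ y → ⟦ h y ⟧ (nudged r') - ⟦ h y ⟧ (at r') ≡ + y * ⟦ b ⟧ (nudged r') + (⟦ P ⟧ (nudged r') - ⟦ P ⟧ (at r'))
        diff y = trans (cong₂ _-_ (line y (nudged r')) (trans (line y (at r')) (cong (λ t → + y * t + ⟦ P ⟧ (at r')) zero-at))) (e (+ y) (⟦ b ⟧ (nudged r')) (⟦ P ⟧ (nudged r')) (⟦ P ⟧ (at r')))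

    module _ (r : Row) (rs : List Row) (ss : All (Separated r) rs) (red : Reduced r) (reds : All Reduced rs) (room : suc (2 ℕ.* length rs) ℕ.≤ R) where

      private
        N = newton r rs ss
        b = word R N

        b∈ : b ∈ words vars p R
        b∈ = word∈words vars p R N (newton-admissible r rs ss reds)

        ⟦b⟧ : ∀ x → ⟦ b ⟧ x ≡ codeProduct N x
        ⟦b⟧ x = ⟦word⟧ R N x (ℕₚ.≤-trans (ℕₚ.≤-reflexive (length-newton r rs ss)) (ℕₚ.≤-trans (ℕₚ.n≤1+n _) room))

        b-unit : ¬ + p ∣ ⟦ b ⟧ (at r)
        b-unit d = newton-unit r rs ss (at r) (λ ι → modulo (subst (+ p ∣_) (sym (ℤₚ.+-inverseʳ (+ pt r ι))) (∣0 (+ p)))) (subst (+ p ∣_) (⟦b⟧ (at r)) d)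

        b-at : ∀ {r'} → r' ∈ rs → ⟦ b ⟧ (at r') ≡ 0ℤ
        b-at r'∈ = trans (⟦b⟧ _) (newton-at r rs ss r'∈)

        b-nudged : ∀ {r'} → r' ∈ rs → + p * + p ∣ ⟦ b ⟧ (nudged r')
        b-nudged r'∈ = subst (+ p * + p ∣_) (sym (⟦b⟧ _)) (newton-nudged r rs ss r'∈)

      -- Adding multiples of the Newton product shifts the value at r by units and leaves values at
      -- the other rows, and their increments modulo p², unchanged.
      value-step : p ℕ.* ∑ Ω (λ F → ind (small? F (at r) ×-dec sat? rs F)) ≡ B ℕ.* ∑ Ω (ind ∘ sat? rs)
      value-step = small-step b∈ (at r) b-unit (sat? rs) (λ h P line y z sat → All.tabulate (λ {r'} r'∈ →
        small-invariant b h P line r' (b-at r'∈) y z (proj₁ (All.lookup sat r'∈)) , flat-invariant b h P line r' (b-at r'∈) (b-nudged r'∈) y z (proj₂ (All.lookup sat r'∈))))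

      smalls? : ∀ rs F → Dec (All (λ r → Small F (at r)) rs)
      smalls? rs F = All.all? (λ r → small? F (at r)) rs

      only-value-step : p ℕ.* ∑ Ω (λ F → ind (small? F (at r) ×-dec smalls? rs F)) ≡ B ℕ.* ∑ Ω (ind ∘ smalls? rs)
      only-value-step = small-step b∈ (at r) b-unit (smalls? rs) (λ h P line y z sat → All.tabulate (λ {r'} r'∈ →
        small-invariant b h P line r' (b-at r'∈) y z (All.lookup sat r'∈)))

      -- One more factor, vanishing at r in a coordinate κ that the direction moves, also keeps the
      -- value at r fixed; the increment at r then changes by p times a unit, so one coefficient at
      -- most achieves flatness.
      flat-step : T (live r) → Moving r → p ℕ.* ∑ Ω (ind ∘ sat? (r ∷ rs)) ℕ.≤ 1 ℕ.* ∑ Ω (λ F → ind (small? F (at r) ×-dec sat? rs F))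
      flat-step alive moving = unique-step b'∈ (λ F → small? F (at r) ×-dec sat? rs F) (sat? (r ∷ rs)) unique spread
        where
        κ = proj₁ (find (moving alive))
        N' = (κ , pt r κ) ∷ N
        b' = word R N'
        b'∈ : b' ∈ words vars p R
        b'∈ = word∈words vars p R N' ((proj₁ (proj₂ (find (moving alive))) , red κ) ∷ newton-admissible r rs ss reds)
        ⟦b'⟧ : ∀ x → ⟦ b' ⟧ x ≡ (x κ - + pt r κ) * codeProduct N x
        ⟦b'⟧ x = ⟦word⟧ R N' x (ℕₚ.≤-trans (s≤s (ℕₚ.≤-reflexive (length-newton r rs ss))) room)
        b'-r : ⟦ b' ⟧ (at r) ≡ 0ℤ
        b'-r = trans (⟦b'⟧ (at r)) (cong (_* codeProduct N (at r)) (ℤₚ.+-inverseʳ (+ pt r κ)))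
        b'-at : ∀ {r'} → r' ∈ rs → ⟦ b' ⟧ (at r') ≡ 0ℤ
        b'-at {r'} r'∈ = trans (⟦b'⟧ _) (trans (cong ((at r' κ - + pt r κ) *_) (newton-at r rs ss r'∈)) (ℤₚ.*-zeroʳ (at r' κ - + pt r κ)))
        b'-nudged : ∀ {r'} → r' ∈ rs → + p * + p ∣ ⟦ b' ⟧ (nudged r')
        b'-nudged {r'} r'∈ = subst (+ p * + p ∣_) (sym (⟦b'⟧ _)) (∣n⇒∣m*n (nudged r' κ - + pt r κ) (newton-nudged r rs ss r'∈))
        spread : ∀ h P → Line p b' h P → ∀ y z → Sat (r ∷ rs) (h y) → Small (h z) (at r) × Sat rs (h z)
        spread h P line y z (s ∷ sat) = small-invariant b' h P line r b'-r y z (proj₁ s) , All.tabulate (λ {r'} r'∈ →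
          small-invariant b' h P line r' (b'-at r'∈) y z (proj₁ (All.lookup sat r'∈)) , flat-invariant b' h P line r' (b'-at r'∈) (b'-nudged r'∈) y z (proj₂ (All.lookup sat r'∈)))
        c = codeProduct N (nudged r)
        c-unit : ¬ + p ∣ c
        c-unit = newton-unit r rs ss (nudged r) (λ ι → modulo (divides (+ dir r ι) (e (+ pt r ι) (+ p) (+ dir r ι))))
          where
          e : ∀ a p d → a + p * d - a ≡ d * p
          e = solve-∀
        unit : ¬ + p ∣ + dir r κ * c
        unit d with primeLike-prime pp (+ dir r κ) c d
        ... | inj₁ d₁ = proj₂ (proj₂ (find (moving alive))) d₁
        ... | inj₂ d₂ = c-unit d₂
        unique : ∀ h P → Line p b' h P → ∀ {y z} → y ℕ.< p → z ℕ.< p → Sat (r ∷ rs) (h y) → Sat (r ∷ rs) (h z) → y ≡ z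
        unique h P line {y} {z} y<p z<p (s ∷ _) (s' ∷ _) = Mod-ℕ⇒≡ y<p z<p (cancel-unit unit (+ y) (+ z)
            (*-cancelˡ-∣ (+ p) (subst (+ p * + p ∣_) total (∣m∣n⇒∣m-n (proj₂ s) (proj₂ s')))))
          where
          Δ : ∀ y → ⟦ h y ⟧ (nudged r) - ⟦ h y ⟧ (at r) ≡ + y * (+ p * (+ dir r κ * c)) + (⟦ P ⟧ (nudged r) - ⟦ P ⟧ (at r))
          Δ y = trans (cong₂ _-_ (trans (line y (nudged r)) (cong (λ t → + y * t + ⟦ P ⟧ (nudged r)) (⟦b'⟧ (nudged r)))) (trans (line y (at r)) (cong (λ t → + y * t + ⟦ P ⟧ (at r)) b'-r)))
              (e (+ y) (+ pt r κ) (+ p) (+ dir r κ) c (⟦ P ⟧ (nudged r)) (⟦ P ⟧ (at r)))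
            where
            e : ∀ y a p d c P Q → y * ((a + p * d - a) * c) + P - (y * 0ℤ + Q) ≡ y * (p * (d * c)) + (P - Q)
            e = solve-∀
          e' : ∀ y z p u Q → y * (p * u) + Q - (z * (p * u) + Q) ≡ p * ((y - z) * u)
          e' = solve-∀
          total : ⟦ h y ⟧ (nudged r) - ⟦ h y ⟧ (at r) - (⟦ h z ⟧ (nudged r) - ⟦ h z ⟧ (at r)) ≡ + p * ((+ y - + z) * (+ dir r κ * c))
          total = trans (cong₂ _-_ (Δ y) (Δ z)) (e' (+ y) (+ z) (+ p) (+ dir r κ * c) (⟦ P ⟧ (nudged r) - ⟦ P ⟧ (at r)))

      flat-step-weighted : Moving r → p ℕ.* ∑ Ω (ind ∘ sat? (r ∷ rs)) ℕ.≤ weight r ℕ.* ∑ Ω (λ F → ind (small? F (at r) ×-dec sat? rs F))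
      flat-step-weighted moving with live r in eq
      ... | true = flat-step (subst T (sym eq) tt) (subst (λ l → T l → _) (sym eq) moving)
      ... | false = ℕₚ.*-monoʳ-≤ p (∑-mono Ω (λ F → ind-mono (sat? (r ∷ rs) F) (small? F (at r) ×-dec sat? rs F) (λ { (s ∷ sat) → proj₁ s , sat })))

    -- Each row costs B / p for its value and 1 / p for its derivative, the latter returned by
    -- `weight` in a dead row. The derivative is stripped first, as its line keeps the value at r
    -- constant.
    rows-count : ∀ rs → AllPairs Separated rs → All Reduced rs → All Moving rs → 2 ℕ.* length rs ℕ.≤ R →
      p ℕ.^ (2 ℕ.* length rs) ℕ.* ∑ Ω (ind ∘ sat? rs) ℕ.≤ B ℕ.^ length rs ℕ.* weights rs ℕ.* length Ω
    rows-count [] _ _ _ _ = ℕₚ.≤-reflexive (trans (ℕₚ.*-identityˡ _) (trans (∑-const Ω 1) (trans (ℕₚ.*-identityʳ _) (sym (ℕₚ.*-identityˡ _)))))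
    rows-count (r ∷ rs) (ss ∷ sep) (red ∷ reds) (mov ∷ movs) room = begin
      p ℕ.^ (2 ℕ.* suc n) ℕ.* X                       ≡⟨ cong (λ e → p ℕ.^ e ℕ.* X) (ℕₚ.*-suc 2 n) ⟩
      p ℕ.* (p ℕ.* P) ℕ.* X                           ≡⟨ e₁ p P X ⟩
      P ℕ.* p ℕ.* (p ℕ.* X)                           ≤⟨ ℕₚ.*-monoʳ-≤ (P ℕ.* p) (flat-step-weighted r rs ss red reds room' mov) ⟩
      P ℕ.* p ℕ.* (weight r ℕ.* Y)                    ≡⟨ e₂ P p (weight r) Y ⟩
      P ℕ.* weight r ℕ.* (p ℕ.* Y)                    ≡⟨ cong (P ℕ.* weight r ℕ.*_) (value-step r rs ss red reds room') ⟩
      P ℕ.* weight r ℕ.* (B ℕ.* Z)                    ≡⟨ e₃ P (weight r) B Z ⟩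
      B ℕ.* weight r ℕ.* (P ℕ.* Z)                    ≤⟨ ℕₚ.*-monoʳ-≤ (B ℕ.* weight r) (rows-count rs sep reds movs (ℕₚ.≤-trans (ℕₚ.n≤1+n _) room')) ⟩
      B ℕ.* weight r ℕ.* (B ℕ.^ n ℕ.* weights rs ℕ.* length Ω) ≡⟨ e₄ B (weight r) (B ℕ.^ n) (weights rs) (length Ω) ⟩
      B ℕ.* B ℕ.^ n ℕ.* (weight r ℕ.* weights rs) ℕ.* length Ω ∎
      where
      open ℕₚ.≤-Reasoning
      n = length rs
      P = p ℕ.^ (2 ℕ.* n)
      X = ∑ Ω (ind ∘ sat? (r ∷ rs))
      Y = ∑ Ω (λ F → ind (small? F (at r) ×-dec sat? rs F))
      Z = ∑ Ω (ind ∘ sat? rs)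
      room' : suc (2 ℕ.* n) ℕ.≤ R
      room' = ℕₚ.≤-trans (ℕₚ.n≤1+n _) (ℕₚ.≤-trans (ℕₚ.≤-reflexive (sym (ℕₚ.*-suc 2 n))) room)
      e₁ : ∀ p P X → p ℕ.* (p ℕ.* P) ℕ.* X ≡ P ℕ.* p ℕ.* (p ℕ.* X)
      e₁ = ℕSolver.solve-∀
      e₂ : ∀ P p w Y → P ℕ.* p ℕ.* (w ℕ.* Y) ≡ P ℕ.* w ℕ.* (p ℕ.* Y)
      e₂ = ℕSolver.solve-∀
      e₃ : ∀ P w B Z → P ℕ.* w ℕ.* (B ℕ.* Z) ≡ B ℕ.* w ℕ.* (P ℕ.* Z)
      e₃ = ℕSolver.solve-∀
      e₄ : ∀ B w b W Ω → B ℕ.* w ℕ.* (b ℕ.* W ℕ.* Ω) ≡ B ℕ.* b ℕ.* (w ℕ.* W) ℕ.* Ω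
      e₄ = ℕSolver.solve-∀

    -- Exact independence of the value conditions, for the lower bound on the expected number of
    -- edges.
    smalls-count : ∀ rs → AllPairs Separated rs → All Reduced rs → 2 ℕ.* length rs ℕ.≤ R →
      B ℕ.^ length rs ℕ.* length Ω ≡ p ℕ.^ length rs ℕ.* ∑ Ω (λ F → ind (All.all? (λ r → small? F (at r)) rs))
    smalls-count [] _ _ _ = sym (trans (ℕₚ.*-identityˡ _) (trans (∑-const Ω 1) (trans (ℕₚ.*-identityʳ _) (sym (ℕₚ.*-identityˡ _)))))
    smalls-count (r ∷ rs) (ss ∷ sep) (red ∷ reds) room = begin
      B ℕ.* B ℕ.^ n ℕ.* length Ω    ≡⟨ ℕₚ.*-assoc B (B ℕ.^ n) (length Ω) ⟩
      B ℕ.* (B ℕ.^ n ℕ.* length Ω)  ≡⟨ cong (B ℕ.*_) (smalls-count rs sep reds (ℕₚ.≤-trans (ℕₚ.n≤1+n _) room')) ⟩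
      B ℕ.* (p ℕ.^ n ℕ.* Z)         ≡⟨ e₁ B (p ℕ.^ n) Z ⟩
      p ℕ.^ n ℕ.* (B ℕ.* Z)         ≡⟨ cong (p ℕ.^ n ℕ.*_) (sym (only-value-step r rs ss red reds room')) ⟩
      p ℕ.^ n ℕ.* (p ℕ.* Y)         ≡⟨ e₂ p (p ℕ.^ n) Y ⟩
      p ℕ.* p ℕ.^ n ℕ.* Y           ≡⟨ cong (p ℕ.* p ℕ.^ n ℕ.*_) (∑-cong Ω (λ F → ℕₚ.≤-antisym
          (ind-mono (small? F (at r) ×-dec All.all? (λ r → small? F (at r)) rs) (All.all? (λ r → small? F (at r)) (r ∷ rs)) (λ { (s , ss) → s ∷ ss }))
          (ind-mono (All.all? (λ r → small? F (at r)) (r ∷ rs)) (small? F (at r) ×-dec All.all? (λ r → small? F (at r)) rs) (λ { (s ∷ ss) → s , ss })))) ⟩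
      p ℕ.* p ℕ.^ n ℕ.* ∑ Ω (λ F → ind (All.all? (λ r → small? F (at r)) (r ∷ rs))) ∎
      where
      open ≡-Reasoning
      n = length rs
      Y = ∑ Ω (λ F → ind (small? F (at r) ×-dec All.all? (λ r → small? F (at r)) rs))
      Z = ∑ Ω (λ F → ind (All.all? (λ r → small? F (at r)) rs))
      room' : suc (2 ℕ.* n) ℕ.≤ R
      room' = ℕₚ.≤-trans (ℕₚ.n≤1+n _) (ℕₚ.≤-trans (ℕₚ.≤-reflexive (sym (ℕₚ.*-suc 2 n))) room)
      e₁ : ∀ B P Z → B ℕ.* (P ℕ.* Z) ≡ P ℕ.* (B ℕ.* Z)
      e₁ = ℕSolver.solve-∀
      e₂ : ∀ p P Y → P ℕ.* (p ℕ.* Y) ≡ p ℕ.* P ℕ.* Y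
      e₂ = ℕSolver.solve-∀

-- Numbering the unknowns of a tree and matching them with equations.

module TreeLayout where

  open import Data.Nat
  open import Data.Nat.Properties
  open import Data.Nat.DivMod
  open import Data.Nat.Tactic.RingSolver using (solve-∀)
  open import Data.Bool using (Bool; not; if_then_else_)
  import Data.Bool as Bool
  open import Data.Bool.Properties using (not-involutive; not-¬; ¬-not)
  open import Data.Fin using (Fin; toℕ; fromℕ<)
  import Data.Fin.Properties as Finₚ
  open import Data.Product using (Σ; _×_; _,_; proj₁; proj₂)
  open import Data.Sum using (_⊎_; inj₁; inj₂)
  open import Data.Empty using (⊥-elim)
  open import Function using (_∘_)
  open import Relation.Nullary using (Dec; yes; no; does; contradiction)
  open import Relation.Nullary.Decidable using (dec-true; dec-false)
  open import Relation.Binary.PropositionalEquality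

  -- The coordinates of both endpoints of an edge, and one more variable `row` for the number of the
  -- equation: a single random polynomial supplies all c equations.
  data Var (dim : Bool → ℕ) : Set where
    co  : (b : Bool) → Fin (dim b) → Var dim
    row : Var dim

  /-unique : ∀ {i j n} .{{_ : NonZero n}} → j < n → (i * n + j) / n ≡ i
  /-unique {i} {j} {n} j<n = begin
    (i * n + j) / n     ≡⟨ +-distrib-/ (i * n) j (subst₂ (λ a b → a + b < n) (sym (m*n%n≡0 i n)) (sym (m<n⇒m%n≡m j<n)) j<n) ⟩
    i * n / n + j / n   ≡⟨ cong₂ _+_ (m*n/n≡m i n) (m<n⇒m/n≡0 j<n) ⟩
    i + 0               ≡⟨ +-identityʳ i ⟩
    i ∎
    where open ≡-Reasoning

  %-unique : ∀ {i j n} .{{_ : NonZero n}} → j < n → (i * n + j) % n ≡ j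
  %-unique {i} {j} {n} j<n = begin
    (i * n + j) % n ≡⟨ cong (_% n) (+-comm (i * n) j) ⟩
    (j + i * n) % n ≡⟨ [m+kn]%n≡m%n j i n ⟩
    j % n           ≡⟨ m<n⇒m%n≡m j<n ⟩
    j ∎
    where open ≡-Reasoning

  /-%-bound : ∀ {s n ξ} .{{_ : NonZero n}} → ξ < s * n → ξ / n < s
  /-%-bound {s} {n} {ξ} h = m<n*o⇒m/o<n {ξ} {s} {n} h

  *+-bound : ∀ {i j s n} → i < s → j < n → i * n + j < s * n
  *+-bound {i} {j} {s} {n} i<s j<n = ≤-trans (≤-reflexive (sym (+-suc (i * n) j))) (≤-trans (+-monoʳ-≤ (i * n) j<n) (≤-trans (≤-reflexive (+-comm (i * n) n)) (*-monoˡ-≤ n i<s)))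

  -- The tree hanging from the roots 0 … s-1 (on side b): path i runs through positions
  -- 0 (the root) … suc last (the centre). The unknowns of path i are laid out consecutively:
  -- the coordinates of positions 1 … last, then the i-th block of a₀ coordinates of the centre.
  -- Unknown number L of a path is matched with equation L % c of its edge number L / c.
  module Tree (dim : Bool → ℕ) (b : Bool) (s k' c a₀ : ℕ) {{_ : NonZero c}} {{_ : NonZero a₀}} where

    side : ℕ → Bool
    side zero    = b
    side (suc j) = not (side j)

    off : ℕ → ℕ
    off zero    = 0
    off (suc j) = off j + dim (side (suc j))

    last : ℕ
    last = suc (2 * k')

    Λ n : ℕ
    Λ = off last + a₀
    n = s * Λ

    instance
      Λ≢0 : NonZero Λ
      Λ≢0 = >-nonZero (≤-trans (>-nonZero⁻¹ a₀) (m≤n+m a₀ (off last)))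

    -- The index j stands for position suc j, so j = `last` is the centre. Its coordinates are
    -- common to all paths: number β is stored with path β / a₀, whatever i is.
    coordinate : ℕ → ℕ → ℕ → ℕ
    coordinate i j β with j ≟ last
    ... | yes _ = (β / a₀) * Λ + (off last + β % a₀)
    ... | no  _ = i * Λ + (off j + β)

    vertex : {A : Set} → (ℕ → ℕ → A) → (ℕ → A) → ℕ → ℕ → ℕ → A
    vertex ρ z i zero    β = ρ i β
    vertex ρ z i (suc j) β = z (coordinate i j β)

    -- Edge e joins positions e and suc e of its path; this is its end on side b'.
    pick : Bool → ℕ → ℕ
    pick b' e with side e Bool.≟ b'
    ... | yes _ = e
    ... | no  _ = suc e

    -- Polymorphic, so that one wiring of unknowns into the variables of F serves points, tangent
    -- directions, integers and substituted polynomials.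
    env : {A : Set} → (ℕ → ℕ → A) → (ℕ → A) → (ℕ → A) → ℕ → Var dim → A
    env ρ z κ ξ (co b' β) = vertex ρ z (ξ / Λ) (pick b' ((ξ % Λ) / c)) (toℕ β)
    env ρ z κ ξ row       = κ ((ξ % Λ) % c)

    vertex-natural : {A B : Set} (g : A → B) → ∀ ρ z i j β → g (vertex ρ z i j β) ≡ vertex (λ i β → g (ρ i β)) (g ∘ z) i j β
    vertex-natural g ρ z i zero    β = refl
    vertex-natural g ρ z i (suc j) β = refl

    env-natural : {A B : Set} (g : A → B) → ∀ ρ z κ ξ ι → g (env ρ z κ ξ ι) ≡ env (λ i β → g (ρ i β)) (g ∘ z) (g ∘ κ) ξ ι
    env-natural g ρ z κ ξ (co b' β) = vertex-natural g ρ z (ξ / Λ) (pick b' ((ξ % Λ) / c)) (toℕ β)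
    env-natural g ρ z κ ξ row       = refl

    side-pick : ∀ b' e → side (pick b' e) ≡ b'
    side-pick b' e with side e Bool.≟ b'
    ... | yes eq = eq
    ... | no  ne = trans (cong not (¬-not ne)) (not-involutive b')

    pick-≤ : ∀ b' e → pick b' e ≤ suc e
    pick-≤ b' e with side e Bool.≟ b'
    ... | yes _ = n≤1+n e
    ... | no  _ = ≤-refl

    pick-injective : ∀ b' e e' → pick b' e ≡ pick b' e' → pick (not b') e ≡ pick (not b') e' → e ≡ e'
    pick-injective b' e e' p₁ p₂ with side e Bool.≟ b' | side e' Bool.≟ b' | side e Bool.≟ not b' | side e' Bool.≟ not b'
    ... | yes _ | yes _ | _ | _ = p₁
    ... | no _  | no _  | _ | _ = suc-injective p₁
    ... | yes q | no _  | yes q' | _ = contradiction (trans (sym q) q') (not-¬ refl)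
    ... | no _  | yes q | _ | yes q' = contradiction (trans (sym q) q') (not-¬ refl)
    ... | no ne | yes _ | no ne' | _ = contradiction (¬-not ne) ne'
    ... | yes _ | no ne | _ | no ne' = contradiction (¬-not ne) ne'
    -- Crossed ends would mean e = suc e' and suc e = e'.
    ... | yes _ | no _  | no _ | yes _ = ⊥-elim (m+1+n≢m e' {1} (trans (+-comm e' 2) (trans (cong suc (sym p₁)) p₂)))
    ... | no _  | yes _ | yes _ | no _ = ⊥-elim (m+1+n≢m e {1} (trans (+-comm e 2) (trans (cong suc p₁) (sym p₂))))

    off-mono : ∀ {i j} → i ≤ j → off i ≤ off j
    off-mono {i} {j} i≤j = go (≤⇒≤′ i≤j)
      where
      go : ∀ {j} → i ≤′ j → off i ≤ off j
      go ≤′-refl = ≤-refl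
      go (≤′-step h) = ≤-trans (go h) (m≤m+n _ _)

    locate : ℕ → ℕ → ℕ × ℕ
    locate zero    L = 0 , L
    locate (suc j) L with off (suc j) ≤? L
    ... | yes _ = suc j , L ∸ off (suc j)
    ... | no  _ = locate j L

    -- No upper bound on L is claimed for the final segment: in the layout that segment is only one
    -- block of the centre and not a whole vertex.
    locate-spec : ∀ N L → proj₁ (locate N L) ≤ N × off (proj₁ (locate N L)) + proj₂ (locate N L) ≡ L ×
      (proj₁ (locate N L) ≡ N ⊎ proj₁ (locate N L) < N × L < off (suc (proj₁ (locate N L))))
    locate-spec zero L = z≤n , refl , inj₁ refl
    locate-spec (suc j) L with off (suc j) ≤? L
    ... | yes h = ≤-refl , m+[n∸m]≡n h , inj₁ refl
    ... | no h with locate-spec j L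
    ...   | le , eq , inj₁ e = ≤-trans le (n≤1+n j) , eq , inj₂ (s≤s le , subst (λ x → L < off (suc x)) (sym e) (≰⇒> h))
    ...   | le , eq , inj₂ (_ , lt) = ≤-trans le (n≤1+n j) , eq , inj₂ (s≤s le , lt)

    locate-unique : ∀ {N j β} → j ≤ N → (j ≡ N ⊎ β < dim (side (suc j))) → locate N (off j + β) ≡ (j , β)
    locate-unique {zero} {zero} _ _ = refl
    locate-unique {suc N} {j} {β} j≤ h with off (suc N) ≤? off j + β
    ... | yes le = final (j ≟ suc N)
      where
      final : Dec (j ≡ suc N) → (suc N , off j + β ∸ off (suc N)) ≡ (j , β)
      final (yes refl) = cong (suc N ,_) (m+n∸m≡n (off (suc N)) β)
      final (no ne) = contradiction le (<⇒≱ (<-≤-trans (+-monoʳ-< (off j) (below h)) (off-mono (≤∧≢⇒< j≤ ne))))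
        where
        below : j ≡ suc N ⊎ β < dim (side (suc j)) → β < dim (side (suc j))
        below (inj₁ e) = contradiction e ne
        below (inj₂ l) = l
    ... | no nle = locate-unique (≤-pred (≤∧≢⇒< j≤ ne)) (weaken h)
      where
      ne : j ≢ suc N
      ne refl = nle (m≤m+n _ _)
      weaken : j ≡ suc N ⊎ β < dim (side (suc j)) → j ≡ N ⊎ β < dim (side (suc j))
      weaken (inj₁ e) = contradiction e ne
      weaken (inj₂ l) = inj₂ l

    entry : (ℕ → ℕ → ℕ → ℕ) → ℕ → ℕ × ℕ → ℕ
    entry X i (j , β) = if does (j ≟ last) then X i (suc last) (i * a₀ + β) else X i (suc j) β

    -- The inverse of `coordinate`: the vector of unknowns that encodes given vertex coordinates X.
    flatten : (ℕ → ℕ → ℕ → ℕ) → ℕ → ℕ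
    flatten X ξ = entry X (ξ / Λ) (locate last (ξ % Λ))

    side-last : side (suc last) ≡ b
    side-last = trans (not-involutive (side (2 * k'))) (even k')
      where
      even : ∀ k → side (2 * k) ≡ b
      even zero = refl
      even (suc k) = trans (cong side (*-suc 2 k)) (trans (not-involutive (side (2 * k))) (even k))

    module Layout (c≤dim : ∀ b' → c ≤ dim b') (split : dim b ≡ s * a₀) (fits : Λ ≤ suc last * c) where

      off-lower : ∀ j → j * c ≤ off j
      off-lower zero    = z≤n
      off-lower (suc j) = ≤-trans (≤-reflexive (+-comm c (j * c))) (+-mono-≤ (off-lower j) (c≤dim (side (suc j))))

      -- Counted from the far end: each later position takes at least c unknowns, and together with
      -- the block of the centre they fit into suc last * c.
      off-upper : ∀ j → j ≤ last → off j ≤ suc j * c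
      off-upper j j≤last = +-cancelʳ-≤ (d * c) (off j) (suc j * c) (≤-trans (grow d) (≤-trans (≤-reflexive (cong off (m+[n∸m]≡n j≤last))) (≤-trans (m≤m+n (off last) a₀) (≤-trans fits (≤-reflexive eq)))))
        where
        d = last ∸ j
        grow : ∀ d → off j + d * c ≤ off (j + d)
        grow zero = ≤-reflexive (trans (+-identityʳ _) (cong off (sym (+-identityʳ j))))
        grow (suc d) = ≤-trans (≤-reflexive (r (off j) c (d * c))) (≤-trans (+-mono-≤ (grow d) (c≤dim (side (suc (j + d))))) (≤-reflexive (cong off (sym (+-suc j d)))))
          where
          r : ∀ o c d → o + (c + d) ≡ o + d + c
          r = solve-∀
        eq : suc last * c ≡ suc j * c + d * c
        eq = trans (cong (λ x → suc x * c) (sym (m+[n∸m]≡n j≤last))) (*-distribʳ-+ c (suc j) d)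

      centre-< : ∀ {i β} → i < s → β < a₀ → i * a₀ + β < dim b
      centre-< i<s β<a₀ = subst (_ <_) (sym split) (*+-bound i<s β<a₀)

      edge-≤last : ∀ {L} → L < Λ → L / c ≤ last
      edge-≤last {L} L<Λ = ≤-pred (m<n*o⇒m/o<n {L} {suc last} {c} (<-≤-trans L<Λ fits))

      pick-near : ∀ {e j} → e ≡ j ⊎ e ≡ suc j → pick (side (suc j)) e ≡ suc j
      pick-near {e} {j} h with side e Bool.≟ side (suc j) | h
      ... | yes q | inj₁ refl = contradiction q (not-¬ refl)
      ... | yes _ | inj₂ e≡ = e≡
      ... | no _  | inj₁ e≡ = cong suc e≡
      ... | no ne | inj₂ refl = contradiction refl ne

      near : ∀ {e j} → j ≤ e → e < suc (suc j) → e ≡ j ⊎ e ≡ suc j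
      near {e} {j} j≤e e< with e ≟ j
      ... | yes q = inj₁ q
      ... | no ne = inj₂ (≤-antisym (≤-pred e<) (≤∧≢⇒< j≤e (λ q → ne (sym q))))

      -- An unknown of position suc j has number L with j * c ≤ off j ≤ L < off (suc j) ≤ suc (suc
      -- j) * c, so its edge L / c is j or suc j, one of the two at that position. In the block of
      -- the centre, L ≥ last * c forces the last edge.
      incident : ∀ ξ → ξ < n → Σ (Var dim) λ ι → ∀ {A : Set} (ρ : ℕ → ℕ → A) z κ → env ρ z κ ξ ι ≡ z ξ
      incident ξ ξ<n = found (locate last L) (locate-spec last L)
        where
        i = ξ / Λ
        L = ξ % Λ
        L<Λ : L < Λ
        L<Λ = m%n<n ξ Λ
        i<s : i < s
        i<s = /-%-bound {s} ξ<n
        ξ≡ : i * Λ + L ≡ ξ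
        ξ≡ = trans (+-comm (i * Λ) L) (sym (m≡m%n+[m/n]*n ξ Λ))
        found : (jβ : ℕ × ℕ) → proj₁ jβ ≤ last × off (proj₁ jβ) + proj₂ jβ ≡ L × (proj₁ jβ ≡ last ⊎ proj₁ jβ < last × L < off (suc (proj₁ jβ))) →
          Σ (Var dim) λ ι → ∀ {A : Set} (ρ : ℕ → ℕ → A) z κ → env ρ z κ ξ ι ≡ z ξ
        found (j , β) (j≤ , L≡ , inj₂ (j<last , L<)) = co (side (suc j)) (fromℕ< β<) , λ ρ z κ → trans (cong (λ j' → vertex ρ z i j' (toℕ (fromℕ< β<))) (pick-near (near j≤e e<))) (cong z at)
          where
          β< : β < dim (side (suc j))
          β< = +-cancelˡ-< (off j) β _ (subst (_< off (suc j)) (sym L≡) L<)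
          j≤e : j ≤ L / c
          j≤e = ≤-trans (≤-reflexive (sym (m*n/n≡m j c))) (/-monoˡ-≤ c (≤-trans (off-lower j) (≤-trans (m≤m+n _ β) (≤-reflexive L≡))))
          e< : L / c < suc (suc j)
          e< = m<n*o⇒m/o<n {L} {suc (suc j)} {c} (<-≤-trans L< (off-upper (suc j) j<last))
          at : coordinate i j (toℕ (fromℕ< β<)) ≡ ξ
          at with j ≟ last
          ... | yes e = contradiction e (<⇒≢ j<last)
          ... | no _ = trans (cong (λ x → i * Λ + (off j + x)) (Finₚ.toℕ-fromℕ< β<)) (trans (cong (i * Λ +_) L≡) ξ≡)
        found (j , β) (j≤ , L≡ , inj₁ refl) = co (side (suc last)) (fromℕ< β'<) , λ ρ z κ → trans (cong (λ j' → vertex ρ z i j' (toℕ (fromℕ< β'<))) (pick-near (inj₁ e≡))) (cong z at)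
          where
          β<a₀ : β < a₀
          β<a₀ = +-cancelˡ-< (off last) β a₀ (subst (_< Λ) (sym L≡) L<Λ)
          β'< : i * a₀ + β < dim (side (suc last))
          β'< = subst (λ x → i * a₀ + β < dim x) (sym side-last) (centre-< i<s β<a₀)
          e≡ : L / c ≡ last
          e≡ = ≤-antisym (edge-≤last L<Λ) (≤-trans (≤-reflexive (sym (m*n/n≡m last c))) (/-monoˡ-≤ c (≤-trans (off-lower last) (≤-trans (m≤m+n _ β) (≤-reflexive L≡)))))
          at : coordinate i last (toℕ (fromℕ< β'<)) ≡ ξ
          at with last ≟ last
          ... | no ne = contradiction refl ne
          ... | yes _ = trans (cong (λ x → (x / a₀) * Λ + (off last + x % a₀)) (Finₚ.toℕ-fromℕ< β'<))
                  (trans (cong₂ (λ x y → x * Λ + (off last + y)) (/-unique {i} β<a₀) (%-unique {i} β<a₀)) (trans (cong (i * Λ +_) L≡) ξ≡))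

      module _ (X : ℕ → ℕ → ℕ → ℕ) (centre : ∀ i i' β → i < s → i' < s → X i (suc last) β ≡ X i' (suc last) β) where

        segment-< : ∀ {j β} → j < last → β < dim (side (suc j)) → off j + β < Λ
        segment-< {j} j<last β< = <-≤-trans (+-monoʳ-< (off j) β<) (≤-trans (off-mono j<last) (m≤m+n (off last) a₀))

        flatten-at : ∀ i L jβ → L < Λ → locate last L ≡ jβ → flatten X (i * Λ + L) ≡ entry X i jβ
        flatten-at i L jβ L<Λ eq = cong₂ (entry X) (/-unique {i} {L} {Λ} L<Λ) (trans (cong (locate last) (%-unique {i} {L} {Λ} L<Λ)) eq)

        flatten-vertex : ∀ i j β → i < s → j ≤ last → β < dim (side (suc j)) →
          coordinate i j β < n × flatten X (coordinate i j β) ≡ X i (suc j) β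
        flatten-vertex i j β i<s j≤last β< with j ≟ last
        ... | no ne = *+-bound i<s (segment-< j<last β<) , trans (flatten-at i (off j + β) (j , β) (segment-< j<last β<) (locate-unique j≤last (inj₂ β<))) (branch ne)
          where
          j<last = ≤∧≢⇒< j≤last ne
          branch : j ≢ last → entry X i (j , β) ≡ X i (suc j) β
          branch ne = cong (λ t → if t then X i (suc last) (i * a₀ + β) else X i (suc j) β) (dec-false (j ≟ last) ne)
        ... | yes refl = *+-bound i'<s L<Λ , trans (flatten-at (β / a₀) (off last + β % a₀) (last , β % a₀) L<Λ (locate-unique ≤-refl (inj₁ refl))) (trans branch (trans (cong (X (β / a₀) (suc last)) (trans (+-comm (β / a₀ * a₀) (β % a₀)) (sym (m≡m%n+[m/n]*n β a₀)))) (centre (β / a₀) i β i'<s i<s)))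
          where
          i'<s : β / a₀ < s
          i'<s = /-%-bound {s} (subst (β <_) (trans (cong dim side-last) split) β<)
          L<Λ : off last + β % a₀ < Λ
          L<Λ = +-monoʳ-< (off last) (m%n<n β a₀)
          branch : entry X (β / a₀) (last , β % a₀) ≡ X (β / a₀) (suc last) (β / a₀ * a₀ + β % a₀)
          branch = cong (λ t → if t then X (β / a₀) (suc last) (β / a₀ * a₀ + β % a₀) else X (β / a₀) (suc last) (β % a₀)) (dec-true (last ≟ last) refl)

-- Lists of candidate trees, tangent vectors and digits.

module TreeGraphs where

  open import Data.Nat as ℕ using (ℕ; zero; suc; z≤n; s≤s; NonZero)
  import Data.Nat.Properties as ℕₚ
  open import Data.Nat.DivMod using (m%n<n; m≡m%n+[m/n]*n; _mod_; m<n⇒m%n≡m)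
  open import Data.Nat.Primality using (Prime; prime⇒nonZero)
  import Data.Nat.Tactic.RingSolver as ℕSolver
  open import Data.Integer using (ℤ; +_; -_; 0ℤ; 1ℤ; _+_; _*_; _-_)
  open import Data.Integer.Divisibility.Signed hiding (quotient)
  open import Data.Fin using (Fin; toℕ; fromℕ<; zero; suc)
  open import Data.List using (List; []; _∷_; _++_; map; concatMap; length; upTo; applyUpTo; allFin; lookup; tabulate)
  import Data.List.Properties as Listₚ
  open import Data.List.Membership.Propositional using (_∈_; find; lose)
  open import Data.List.Membership.Propositional.Properties using (∈-map⁺; ∈-map⁻; ∈-concatMap⁺; ∈-concatMap⁻; ∈-upTo⁺; ∈-upTo⁻; ∈-++⁺ˡ; ∈-++⁺ʳ; ∈-++⁻; ∈-allFin; ∈-lookup)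
  open import Data.List.Relation.Unary.Any as Any using (Any; here; there)
  open import Data.List.Relation.Unary.All as All using (All; []; _∷_)
  import Data.List.Relation.Unary.All.Properties as Allₗ
  open import Data.List.Relation.Unary.AllPairs as AllPairs using (AllPairs; []; _∷_)
  open import Data.Product using (∃-syntax; _×_; _,_; proj₁; proj₂)
  open import Data.Sum using (_⊎_; inj₁; inj₂; [_,_]′)
  open import Data.Bool using (Bool; true; false; not; if_then_else_) renaming (T to IsTrue)
  open import Data.Empty using (⊥)
  open import Function using (_∘_; id)
  open import Relation.Nullary using (¬_; Dec; yes; no; contradiction; ¬?; does)
  open import Relation.Nullary.Decidable using (_×-dec_; decidable-stable)
  open import Relation.Binary.PropositionalEquality
  import Data.Integer.Properties as ℤₚ
  open import Data.Integer.DivMod using (_%ℕ_; _/ℕ_; a≡a%ℕn+[a/ℕn]*n)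
  open import Data.Integer.Tactic.RingSolver using (solve-∀)
  import Data.Fin.Properties as Finₚ
  import Data.List.Relation.Unary.AllPairs.Properties as AllPairsₚ
  import Data.List.Relation.Unary.Unique.Propositional.Properties as Uniqueₚ
  open import Defs
  import Data.Sum.Properties as Sumₚ
  open import Data.Bool.Properties using (not-¬; not-involutive)
  import Data.Bool as Bool
  open PrimeGaps using (^-*-distrib)
  open NonsingularZeros
  open RandomPolynomials
  open TreeLayout

  allVars : ∀ dim → List (Var dim)
  allVars dim = row ∷ (map (co true) (allFin (dim true)) ++ map (co false) (allFin (dim false)))

  ∈-allVars : ∀ {dim} (ι : Var dim) → ι ∈ allVars dim
  ∈-allVars row = here refl
  ∈-allVars (co true β) = there (∈-++⁺ˡ (∈-map⁺ (co true) (∈-allFin β)))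
  ∈-allVars {dim} (co false β) = there (∈-++⁺ʳ (map (co true) (allFin (dim true))) (∈-map⁺ (co false) (∈-allFin β)))

  get : List ℕ → ℕ → ℕ
  get []       _       = 0
  get (x ∷ xs) zero    = x
  get (x ∷ xs) (suc i) = get xs i

  get-< : ∀ {q} → 0 ℕ.< q → ∀ {xs} → All (ℕ._< q) xs → ∀ i → get xs i ℕ.< q
  get-< 0<q []       i       = 0<q
  get-< 0<q (h ∷ hs) zero    = h
  get-< 0<q (h ∷ hs) (suc i) = get-< 0<q hs i

  get-applyUpTo : ∀ (f : ℕ → ℕ) n i → i ℕ.< n → get (applyUpTo f n) i ≡ f i
  get-applyUpTo f (suc n) zero    _         = refl
  get-applyUpTo f (suc n) (suc i) (s≤s i<n) = get-applyUpTo (f ∘ suc) n i i<n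

  tuples : {A : Set} → ℕ → List A → List (List A)
  tuples zero    xs = [] ∷ []
  tuples (suc n) xs = concatMap (λ x → map (x ∷_) (tuples n xs)) xs

  productBy : {A : Set} → (A → ℕ) → List A → ℕ
  productBy f []       = 1
  productBy f (x ∷ xs) = f x ℕ.* productBy f xs

  ∑-tuples : ∀ {A : Set} n (xs : List A) f → ∑ (tuples n xs) (productBy f) ≡ ∑ xs f ℕ.^ n
  ∑-tuples zero    xs f = refl
  ∑-tuples (suc n) xs f = begin
    ∑ (tuples (suc n) xs) (productBy f)                        ≡⟨ ∑-concatMap xs (λ x → map (x ∷_) (tuples n xs)) (productBy f) ⟩
    ∑ xs (λ x → ∑ (map (x ∷_) (tuples n xs)) (productBy f))    ≡⟨ ∑-cong xs (λ x → trans (∑-map (tuples n xs) (x ∷_) (productBy f)) (∑-* (tuples n xs) (f x) (productBy f))) ⟩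
    ∑ xs (λ x → f x ℕ.* ∑ (tuples n xs) (productBy f))         ≡⟨ ∑-cong xs (λ x → ℕₚ.*-comm (f x) _) ⟩
    ∑ xs (λ x → ∑ (tuples n xs) (productBy f) ℕ.* f x)         ≡⟨ ∑-* xs (∑ (tuples n xs) (productBy f)) f ⟩
    ∑ (tuples n xs) (productBy f) ℕ.* ∑ xs f                   ≡⟨ cong (ℕ._* ∑ xs f) (∑-tuples n xs f) ⟩
    ∑ xs f ℕ.^ n ℕ.* ∑ xs f                                    ≡⟨ ℕₚ.*-comm _ (∑ xs f) ⟩
    ∑ xs f ℕ.* ∑ xs f ℕ.^ n ∎
    where open ≡-Reasoning

  length-tuples : ∀ {A : Set} n (xs : List A) → length (tuples n xs) ≡ length xs ℕ.^ n
  length-tuples n xs = begin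
    length (tuples n xs)                       ≡⟨ sym (trans (∑-const (tuples n xs) 1) (ℕₚ.*-identityʳ _)) ⟩
    ∑ (tuples n xs) (λ _ → 1)                  ≡⟨ ∑-cong (tuples n xs) (λ ys → sym (ones ys)) ⟩
    ∑ (tuples n xs) (productBy (λ _ → 1))      ≡⟨ ∑-tuples n xs (λ _ → 1) ⟩
    ∑ xs (λ _ → 1) ℕ.^ n                       ≡⟨ cong (ℕ._^ n) (trans (∑-const xs 1) (ℕₚ.*-identityʳ _)) ⟩
    length xs ℕ.^ n ∎
    where
    open ≡-Reasoning
    ones : ∀ {A : Set} (ys : List A) → productBy (λ _ → 1) ys ≡ 1
    ones []       = refl
    ones (y ∷ ys) = trans (ℕₚ.*-identityˡ _) (ones ys)

  ∈-tuples⁺ : ∀ {A : Set} {xs ys : List A} → All (_∈ xs) ys → ys ∈ tuples (length ys) xs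
  ∈-tuples⁺ [] = here refl
  ∈-tuples⁺ {xs = xs} {y ∷ ys} (y∈ ∷ h) = ∈-concatMap⁺ (λ x → map (x ∷_) (tuples (length ys) xs)) (Any.map (λ { refl → ∈-map⁺ (y ∷_) (∈-tuples⁺ h) }) y∈)

  ∈-tuples⁻ : ∀ {A : Set} n {xs ys : List A} → ys ∈ tuples n xs → length ys ≡ n × All (_∈ xs) ys
  ∈-tuples⁻ zero (here refl) = refl , []
  ∈-tuples⁻ (suc n) {xs} h with find (∈-concatMap⁻ (λ x → map (x ∷_) (tuples n xs)) {xs = xs} h)
  ... | x , x∈ , ys∈ with ∈-map⁻ (x ∷_) ys∈
  ...   | zs , zs∈ , refl with ∈-tuples⁻ n zs∈
  ...     | len , all = cong suc len , x∈ ∷ all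

  ∑-monoᵐ : ∀ {A : Set} (xs : List A) {f g : A → ℕ} → (∀ {x} → x ∈ xs → f x ℕ.≤ g x) → ∑ xs f ℕ.≤ ∑ xs g
  ∑-monoᵐ []       h = z≤n
  ∑-monoᵐ (x ∷ xs) h = ℕₚ.+-mono-≤ (h (here refl)) (∑-monoᵐ xs (h ∘ there))

  -- Representatives of the lines of 𝔽ₚⁿ: the first nonzero entry is 1.
  normalised : ℕ → ℕ → List (List ℕ)
  normalised p zero    = []
  normalised p (suc n) = map (1 ∷_) (tuples n (upTo p)) ++ map (0 ∷_) (normalised p n)

  -- A zero entry of the tangent vector leaves one derivative condition unused, at the price of a factor p.
  zeroWeight : ℕ → ℕ → ℕ
  zeroWeight p zero    = p
  zeroWeight p (suc _) = 1

  ∑-zeroWeight : ∀ p → ∑ (upTo p) (zeroWeight p) ℕ.≤ 2 ℕ.* p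
  ∑-zeroWeight p = begin
    ∑ (upTo p) (zeroWeight p)                                         ≤⟨ ∑-mono (upTo p) split ⟩
    ∑ (upTo p) (λ y → 1 ℕ.+ p ℕ.* ind (0 ℕ.≟ y))                      ≡⟨ ∑-+ (upTo p) (λ _ → 1) (λ y → p ℕ.* ind (0 ℕ.≟ y)) ⟩
    ∑ (upTo p) (λ _ → 1) ℕ.+ ∑ (upTo p) (λ y → p ℕ.* ind (0 ℕ.≟ y))   ≡⟨ cong₂ ℕ._+_ (length-upTo≡ p) (∑-* (upTo p) p (λ y → ind (0 ℕ.≟ y))) ⟩
    p ℕ.+ p ℕ.* ∑ (upTo p) (λ y → ind (0 ℕ.≟ y))                      ≤⟨ ℕₚ.+-monoʳ-≤ p (ℕₚ.*-monoʳ-≤ p (∑-ind-unique (0 ℕ.≟_) (upTo p) (upTo-unique p) (λ e e' _ _ → trans (sym e) e'))) ⟩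
    p ℕ.+ p ℕ.* 1                                                     ≡⟨ r p ⟩
    2 ℕ.* p ∎
    where
    open ℕₚ.≤-Reasoning
    r : ∀ p → p ℕ.+ p ℕ.* 1 ≡ 2 ℕ.* p
    r = ℕSolver.solve-∀
    split : ∀ y → zeroWeight p y ℕ.≤ 1 ℕ.+ p ℕ.* ind (0 ℕ.≟ y)
    split zero    = ℕₚ.≤-trans (ℕₚ.≤-reflexive (sym (ℕₚ.*-identityʳ p))) (ℕₚ.n≤1+n _)
    split (suc y) = s≤s z≤n

  -- The leading entry 1 is fixed and not summed over; this saved factor p is the whole gain from
  -- singularity. A zero in front of it contributes its weight p, so the two cases balance and
  -- double.
  ∑-normalised : ∀ p n → p ℕ.* ∑ (normalised p n) (productBy (zeroWeight p)) ℕ.≤ (2 ℕ.* p) ℕ.^ n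
  ∑-normalised p zero = ℕₚ.≤-trans (ℕₚ.≤-reflexive (ℕₚ.*-zeroʳ p)) z≤n
  ∑-normalised p (suc n) = begin
    p ℕ.* ∑ (normalised p (suc n)) w ≡⟨ cong (p ℕ.*_) (trans (∑-++ (map (1 ∷_) (tuples n (upTo p))) (map (0 ∷_) (normalised p n)) w)
        (cong₂ ℕ._+_ (trans (∑-map (tuples n (upTo p)) (1 ∷_) w) (trans (∑-cong (tuples n (upTo p)) (λ ys → ℕₚ.*-identityˡ (w ys))) (∑-tuples n (upTo p) (zeroWeight p))))
          (trans (∑-map (normalised p n) (0 ∷_) w) (∑-* (normalised p n) p w)))) ⟩
    p ℕ.* (∑ (upTo p) (zeroWeight p) ℕ.^ n ℕ.+ p ℕ.* ∑ (normalised p n) w) ≤⟨ ℕₚ.*-monoʳ-≤ p (ℕₚ.+-mono-≤ (ℕₚ.^-monoˡ-≤ n (∑-zeroWeight p)) (∑-normalised p n)) ⟩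
    p ℕ.* ((2 ℕ.* p) ℕ.^ n ℕ.+ (2 ℕ.* p) ℕ.^ n) ≡⟨ r p ((2 ℕ.* p) ℕ.^ n) ⟩
    2 ℕ.* p ℕ.* (2 ℕ.* p) ℕ.^ n ∎
    where
    open ℕₚ.≤-Reasoning
    w = productBy (zeroWeight p)
    r : ∀ p x → p ℕ.* (x ℕ.+ x) ≡ 2 ℕ.* p ℕ.* x
    r = ℕSolver.solve-∀

  ∈-normalised⁻ : ∀ {p} → 1 ℕ.< p → ∀ n {v} → v ∈ normalised p n → length v ≡ n × All (ℕ._< p) v
  ∈-normalised⁻ {p} 1<p (suc n) v∈ with ∈-++⁻ (map (1 ∷_) (tuples n (upTo p))) v∈
  ... | inj₁ h with ∈-map⁻ (1 ∷_) h
  ...   | ys , ys∈ , refl with ∈-tuples⁻ n ys∈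
  ...     | len , all = cong suc len , 1<p ∷ All.map ∈-upTo⁻ all
  ∈-normalised⁻ {p} 1<p (suc n) v∈ | inj₂ h with ∈-map⁻ (0 ∷_) h
  ... | ys , ys∈ , refl with ∈-normalised⁻ 1<p n ys∈
  ...   | len , all = cong suc len , ℕₚ.<-trans (s≤s z≤n) 1<p ∷ all

  -- Base q digits identify the vertex numbers below q ^ d with the vectors in [q]^d.
  digit : (q : ℕ) .{{_ : NonZero q}} → ℕ → ℕ → ℕ
  digit q x zero    = x ℕ.% q
  digit q x (suc β) = digit q (x ℕ./ q) β

  digit-< : ∀ q .{{_ : NonZero q}} x β → digit q x β ℕ.< q
  digit-< q x zero    = m%n<n x q
  digit-< q x (suc β) = digit-< q (x ℕ./ q) β

  -- The expected number of families of singular trees.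

  module BadTrees {p : ℕ} (pp : Prime p) (q : ℕ) {{q≢0 : NonZero q}} (q≤p : q ℕ.≤ p) (1<p : 1 ℕ.< p)
    (dim : Bool → ℕ) (b : Bool) (s k' c a₀ : ℕ) {{c≢0 : NonZero c}} {{a₀≢0 : NonZero a₀}} (c≤p : c ℕ.≤ p)
    (c≤dim : ∀ b' → c ℕ.≤ dim b') (split : dim b ≡ s ℕ.* a₀)
    (fits : Tree.Λ dim b s k' c a₀ ℕ.≤ suc (Tree.last dim b s k' c a₀) ℕ.* c)
    (R B T : ℕ) (B≤p : B ℕ.≤ p) (room : 2 ℕ.* (T ℕ.* Tree.n dim b s k' c a₀) ℕ.≤ R) where

    open Sampling pp (allVars dim) R B B≤p
    open Tree dim b s k' c a₀
    open Layout c≤dim split fits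

    rootCoordinate : List ℕ → ℕ → ℕ → ℕ
    rootCoordinate ρ i β = digit q (get ρ i) β

    -- Roots and equation number are constants of the system, so the direction is zero there. The
    -- row counts as live when the entry of v at its matched unknown is nonzero.
    treeRow : List ℕ → List ℕ × List ℕ → ℕ → Row
    treeRow ρ (x , v) ξ = record
      { pt   = env (rootCoordinate ρ) (get x) id ξ
      ; dir  = env (λ _ _ → 0) (get v) (λ _ → 0) ξ
      ; live = not (get v ξ ℕ.≡ᵇ 0)
      }

    treeRows : List ℕ → List ℕ × List ℕ → List Row
    treeRows ρ t = map (treeRow ρ t) (upTo n)

    configRows : List ℕ → List (List ℕ × List ℕ) → List Row
    configRows ρ ts = concatMap (treeRows ρ) ts

    trees : List (List ℕ × List ℕ)
    trees = concatMap (λ x → map (x ,_) (normalised p n)) (tuples n (upTo q))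

    roots : List (List ℕ)
    roots = tuples s (upTo (q ℕ.^ dim b))

    -- Separation belongs to the event, so families with coinciding evaluation points, for which
    -- independence fails, contribute nothing.
    Realised : List Row → Poly (Var dim) → Set
    Realised rs F = AllPairs Separated rs × Sat rs F

    separated? : ∀ r r' → Dec (Separated r r')
    separated? r r' = Any.any? (λ ι → ¬? ((+ p) ∣? (+ Row.pt r ι - + Row.pt r' ι))) (allVars dim)

    realised? : ∀ rs F → Dec (Realised rs F)
    realised? rs F = AllPairs.allPairs? separated? rs ×-dec sat? rs F

    -- The number of families of T disjoint singular trees on common roots, with a kernel vector for each.
    bad : Poly (Var dim) → ℕ
    bad F = ∑ roots (λ ρ → ∑ (tuples T trees) (λ ts → ind (realised? (configRows ρ ts) F)))

    ∈-trees⁻ : ∀ {x v} → (x , v) ∈ trees → x ∈ tuples n (upTo q) × v ∈ normalised p n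
    ∈-trees⁻ h with find (∈-concatMap⁻ (λ x → map (x ,_) (normalised p n)) {xs = tuples n (upTo q)} h)
    ... | x' , x'∈ , h' with ∈-map⁻ (x' ,_) h'
    ...   | v' , v'∈ , refl = x'∈ , v'∈

    ∈-trees⁺ : ∀ {x v} → x ∈ tuples n (upTo q) → v ∈ normalised p n → (x , v) ∈ trees
    ∈-trees⁺ {x} x∈ v∈ = ∈-concatMap⁺ (λ x → map (x ,_) (normalised p n)) (Any.map (λ { refl → ∈-map⁺ (x ,_) v∈ }) x∈)

    env-all : ∀ {A : Set} (P : A → Set) ρ z κ ξ → (∀ i β → P (ρ i β)) → (∀ ξ → P (z ξ)) → (∀ r → r ℕ.< c → P (κ r)) → ∀ ι → P (env ρ z κ ξ ι)
    env-all P ρ z κ ξ hρ hz hκ (co b' β) = vertex-all (pick b' ((ξ ℕ.% Λ) ℕ./ c))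
      where
      vertex-all : ∀ j → P (vertex ρ z (ξ ℕ./ Λ) j (toℕ β))
      vertex-all zero    = hρ _ _
      vertex-all (suc j) = hz _
    env-all P ρ z κ ξ hρ hz hκ row = hκ _ (m%n<n (ξ ℕ.% Λ) c)

    treeRow-reduced : ∀ ρ {t} → t ∈ trees → ∀ ξ → Reduced (treeRow ρ t ξ)
    treeRow-reduced ρ {x , v} t∈ ξ = env-all (ℕ._< p) (rootCoordinate ρ) (get x) id ξ
      (λ i β → ℕₚ.<-≤-trans (digit-< q (get ρ i) β) q≤p)
      (λ ξ → ℕₚ.<-≤-trans (get-< (ℕ.>-nonZero⁻¹ q) (All.map ∈-upTo⁻ (proj₂ (∈-tuples⁻ n (proj₁ (∈-trees⁻ t∈))))) ξ) q≤p)
      (λ r r<c → ℕₚ.<-≤-trans r<c c≤p)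

    -- The matching at work: equation ξ sees unknown ξ, so a nonzero entry there is a nonzero
    -- component of the direction.
    treeRow-moving : ∀ ρ {t} → t ∈ trees → ∀ ξ → ξ ℕ.< n → Moving (treeRow ρ t ξ)
    treeRow-moving ρ {x , v} t∈ ξ ξ<n alive = lose (∈-allVars ι) (subst (λ a → ¬ + p ∣ + a) (sym (proj₂ inc (λ _ _ → 0) (get v) (λ _ → 0))) (∤-small pp (get v ξ) (positive (get v ξ) alive) v<p))
      where
      inc = incident ξ ξ<n
      ι = proj₁ inc
      v<p : get v ξ ℕ.< p
      v<p = get-< (ℕₚ.<-trans (s≤s z≤n) 1<p) (proj₂ (∈-normalised⁻ 1<p n (proj₂ (∈-trees⁻ t∈)))) ξ
      positive : ∀ a → IsTrue (not (a ℕ.≡ᵇ 0)) → 0 ℕ.< a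
      positive (suc a) _ = s≤s z≤n

    weights-++ : ∀ rs rs' → weights (rs ++ rs') ≡ weights rs ℕ.* weights rs'
    weights-++ []       rs' = sym (ℕₚ.*-identityˡ _)
    weights-++ (r ∷ rs) rs' = trans (cong (weight r ℕ.*_) (weights-++ rs rs')) (sym (ℕₚ.*-assoc (weight r) _ _))

    treeWeight : List ℕ × List ℕ → ℕ
    treeWeight (x , v) = productBy (zeroWeight p) v

    treeRows-weight : ∀ ρ {t} → t ∈ trees → weights (treeRows ρ t) ≡ treeWeight t
    treeRows-weight ρ {x , v} t∈ = trans (cong weights (Listₚ.map-upTo (treeRow ρ (x , v)) n)) (trans (cong (λ k → weights (applyUpTo (treeRow ρ (x , v)) k)) (sym len)) (go v (treeRow ρ (x , v)) (λ ξ → w (get v ξ))))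
      where
      len : length v ≡ n
      len = proj₁ (∈-normalised⁻ 1<p n (proj₂ (∈-trees⁻ t∈)))
      w : ∀ a → (if not (a ℕ.≡ᵇ 0) then 1 else p) ≡ zeroWeight p a
      w zero    = refl
      w (suc a) = refl
      go : ∀ v (f : ℕ → Row) → (∀ ξ → weight (f ξ) ≡ zeroWeight p (get v ξ)) → weights (applyUpTo f (length v)) ≡ productBy (zeroWeight p) v
      go []       f h = refl
      go (a ∷ v) f h = cong₂ ℕ._*_ (h 0) (go v (f ∘ suc) (h ∘ suc))

    configRows-weight : ∀ ρ {ts} → All (_∈ trees) ts → weights (configRows ρ ts) ≡ productBy treeWeight ts
    configRows-weight ρ []         = refl
    configRows-weight ρ {t ∷ ts} (t∈ ∷ h) = trans (weights-++ (treeRows ρ t) (configRows ρ ts)) (cong₂ ℕ._*_ (treeRows-weight ρ t∈) (configRows-weight ρ h))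

    length-configRows : ∀ ρ ts → length (configRows ρ ts) ≡ length ts ℕ.* n
    length-configRows ρ []       = refl
    length-configRows ρ (t ∷ ts) = trans (Listₚ.length-++ (treeRows ρ t)) (cong₂ ℕ._+_ (trans (Listₚ.length-map _ (upTo n)) (Listₚ.length-upTo n)) (length-configRows ρ ts))

    configRows-all : ∀ {P : Row → Set} ρ {ts} → All (_∈ trees) ts → (∀ {t} → t ∈ trees → ∀ ξ → ξ ℕ.< n → P (treeRow ρ t ξ)) → All P (configRows ρ ts)
    configRows-all ρ []       h = []
    configRows-all ρ (t∈ ∷ ts∈) h = Allₗ.++⁺ (Allₗ.map⁺ (All.tabulate (λ ξ∈ → h t∈ _ (∈-upTo⁻ ξ∈)))) (configRows-all ρ ts∈ h)

    private
      N = T ℕ.* n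
      W = ∑ trees treeWeight

    realised-count : ∀ ρ {ts} → ts ∈ tuples T trees →
      p ℕ.^ (2 ℕ.* N) ℕ.* ∑ Ω (λ F → ind (realised? (configRows ρ ts) F)) ℕ.≤ B ℕ.^ N ℕ.* length Ω ℕ.* productBy treeWeight ts
    realised-count ρ {ts} ts∈ = by-separation (AllPairs.allPairs? separated? (configRows ρ ts))
      where
      len : length (configRows ρ ts) ≡ N
      len = trans (length-configRows ρ ts) (cong (ℕ._* n) (proj₁ (∈-tuples⁻ T ts∈)))
      all = proj₂ (∈-tuples⁻ T ts∈)
      by-separation : Dec (AllPairs Separated (configRows ρ ts)) →
        p ℕ.^ (2 ℕ.* N) ℕ.* ∑ Ω (λ F → ind (realised? (configRows ρ ts) F)) ℕ.≤ B ℕ.^ N ℕ.* length Ω ℕ.* productBy treeWeight ts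
      by-separation (no ¬sep) = ℕₚ.≤-trans (ℕₚ.≤-reflexive (trans (cong (p ℕ.^ (2 ℕ.* N) ℕ.*_) (trans (∑-cong Ω (λ F → ind-no (realised? (configRows ρ ts) F) (λ r → ¬sep (proj₁ r)))) (trans (∑-const Ω 0) (ℕₚ.*-zeroʳ (length Ω))))) (ℕₚ.*-zeroʳ (p ℕ.^ (2 ℕ.* N))))) z≤n
      by-separation (yes sep) = begin
        p ℕ.^ (2 ℕ.* N) ℕ.* ∑ Ω (λ F → ind (realised? (configRows ρ ts) F)) ≤⟨ ℕₚ.*-monoʳ-≤ (p ℕ.^ (2 ℕ.* N)) (∑-mono Ω (λ F → ind-mono (realised? (configRows ρ ts) F) (sat? (configRows ρ ts) F) proj₂)) ⟩
        p ℕ.^ (2 ℕ.* N) ℕ.* ∑ Ω (ind ∘ sat? (configRows ρ ts)) ≤⟨ subst (λ m → p ℕ.^ (2 ℕ.* m) ℕ.* ∑ Ω (ind ∘ sat? (configRows ρ ts)) ℕ.≤ B ℕ.^ m ℕ.* weights (configRows ρ ts) ℕ.* length Ω) len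
            (rows-count (configRows ρ ts) sep (configRows-all ρ all (λ t∈ ξ _ → treeRow-reduced ρ t∈ ξ)) (configRows-all ρ all (λ t∈ ξ ξ<n → treeRow-moving ρ t∈ ξ ξ<n)) (subst (λ m → 2 ℕ.* m ℕ.≤ R) (sym len) room)) ⟩
        B ℕ.^ N ℕ.* weights (configRows ρ ts) ℕ.* length Ω ≡⟨ cong (λ w → B ℕ.^ N ℕ.* w ℕ.* length Ω) (configRows-weight ρ all) ⟩
        B ℕ.^ N ℕ.* productBy treeWeight ts ℕ.* length Ω ≡⟨ r (B ℕ.^ N) (productBy treeWeight ts) (length Ω) ⟩
        B ℕ.^ N ℕ.* length Ω ℕ.* productBy treeWeight ts ∎
        where
        open ℕₚ.≤-Reasoning
        r : ∀ a b c → a ℕ.* b ℕ.* c ≡ a ℕ.* c ℕ.* b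
        r = ℕSolver.solve-∀

    bad-total : p ℕ.^ (2 ℕ.* N) ℕ.* ∑ Ω bad ℕ.≤ (q ℕ.^ dim b) ℕ.^ s ℕ.* (B ℕ.^ N ℕ.* length Ω ℕ.* W ℕ.^ T)
    bad-total = begin
      P ℕ.* ∑ Ω bad
        ≡⟨ cong (P ℕ.*_) (trans (∑-swap Ω roots _) (∑-cong roots (λ ρ → ∑-swap Ω (tuples T trees) _))) ⟩
      P ℕ.* ∑ roots (λ ρ → ∑ (tuples T trees) (λ ts → ∑ Ω (λ F → ind (realised? (configRows ρ ts) F))))
        ≡⟨ trans (sym (∑-* roots P _)) (∑-cong roots (λ ρ → sym (∑-* (tuples T trees) P _))) ⟩
      ∑ roots (λ ρ → ∑ (tuples T trees) (λ ts → P ℕ.* ∑ Ω (λ F → ind (realised? (configRows ρ ts) F))))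
        ≤⟨ ∑-mono roots (λ ρ → ∑-monoᵐ (tuples T trees) (realised-count ρ)) ⟩
      ∑ roots (λ ρ → ∑ (tuples T trees) (λ ts → B ℕ.^ N ℕ.* length Ω ℕ.* productBy treeWeight ts))
        ≡⟨ ∑-cong roots (λ ρ → trans (∑-* (tuples T trees) (B ℕ.^ N ℕ.* length Ω) (productBy treeWeight)) (cong (B ℕ.^ N ℕ.* length Ω ℕ.*_) (∑-tuples T trees treeWeight))) ⟩
      ∑ roots (λ ρ → B ℕ.^ N ℕ.* length Ω ℕ.* W ℕ.^ T)
        ≡⟨ trans (∑-const roots _) (cong (ℕ._* (B ℕ.^ N ℕ.* length Ω ℕ.* W ℕ.^ T)) (trans (length-tuples s (upTo (q ℕ.^ dim b))) (cong (ℕ._^ s) (Listₚ.length-upTo (q ℕ.^ dim b))))) ⟩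
      (q ℕ.^ dim b) ℕ.^ s ℕ.* (B ℕ.^ N ℕ.* length Ω ℕ.* W ℕ.^ T) ∎
      where
      open ℕₚ.≤-Reasoning
      P = p ℕ.^ (2 ℕ.* N)

    -- There are at most p ^ n points, and the weighted directions number at most (2 p) ^ n / p.
    -- Against the 2 n conditions of a tree this leaves O(1 / p) singular trees on given roots.
    trees-weight : p ℕ.* W ℕ.≤ 2 ℕ.^ n ℕ.* p ℕ.^ (2 ℕ.* n)
    trees-weight = begin
      p ℕ.* W ≡⟨ cong (p ℕ.*_) (trans (∑-concatMap (tuples n (upTo q)) (λ x → map (x ,_) (normalised p n)) treeWeight)
          (trans (∑-cong (tuples n (upTo q)) (λ x → ∑-map (normalised p n) (x ,_) treeWeight)) (trans (∑-const (tuples n (upTo q)) V) (cong (ℕ._* V) (trans (length-tuples n (upTo q)) (cong (ℕ._^ n) (Listₚ.length-upTo q))))))) ⟩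
      p ℕ.* (q ℕ.^ n ℕ.* V) ≡⟨ e₁ p (q ℕ.^ n) V ⟩
      q ℕ.^ n ℕ.* (p ℕ.* V) ≤⟨ ℕₚ.*-mono-≤ (ℕₚ.^-monoˡ-≤ n q≤p) (∑-normalised p n) ⟩
      p ℕ.^ n ℕ.* (2 ℕ.* p) ℕ.^ n ≡⟨ cong (p ℕ.^ n ℕ.*_) (^-*-distrib 2 p n) ⟩
      p ℕ.^ n ℕ.* (2 ℕ.^ n ℕ.* p ℕ.^ n) ≡⟨ e₂ (p ℕ.^ n) (2 ℕ.^ n) ⟩
      2 ℕ.^ n ℕ.* (p ℕ.^ n ℕ.* p ℕ.^ n) ≡⟨ cong (2 ℕ.^ n ℕ.*_) (trans (sym (ℕₚ.^-distribˡ-+-* p n n)) (cong (λ m → p ℕ.^ (n ℕ.+ m)) (sym (ℕₚ.+-identityʳ n)))) ⟩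
      2 ℕ.^ n ℕ.* p ℕ.^ (2 ℕ.* n) ∎
      where
      open ℕₚ.≤-Reasoning
      V = ∑ (normalised p n) (productBy (zeroWeight p))
      e₁ : ∀ a b c → a ℕ.* (b ℕ.* c) ≡ b ℕ.* (a ℕ.* c)
      e₁ = ℕSolver.solve-∀
      e₂ : ∀ a b → a ℕ.* (b ℕ.* a) ≡ b ℕ.* (a ℕ.* a)
      e₂ = ℕSolver.solve-∀

    -- A union over the roots, with a factor (2 B) ^ n / p for each of the T trees.
    bad-bound : p ℕ.^ T ℕ.* ∑ Ω bad ℕ.≤ (q ℕ.^ dim b) ℕ.^ s ℕ.* (2 ℕ.* B) ℕ.^ N ℕ.* length Ω
    bad-bound = ℕₚ.*-cancelˡ-≤ P {{P≢0}} (begin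
      P ℕ.* (p ℕ.^ T ℕ.* X)                     ≡⟨ e₁ P (p ℕ.^ T) X ⟩
      p ℕ.^ T ℕ.* (P ℕ.* X)                     ≤⟨ ℕₚ.*-monoʳ-≤ (p ℕ.^ T) bad-total ⟩
      p ℕ.^ T ℕ.* (Q ℕ.* (B ℕ.^ N ℕ.* M ℕ.* W ℕ.^ T)) ≡⟨ e₂ (p ℕ.^ T) Q (B ℕ.^ N) M (W ℕ.^ T) ⟩
      Q ℕ.* B ℕ.^ N ℕ.* M ℕ.* (p ℕ.^ T ℕ.* W ℕ.^ T)   ≡⟨ cong (Q ℕ.* B ℕ.^ N ℕ.* M ℕ.*_) (sym (^-*-distrib p W T)) ⟩
      Q ℕ.* B ℕ.^ N ℕ.* M ℕ.* (p ℕ.* W) ℕ.^ T         ≤⟨ ℕₚ.*-monoʳ-≤ (Q ℕ.* B ℕ.^ N ℕ.* M) (ℕₚ.^-monoˡ-≤ T trees-weight) ⟩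
      Q ℕ.* B ℕ.^ N ℕ.* M ℕ.* (2 ℕ.^ n ℕ.* p ℕ.^ (2 ℕ.* n)) ℕ.^ T ≡⟨ cong (Q ℕ.* B ℕ.^ N ℕ.* M ℕ.*_) (trans (^-*-distrib (2 ℕ.^ n) (p ℕ.^ (2 ℕ.* n)) T) (cong₂ ℕ._*_ (pow 2 n T refl) (pow p (2 ℕ.* n) T (e₄ n T)))) ⟩
      Q ℕ.* B ℕ.^ N ℕ.* M ℕ.* (2 ℕ.^ N ℕ.* P)         ≡⟨ e₃ Q (B ℕ.^ N) M (2 ℕ.^ N) P ⟩
      P ℕ.* (Q ℕ.* (2 ℕ.^ N ℕ.* B ℕ.^ N) ℕ.* M)       ≡⟨ cong (λ z → P ℕ.* (Q ℕ.* z ℕ.* M)) (sym (^-*-distrib 2 B N)) ⟩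
      P ℕ.* (Q ℕ.* (2 ℕ.* B) ℕ.^ N ℕ.* M) ∎)
      where
      open ℕₚ.≤-Reasoning
      P = p ℕ.^ (2 ℕ.* N)
      Q = (q ℕ.^ dim b) ℕ.^ s
      M = length Ω
      X = ∑ Ω bad
      P≢0 : NonZero P
      P≢0 = ℕₚ.m^n≢0 p (2 ℕ.* N) {{prime⇒nonZero pp}}
      pow : ∀ a e T {m} → T ℕ.* e ≡ m → (a ℕ.^ e) ℕ.^ T ≡ a ℕ.^ m
      pow a e T eq = trans (ℕₚ.^-*-assoc a e T) (cong (a ℕ.^_) (trans (ℕₚ.*-comm e T) eq))
      e₁ : ∀ a b c → a ℕ.* (b ℕ.* c) ≡ b ℕ.* (a ℕ.* c)
      e₁ = ℕSolver.solve-∀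
      e₂ : ∀ t q b m w → t ℕ.* (q ℕ.* (b ℕ.* m ℕ.* w)) ≡ q ℕ.* b ℕ.* m ℕ.* (t ℕ.* w)
      e₂ = ℕSolver.solve-∀
      e₃ : ∀ q b m t p → q ℕ.* b ℕ.* m ℕ.* (t ℕ.* p) ≡ p ℕ.* (q ℕ.* (t ℕ.* b) ℕ.* m)
      e₃ = ℕSolver.solve-∀
      e₄ : ∀ n T → T ℕ.* (2 ℕ.* n) ≡ 2 ℕ.* (T ℕ.* n)
      e₄ = ℕSolver.solve-∀

  digit-injective : ∀ q .{{_ : NonZero q}} d x y → x ℕ.< q ℕ.^ d → y ℕ.< q ℕ.^ d → (∀ β → β ℕ.< d → digit q x β ≡ digit q y β) → x ≡ y
  digit-injective q zero    x y x< y< h = trans (ℕₚ.n<1⇒n≡0 x<) (sym (ℕₚ.n<1⇒n≡0 y<))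
  digit-injective q (suc d) x y x< y< h = trans (m≡m%n+[m/n]*n x q) (trans (cong₂ (λ r t → r ℕ.+ t ℕ.* q) (h 0 (s≤s z≤n))
    (digit-injective q d (x ℕ./ q) (y ℕ./ q) (shrink x<) (shrink y<) (λ β β<d → h (suc β) (s≤s β<d)))) (sym (m≡m%n+[m/n]*n y q)))
    where
    shrink : ∀ {x} → x ℕ.< q ℕ.^ suc d → x ℕ./ q ℕ.< q ℕ.^ d
    shrink {x} x< = /-%-bound {q ℕ.^ d} (subst (x ℕ.<_) (ℕₚ.*-comm q (q ℕ.^ d)) x<)

  get-beyond : ∀ xs i → length xs ℕ.≤ i → get xs i ≡ 0
  get-beyond []       i       _       = refl
  get-beyond (x ∷ xs) (suc i) (s≤s h) = get-beyond xs i h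

  extend : ∀ {A : Set} {n} → A → (Fin n → A) → ℕ → A
  extend {n = n} d f a with a ℕ.<? n
  ... | yes a<n = f (fromℕ< a<n)
  ... | no  _   = d

  extend-natural : ∀ {A B : Set} (g : A → B) {n} d (f : Fin n → A) a → g (extend d f a) ≡ extend (g d) (g ∘ f) a
  extend-natural g {n} d f a with a ℕ.<? n
  ... | yes _ = refl
  ... | no  _ = refl

  extend-get : ∀ {A : Set} {n} (g : ℕ → A) a → (n ℕ.≤ a → g a ≡ g n) → extend {n = n} (g n) (g ∘ toℕ) a ≡ g a
  extend-get {n = n} g a h with a ℕ.<? n
  ... | yes a<n = cong g (Finₚ.toℕ-fromℕ< a<n)
  ... | no  a≮n = sym (h (ℕₚ.≮⇒≥ a≮n))

  split-list : ∀ {A : Set} {P : A → Set} (P? : ∀ x → Dec (P x)) K T xs → AllPairs _≢_ xs → K ℕ.+ T ℕ.≤ length xs →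
    (∃[ ys ] length ys ≡ K × AllPairs _≢_ ys × All (_∈ xs) ys × All (λ x → ¬ P x) ys) ⊎
    (∃[ ys ] length ys ≡ T × AllPairs _≢_ ys × All (_∈ xs) ys × All P ys)
  split-list P? zero    T       xs       un h = inj₁ ([] , refl , [] , [] , [])
  split-list P? (suc K) zero    xs       un h = inj₂ ([] , refl , [] , [] , [])
  split-list P? (suc K) (suc T) (x ∷ xs) (x∉ ∷ un) (s≤s h) with P? x
  ... | yes px with split-list P? (suc K) T xs un (subst (ℕ._≤ length xs) (ℕₚ.+-suc K T) h)
  ...   | inj₁ (ys , len , u , sub , all) = inj₁ (ys , len , u , All.map there sub , all)
  ...   | inj₂ (ys , len , u , sub , all) = inj₂ (x ∷ ys , cong suc len , All.map (All.lookup x∉) sub ∷ u , here refl ∷ All.map there sub , px ∷ all)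
  split-list P? (suc K) (suc T) (x ∷ xs) (x∉ ∷ un) (s≤s h) | no ¬px with split-list P? K (suc T) xs un h
  ...   | inj₁ (ys , len , u , sub , all) = inj₁ (x ∷ ys , cong suc len , All.map (All.lookup x∉) sub ∷ u , here refl ∷ All.map there sub , ¬px ∷ all)
  ...   | inj₂ (ys , len , u , sub , all) = inj₂ (ys , len , u , All.map there sub , all)

  lookup-injective : ∀ {A : Set} {xs : List A} → AllPairs _≢_ xs → ∀ i l → lookup xs i ≡ lookup xs l → i ≡ l
  lookup-injective (x∉ ∷ un) zero    zero    e = refl
  lookup-injective {xs = x ∷ xs} (x∉ ∷ un) zero    (suc l) e = contradiction e (All.lookup x∉ (∈-lookup {xs = xs} l))
  lookup-injective {xs = x ∷ xs} (x∉ ∷ un) (suc i) zero    e = contradiction (sym e) (All.lookup x∉ (∈-lookup {xs = xs} i))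
  lookup-injective (x∉ ∷ un) (suc i) (suc l) e = cong suc (lookup-injective un i l e)

  module _ {p : ℕ} (pp : Prime p) where

    private instance
      p≢0 : NonZero p
      p≢0 = prime⇒nonZero pp

    inverse-mod : ∀ {β} → ¬ + p ∣ β → ∃[ y ] Mod (+ p) (y * β) 1ℤ
    inverse-mod {β} p∤β = + toℕ (proj₁ hit) , residue-eq pp {+ toℕ (proj₁ hit) * β} {1ℤ} (proj₂ hit)
      where
      r : ∀ y z β → y * β - z * β ≡ (y - z) * β
      r = solve-∀
      φ : Fin p → Fin p
      φ y = residue pp (+ toℕ y * β)
      injective : ∀ {y z : Fin p} → φ y ≡ φ z → y ≡ z
      injective {y} {z} e = [ (λ d → Mod⇒≡ pp y z (modulo d)) , (λ d → contradiction d p∤β) ]′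
        (primeLike-prime pp (+ toℕ y - + toℕ z) β (subst (+ p ∣_) (r (+ toℕ y) (+ toℕ z) β) (Mod.∣-diff (residue-eq pp {+ toℕ y * β} {+ toℕ z * β} e))))
      hit : ∃[ y ] φ y ≡ residue pp 1ℤ
      hit = injective⇒surjective φ injective (residue pp 1ℤ)

    Normalisation : ∀ n → (Fin n → ℤ) → Set
    Normalisation n w = ∃[ a ] ∃[ v ] v ∈ normalised p n × (∀ ξ → Mod (+ p) (a * w ξ) (+ get v (toℕ ξ)))

    normalise-unit : ∀ n (w : Fin (suc n) → ℤ) → ∃[ a ] Mod (+ p) (a * w zero) 1ℤ → Normalisation (suc n) w
    normalise-unit n w (a , ha) = a , 1 ∷ rest , ∈-++⁺ˡ (∈-map⁺ (1 ∷_) rest∈) , entries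
      where
      entry : Fin n → ℕ
      entry ξ = toℕ (residue pp (a * w (suc ξ)))
      rest : List ℕ
      rest = tabulate entry
      rest∈ : rest ∈ tuples n (upTo p)
      rest∈ = subst (λ k → rest ∈ tuples k (upTo p)) (Listₚ.length-tabulate entry) (∈-tuples⁺ (Allₗ.tabulate⁺ (λ ξ → ∈-upTo⁺ (Finₚ.toℕ<n (residue pp (a * w (suc ξ)))))))
      get-tabulate : ∀ {m} (g : Fin m → ℕ) ξ → get (tabulate g) (toℕ ξ) ≡ g ξ
      get-tabulate g zero    = refl
      get-tabulate g (suc ξ) = get-tabulate (g ∘ suc) ξ
      entries : ∀ ξ → Mod (+ p) (a * w ξ) (+ get (1 ∷ rest) (toℕ ξ))
      entries zero    = ha
      entries (suc ξ) = subst (λ g → Mod (+ p) (a * w (suc ξ)) (+ g)) (sym (get-tabulate entry ξ)) (residue-≡ pp (a * w (suc ξ)))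

    normalise-zero : ∀ n (w : Fin (suc n) → ℤ) → + p ∣ w zero → Normalisation n (w ∘ suc) → Normalisation (suc n) w
    normalise-zero n w d (a , v , v∈ , h) = a , 0 ∷ v , ∈-++⁺ʳ (map (1 ∷_) (tuples n (upTo p))) (∈-map⁺ (0 ∷_) v∈) , entries
      where
      entries : ∀ ξ → Mod (+ p) (a * w ξ) (+ get (0 ∷ v) (toℕ ξ))
      entries zero    = modulo (subst (+ p ∣_) (sym (ℤₚ.+-identityʳ (a * w zero))) (∣n⇒∣m*n a d))
      entries (suc ξ) = h ξ

    normalise : ∀ n (w : Fin n → ℤ) → (∀ ξ → + p ∣ w ξ) ⊎ Normalisation n w
    normalise zero    w = inj₁ λ ()
    normalise (suc n) w = decide ((+ p) ∣? w zero)
      where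
      decide : Dec (+ p ∣ w zero) → (∀ ξ → + p ∣ w ξ) ⊎ Normalisation (suc n) w
      decide (no ¬d) = inj₂ (normalise-unit n w (inverse-mod ¬d))
      decide (yes d) = [ (λ h → inj₁ (λ { zero → d ; (suc ξ) → h ξ })) , inj₂ ∘ normalise-zero n w d ]′ (normalise n (w ∘ suc))

    -- In the product rule every term but one retains the vanishing factor; the remaining term is
    -- the derivative of that factor times units.
    ∂-prodP : ∀ {I : Set} {n} (f : Fin n → Poly I) x v i → + p ∣ ⟦ f i ⟧ x → (∀ l → l ≢ i → ¬ + p ∣ ⟦ f l ⟧ x) →
      + p ∣ ∂ (prodP f) x v → + p ∣ ∂ (f i) x v
    ∂-prodP f x v zero h units d = [ id , (λ r → contradiction r (prodP-∤ pp (f ∘ suc) x (λ l → units (suc l) (λ ())))) ]′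
      (primeLike-prime pp (∂ (f zero) x v) (⟦ prodP (f ∘ suc) ⟧ x)
        (∣m+n∣n⇒∣m {m = ∂ (f zero) x v * ⟦ prodP (f ∘ suc) ⟧ x} {n = ⟦ f zero ⟧ x * ∂ (prodP (f ∘ suc)) x v} d (∣m⇒∣m*n (∂ (prodP (f ∘ suc)) x v) h)))
    ∂-prodP f x v (suc i) h units d =
      [ (λ r → contradiction r (units zero (λ ()))) , ∂-prodP (f ∘ suc) x v i h (λ l l≢i → units (suc l) (l≢i ∘ Finₚ.suc-injective)) ]′
      (primeLike-prime pp (⟦ f zero ⟧ x) (∂ (prodP (f ∘ suc)) x v)
        (∣m+n∣m⇒∣n {m = ∂ (f zero) x v * ⟦ prodP (f ∘ suc) ⟧ x} {n = ⟦ f zero ⟧ x * ∂ (prodP (f ∘ suc)) x v} d (∣n⇒∣m*n (∂ (f zero) x v) (prodP-∣ pp (f ∘ suc) x i h))))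

    -- Divisibility by p of this product says that the residue of f is below B. For B ≤ p the shifts
    -- are incongruent, so such a zero is a zero of one factor only.
    window : {I : Set} → ℕ → Poly I → Poly I
    window B f = prodP {n = B} (λ w → f ⊕ con (- + toℕ w))

    deg-window : ∀ {I : Set} B {R} (f : Poly I) → deg f ℕ.≤ R → deg (window B f) ℕ.≤ B ℕ.* R
    deg-window B f h = deg-prodP {n = B} (λ w → f ⊕ con (- + toℕ w)) (λ w → ℕₚ.⊔-lub h z≤n)

    module _ {I : Set} {B : ℕ} (B≤p : B ℕ.≤ p) (f : Poly I) (x : I → ℤ) (small : (⟦ f ⟧ x %ℕ p) ℕ.< B) where

      private
        w₀ : Fin B
        w₀ = fromℕ< small

        root : + p ∣ ⟦ f ⟧ x + - + toℕ w₀
        root = divides (⟦ f ⟧ x /ℕ p) (trans (cong₂ (λ a w → a - + w) (a≡a%ℕn+[a/ℕn]*n (⟦ f ⟧ x) p) (Finₚ.toℕ-fromℕ< small)) (r (+ (⟦ f ⟧ x %ℕ p)) ((⟦ f ⟧ x /ℕ p) * + p)))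
          where
          r : ∀ a b → a + b - a ≡ b
          r = solve-∀

      window-∣ : + p ∣ ⟦ window B f ⟧ x
      window-∣ = prodP-∣ pp (λ w → f ⊕ con (- + toℕ w)) x w₀ root

      ∂-window : ∀ v → + p ∣ ∂ (window B f) x v → + p ∣ ∂ f x v
      ∂-window v d = subst (+ p ∣_) (ℤₚ.+-identityʳ (∂ f x v)) (∂-prodP (λ w → f ⊕ con (- + toℕ w)) x v w₀ root units d)
        where
        r : ∀ f a b → f + - a - (f + - b) ≡ b - a
        r = solve-∀
        units : ∀ l → l ≢ w₀ → ¬ + p ∣ ⟦ f ⟧ x + - + toℕ l
        units l l≢ d' = l≢ (Finₚ.toℕ-injective (trans (sym (Finₚ.toℕ-inject≤ l B≤p)) (trans (cong toℕ eq) (Finₚ.toℕ-inject≤ w₀ B≤p))))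
          where
          eq : Data.Fin.inject≤ l B≤p ≡ Data.Fin.inject≤ w₀ B≤p
          eq = Mod⇒≡ pp _ _ (subst₂ (λ a b → Mod (+ p) (+ a) (+ b)) (sym (Finₚ.toℕ-inject≤ l B≤p)) (sym (Finₚ.toℕ-inject≤ w₀ B≤p))
                 (modulo (subst (+ p ∣_) (r (⟦ f ⟧ x) (+ toℕ w₀) (+ toℕ l)) (∣m∣n⇒∣m-n root d'))))

  -- No large family of internally disjoint trees on common roots.

  module FreeTrees {p : ℕ} (pp : Prime p) (q : ℕ) {{q≢0 : NonZero q}} (q≤p : q ℕ.≤ p) (1<p : 1 ℕ.< p)
    (dim : Bool → ℕ) (b : Bool) (s k' c a₀ : ℕ) {{c≢0 : NonZero c}} {{a₀≢0 : NonZero a₀}} (c≤p : c ℕ.≤ p)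
    (c≤dim : ∀ b' → c ℕ.≤ dim b') (split : dim b ≡ s ℕ.* a₀)
    (fits : Tree.Λ dim b s k' c a₀ ℕ.≤ suc (Tree.last dim b s k' c a₀) ℕ.* c)
    (R B T : ℕ) (B≤p : B ℕ.≤ p) (room : 2 ℕ.* (T ℕ.* Tree.n dim b s k' c a₀) ℕ.≤ R) where

    open Sampling pp (allVars dim) R B B≤p
    open Tree dim b s k' c a₀
    open Layout c≤dim split fits
    open BadTrees pp q q≤p 1<p dim b s k' c a₀ c≤p c≤dim split fits R B T B≤p room

    module _ (1≤s : 1 ℕ.≤ s) {K : ℕ} (K-big : suc (n ℕ.* (B ℕ.* R)) ℕ.^ n ℕ.< K) (K<p : K ℕ.< p)
      (F : Poly (Var dim)) (deg-F : deg F ℕ.≤ R) (no-bad : bad F ≡ 0)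
      {t : ℕ} (K+T≤t : K ℕ.+ T ℕ.≤ t)
      (N : Fin t → ℕ → ℕ → ℕ) (root : ℕ → ℕ)
      (root-< : ∀ i → root i ℕ.< q ℕ.^ dim b)
      (N-root : ∀ τ i → N τ i 0 ≡ root i)
      (N-centre : ∀ τ i i' → N τ i (suc last) ≡ N τ i' (suc last))
      (N-< : ∀ τ i j → j ℕ.≤ suc last → N τ i j ℕ.< q ℕ.^ dim (side j))
      -- Off the root side no vertex is shared at all. On the root side the roots belong to every
      -- tree and the centre to every path, so distinctness is asked only along one path.
      (N-odd : ∀ τ τ' i i' j j' → i ℕ.< s → i' ℕ.< s → j ℕ.≤ suc last → j' ℕ.≤ suc last → side j ≡ not b → side j' ≡ not b →
        N τ i j ≡ N τ' i' j' → τ ≡ τ' × i ≡ i' × j ≡ j')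
      (N-even : ∀ τ i j j' → j ℕ.≤ suc last → j' ℕ.≤ suc last → side j ≡ b → side j' ≡ b → N τ i j ≡ N τ i j' → j ≡ j')
      (point : Fin t → ℕ → ℕ → ℕ → Var dim → ℕ)
      (point-co : ∀ τ i e r b' β → point τ i e r (co b' β) ≡ digit q (N τ i (pick b' e)) (toℕ β))
      (point-row : ∀ τ i e r → point τ i e r row ≡ r)
      (N-edge : ∀ τ i e r → i ℕ.< s → e ℕ.≤ last → r ℕ.< c → Small F (λ ι → + point τ i e r ι)) where

      private
        X : Fin t → ℕ → ℕ → ℕ → ℕ
        X τ i j β = digit q (N τ i j) β

        ρ : List ℕ
        ρ = applyUpTo root s

        x : Fin t → List ℕ
        x τ = applyUpTo (flatten (X τ)) n

        length-x : ∀ τ → length (x τ) ≡ n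
        length-x τ = Listₚ.length-applyUpTo (flatten (X τ)) n

        centre : ∀ τ i i' β → i ℕ.< s → i' ℕ.< s → X τ i (suc last) β ≡ X τ i' (suc last) β
        centre τ i i' β _ _ = cong (λ m → digit q m β) (N-centre τ i i')

        vertex-X : ∀ τ i j β → i ℕ.< s → j ℕ.≤ suc last → β ℕ.< dim (side j) → vertex (rootCoordinate ρ) (get (x τ)) i j β ≡ X τ i j β
        vertex-X τ i zero    β i<s _ _ = cong (λ m → digit q m β) (trans (get-applyUpTo root s i i<s) (sym (N-root τ i)))
        vertex-X τ i (suc j) β i<s (s≤s j≤) β< = trans (get-applyUpTo (flatten (X τ)) n (coordinate i j β) (proj₁ fv)) (proj₂ fv)
          where fv = flatten-vertex (X τ) (centre τ) i j β i<s j≤ β<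

        path edge equation : ℕ → ℕ
        path ξ = ξ ℕ./ Λ
        edge ξ = (ξ ℕ.% Λ) ℕ./ c
        equation ξ = (ξ ℕ.% Λ) ℕ.% c

        path-< : ∀ {ξ} → ξ ℕ.< n → path ξ ℕ.< s
        path-< = /-%-bound {s}

        edge-≤ : ∀ ξ → edge ξ ℕ.≤ last
        edge-≤ ξ = edge-≤last (m%n<n ξ Λ)

        pick-≤last : ∀ b' ξ → pick b' (edge ξ) ℕ.≤ suc last
        pick-≤last b' ξ = ℕₚ.≤-trans (pick-≤ b' (edge ξ)) (s≤s (edge-≤ ξ))

        treePoint : Fin t → ℕ → Var dim → ℕ
        treePoint τ ξ = env (rootCoordinate ρ) (get (x τ)) id ξ

        treePoint-X : ∀ τ ξ b' β → ξ ℕ.< n → treePoint τ ξ (co b' β) ≡ X τ (path ξ) (pick b' (edge ξ)) (toℕ β)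
        treePoint-X τ ξ b' β ξ<n = vertex-X τ (path ξ) (pick b' (edge ξ)) (toℕ β) (path-< ξ<n) (pick-≤last b' ξ) (subst (λ z → toℕ β ℕ.< dim z) (sym (side-pick b' (edge ξ))) (Finₚ.toℕ<n β))

        treePoint-point : ∀ τ ξ → ξ ℕ.< n → treePoint τ ξ ≗ point τ (path ξ) (edge ξ) (equation ξ)
        treePoint-point τ ξ ξ<n (co b' β) = trans (treePoint-X τ ξ b' β ξ<n) (sym (point-co τ (path ξ) (edge ξ) (equation ξ) b' β))
        treePoint-point τ ξ ξ<n row = sym (point-row τ (path ξ) (edge ξ) (equation ξ))

        treePoint-small : ∀ τ ξ → ξ ℕ.< n → Small F (λ ι → + treePoint τ ξ ι)
        treePoint-small τ ξ ξ<n = subst (λ v → (v %ℕ p) {{prime⇒nonZero pp}} ℕ.< B) (⟦⟧-cong F (λ ι → cong +_ (sym (treePoint-point τ ξ ξ<n ι))))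
          (N-edge τ (path ξ) (edge ξ) (equation ξ) (path-< ξ<n) (edge-≤ ξ) (m%n<n (ξ ℕ.% Λ) c))

        same-vertex : ∀ {τ τ' ξ ξ'} → ξ ℕ.< n → ξ' ℕ.< n → (∀ ι → treePoint τ ξ ι ≡ treePoint τ' ξ' ι) → ∀ b' →
          N τ (path ξ) (pick b' (edge ξ)) ≡ N τ' (path ξ') (pick b' (edge ξ'))
        same-vertex {τ} {τ'} {ξ} {ξ'} ξ<n ξ'<n h b' = digit-injective q (dim b') _ _ (bound τ ξ) (bound τ' ξ')
            (λ β β< → subst (λ γ → digit q (N τ (path ξ) (pick b' (edge ξ))) γ ≡ digit q (N τ' (path ξ') (pick b' (edge ξ'))) γ) (Finₚ.toℕ-fromℕ< β<)
              (trans (sym (treePoint-X τ ξ b' (fromℕ< β<) ξ<n)) (trans (h (co b' (fromℕ< β<))) (treePoint-X τ' ξ' b' (fromℕ< β<) ξ'<n))))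
          where
          bound : ∀ τ ξ → N τ (path ξ) (pick b' (edge ξ)) ℕ.< q ℕ.^ dim b'
          bound τ ξ = subst (λ z → N τ (path ξ) (pick b' (edge ξ)) ℕ.< q ℕ.^ dim z) (side-pick b' (edge ξ)) (N-< τ (path ξ) (pick b' (edge ξ)) (pick-≤last b' ξ))

        -- The end off the root side determines tree, path and its position; the other end, on the
        -- same path, then determines the edge, and `row` determines the equation.
        treePoint-injective : ∀ {τ τ' ξ ξ'} → ξ ℕ.< n → ξ' ℕ.< n → (∀ ι → treePoint τ ξ ι ≡ treePoint τ' ξ' ι) → τ ≡ τ' × ξ ≡ ξ'
        treePoint-injective {τ} {τ'} {ξ} {ξ'} ξ<n ξ'<n h = conclude
            (N-odd τ τ' (path ξ) (path ξ') (pick (not b) (edge ξ)) (pick (not b) (edge ξ')) (path-< ξ<n) (path-< ξ'<n) (pick-≤last (not b) ξ) (pick-≤last (not b) ξ')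
              (side-pick (not b) (edge ξ)) (side-pick (not b) (edge ξ')) (same-vertex ξ<n ξ'<n h (not b)))
          where
          conclude : τ ≡ τ' × path ξ ≡ path ξ' × pick (not b) (edge ξ) ≡ pick (not b) (edge ξ') → τ ≡ τ' × ξ ≡ ξ'
          conclude (refl , i≡ , odd≡) = refl , trans (m≡m%n+[m/n]*n ξ Λ) (trans (cong₂ (λ l i → l ℕ.+ i ℕ.* Λ) L≡ i≡) (sym (m≡m%n+[m/n]*n ξ' Λ)))
            where
            even≡ : pick b (edge ξ) ≡ pick b (edge ξ')
            even≡ = N-even τ (path ξ) (pick b (edge ξ)) (pick b (edge ξ')) (pick-≤last b ξ) (pick-≤last b ξ') (side-pick b (edge ξ)) (side-pick b (edge ξ'))
              (trans (same-vertex ξ<n ξ'<n h b) (cong (λ i → N τ i (pick b (edge ξ'))) (sym i≡)))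
            L≡ : ξ ℕ.% Λ ≡ ξ' ℕ.% Λ
            L≡ = trans (m≡m%n+[m/n]*n (ξ ℕ.% Λ) c) (trans (cong₂ (λ l i → l ℕ.+ i ℕ.* c) (h row) (pick-injective b (edge ξ) (edge ξ') even≡ odd≡)) (sym (m≡m%n+[m/n]*n (ξ' ℕ.% Λ) c)))

        x-entries : ∀ τ → All (_∈ upTo q) (x τ)
        x-entries τ = Allₗ.applyUpTo⁺₂ (flatten (X τ)) n (λ ξ → ∈-upTo⁺ (entry-< (path ξ) (locate last (ξ ℕ.% Λ))))
          where
          entry-< : ∀ i jβ → entry (X τ) i jβ ℕ.< q
          entry-< i (j , β) with j ℕ.≡ᵇ last
          ... | true  = digit-< q (N τ i (suc last)) (i ℕ.* a₀ ℕ.+ β)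
          ... | false = digit-< q (N τ i (suc j)) β

        x∈ : ∀ τ → x τ ∈ tuples n (upTo q)
        x∈ τ = subst (λ m → x τ ∈ tuples m (upTo q)) (length-x τ) (∈-tuples⁺ (x-entries τ))

        x-< : ∀ τ ξ → get (x τ) ξ ℕ.< p
        x-< τ ξ = ℕₚ.<-≤-trans (get-< (ℕ.>-nonZero⁻¹ q) (All.map ∈-upTo⁻ (x-entries τ)) ξ) q≤p

        treePoint-< : ∀ τ ξ ι → treePoint τ ξ ι ℕ.< p
        treePoint-< τ ξ = env-all (ℕ._< p) (rootCoordinate ρ) (get (x τ)) id ξ (λ i β → ℕₚ.<-≤-trans (digit-< q (get ρ i) β) q≤p) (x-< τ) (λ r r<c → ℕₚ.<-≤-trans r<c c≤p)

        rows-separated : ∀ {τ τ' v v' ξ ξ'} → ξ ℕ.< n → ξ' ℕ.< n → ¬ (τ ≡ τ' × ξ ≡ ξ') → Separated (treeRow ρ (x τ , v) ξ) (treeRow ρ (x τ' , v') ξ')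
        rows-separated {τ} {τ'} {v} {v'} {ξ} {ξ'} ξ<n ξ'<n ne = decidable-stable (separated? (treeRow ρ (x τ , v) ξ) (treeRow ρ (x τ' , v') ξ'))
          (λ none → ne (treePoint-injective ξ<n ξ'<n (λ ι → Mod-ℕ⇒≡ (treePoint-< τ ξ ι) (treePoint-< τ' ξ' ι)
            (modulo (decidable-stable ((+ p) ∣? (+ treePoint τ ξ ι - + treePoint τ' ξ' ι)) (λ nd → none (lose (∈-allVars ι) nd)))))))

        equationP : Fin n → Poly (Fin n)
        equationP ξ = F ⟪ env (λ i β → con (+ rootCoordinate ρ i β)) (extend (con 0ℤ) var) (λ r → con (+ r)) (toℕ ξ) ⟫

        deg-equationP : ∀ ξ → deg (equationP ξ) ℕ.≤ R
        deg-equationP ξ = ℕₚ.≤-trans (deg-⟪⟫ F _ (env-all (λ f → deg f ℕ.≤ 1) (λ i β → con (+ rootCoordinate ρ i β)) (extend (con 0ℤ) var) (λ r → con (+ r)) (toℕ ξ) (λ _ _ → z≤n) ext-deg (λ _ _ → z≤n))) deg-F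
          where
          ext-deg : ∀ a → deg (extend {n = n} (con 0ℤ) var a) ℕ.≤ 1
          ext-deg a with a ℕ.<? n
          ... | yes _ = ℕₚ.≤-refl
          ... | no  _ = z≤n

        env-cong : ∀ {A : Set} (σ : ℕ → ℕ → A) {z z' : ℕ → A} (κ : ℕ → A) ξ → z ≗ z' → env σ z κ ξ ≗ env σ z' κ ξ
        env-cong σ {z} {z'} κ ξ h (co b' β) = vertex-cong (pick b' (edge ξ))
          where
          vertex-cong : ∀ j → vertex σ z (path ξ) j (toℕ β) ≡ vertex σ z' (path ξ) j (toℕ β)
          vertex-cong zero    = refl
          vertex-cong (suc j) = h (coordinate (path ξ) j (toℕ β))
        env-cong σ κ ξ h row = refl

        ⟦equationP⟧ : ∀ ξ (z : Fin n → ℤ) → ⟦ equationP ξ ⟧ z ≡ ⟦ F ⟧ (env (λ i β → + rootCoordinate ρ i β) (extend 0ℤ z) +_ (toℕ ξ))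
        ⟦equationP⟧ ξ z = trans (⟦⟪⟫⟧ F _ z) (⟦⟧-cong F (λ ι → trans (env-natural (λ f → ⟦ f ⟧ z) _ _ _ (toℕ ξ) ι) (env-cong _ _ (toℕ ξ) (extend-natural (λ f → ⟦ f ⟧ z) (con 0ℤ) var) ι)))

        vec : List ℕ → Fin n → ℤ
        vec v ξ = + get v (toℕ ξ)

        ζ : Fin t → Fin n → ℤ
        ζ τ = vec (x τ)

        extend-vec : ∀ v → length v ≡ n → extend 0ℤ (vec v) ≗ (λ a → + get v a)
        extend-vec v len a = trans (cong (λ d → extend d (vec v) a) (cong +_ (sym (get-beyond v n (ℕₚ.≤-reflexive len))))) (extend-get (λ a → + get v a) a (λ n≤a → cong +_ (trans (get-beyond v a (ℕₚ.≤-trans (ℕₚ.≤-reflexive len) n≤a)) (sym (get-beyond v n (ℕₚ.≤-reflexive len))))))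

        ⟦equationP⟧-ζ : ∀ τ ξ → ⟦ equationP ξ ⟧ (ζ τ) ≡ ⟦ F ⟧ (λ ι → + treePoint τ (toℕ ξ) ι)
        ⟦equationP⟧-ζ τ ξ = trans (⟦equationP⟧ ξ (ζ τ)) (⟦⟧-cong F (λ ι → trans (env-cong _ _ (toℕ ξ) (extend-vec (x τ) (length-x τ)) ι) (sym (env-natural +_ (rootCoordinate ρ) (get (x τ)) id (toℕ ξ) ι))))

        env-+ : ∀ (σ : ℕ → ℕ → ℕ) (z w κ : ℕ → ℕ) ξ ι →
          env (λ i β → + σ i β) (λ a → + z a + + p * + w a) (λ r → + κ r) ξ ι ≡ + env σ z κ ξ ι + + p * + env (λ _ _ → 0) w (λ _ → 0) ξ ι
        env-+ σ z w κ ξ (co b' β) = go (pick b' (edge ξ))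
          where
          go : ∀ j → vertex (λ i β → + σ i β) (λ a → + z a + + p * + w a) (path ξ) j (toℕ β) ≡ + vertex σ z (path ξ) j (toℕ β) + + p * + vertex (λ _ _ → 0) w (path ξ) j (toℕ β)
          go zero    = e (+ σ (path ξ) (toℕ β)) (+ p)
            where
            e : ∀ a p → a ≡ a + p * 0ℤ
            e = solve-∀
          go (suc j) = refl
        env-+ σ z w κ ξ row = e (+ κ (equation ξ)) (+ p)
          where
          e : ∀ a p → a ≡ a + p * 0ℤ
          e = solve-∀

        ⟦equationP⟧-nudged : ∀ τ v ξ → length v ≡ n → ⟦ equationP ξ ⟧ (λ i → ζ τ i + + p * vec v i) ≡ ⟦ F ⟧ (nudged (treeRow ρ (x τ , v) (toℕ ξ)))
        ⟦equationP⟧-nudged τ v ξ len = trans (⟦equationP⟧ ξ (λ i → ζ τ i + + p * vec v i)) (⟦⟧-cong F (λ ι →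
            trans (env-cong _ _ (toℕ ξ) ext ι) (env-+ (rootCoordinate ρ) (get (x τ)) (get v) id (toℕ ξ) ι)))
          where
          g : ℕ → ℤ
          g a = + get (x τ) a + + p * + get v a
          ext : extend 0ℤ (λ i → ζ τ i + + p * vec v i) ≗ g
          ext a = trans (cong (λ d → extend {n = n} d (g ∘ toℕ) a) (sym (g≡0 n ℕₚ.≤-refl))) (extend-get g a (λ n≤a → trans (g≡0 a n≤a) (sym (g≡0 n ℕₚ.≤-refl))))
            where
            g≡0 : ∀ a → n ℕ.≤ a → g a ≡ 0ℤ
            g≡0 a n≤a = trans (cong₂ (λ y z → + y + + p * + z) (get-beyond (x τ) a (ℕₚ.≤-trans (ℕₚ.≤-reflexive (length-x τ)) n≤a)) (get-beyond v a (ℕₚ.≤-trans (ℕₚ.≤-reflexive len) n≤a))) (trans (ℤₚ.+-identityˡ (+ p * 0ℤ)) (ℤₚ.*-zeroʳ (+ p)))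

        Kernel : Fin t → List ℕ → Set
        Kernel τ v = All (λ ξ → + p ∣ ∂ (equationP ξ) (ζ τ) (vec v)) (allFin n)

        Singular : Fin t → Set
        Singular τ = Any (Kernel τ) (normalised p n)

        singular? : ∀ τ → Dec (Singular τ)
        singular? τ = Any.any? (λ v → All.all? (λ ξ → (+ p) ∣? ∂ (equationP ξ) (ζ τ) (vec v)) (allFin n)) (normalised p n)

        nonsingular : ∀ τ → ¬ Singular τ → ∀ w → (∀ ξ → + p ∣ ∂ (equationP ξ) (ζ τ) w) → ∀ ξ → + p ∣ w ξ
        nonsingular τ ¬sing w ker = [ id , (λ r → contradiction (kernel r) ¬sing) ]′ (normalise pp n w)
          where
          kernel : Normalisation pp n w → Singular τ
          kernel (a , v , v∈ , h) = lose v∈ (All.tabulate (λ {ξ} _ → in-kernel ξ))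
            where
            e : ∀ a w v q → a * w - v ≡ q → v ≡ a * w - q
            e a w v q eq = trans (r a w v) (cong (λ z → a * w - z) eq)
              where
              r : ∀ a w v → v ≡ a * w - (a * w - v)
              r = solve-∀
            quot : Fin n → ℤ
            quot ξ = _∣_.quotient (Mod.∣-diff (h ξ))
            v≡ : ∀ ξ → vec v ξ ≡ a * w ξ - + p * quot ξ
            v≡ ξ = e a (w ξ) (vec v ξ) (+ p * quot ξ) (trans (_∣_.equality (Mod.∣-diff (h ξ))) (ℤₚ.*-comm (quot ξ) (+ p)))
            in-kernel : ∀ ξ → + p ∣ ∂ (equationP ξ) (ζ τ) (vec v)
            in-kernel ξ = subst (+ p ∣_) (sym (trans (∂-cong (equationP ξ) (ζ τ) v≡) (trans (∂-sub (equationP ξ) (ζ τ) (λ i → a * w i) (λ i → + p * quot i)) (cong₂ _-_ (∂-scale (equationP ξ) (ζ τ) a w) (∂-scale (equationP ξ) (ζ τ) (+ p) quot)))))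
              (∣m∣n⇒∣m-n (∣n⇒∣m*n a (ker ξ)) (∣m⇒∣m*n (∂ (equationP ξ) (ζ τ) quot) ∣-refl))

        -- The first-order term is p times a derivative that p divides, and the remainder carries p²
        -- anyway.
        singular-flat : ∀ τ v → length v ≡ n → Kernel τ v → ∀ ξ → ξ ℕ.< n → Flat F (treeRow ρ (x τ , v) ξ)
        singular-flat τ v len ker ξ ξ<n = subst (λ ξ → Flat F (treeRow ρ (x τ , v) ξ)) (Finₚ.toℕ-fromℕ< ξ<n)
            (subst₂ (λ a b → + p * + p ∣ a - b) (⟦equationP⟧-nudged τ v η len) (⟦equationP⟧-ζ τ η)
              (subst (+ p * + p ∣_) (sym difference) (*-monoʳ-∣ (+ p) (∣m∣n⇒∣m+n (All.lookup ker (∈-allFin η)) (∣m⇒∣m*n remainder ∣-refl)))))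
          where
          η = fromℕ< ξ<n
          expansion = taylor (equationP η) (ζ τ) (+ p) (vec v)
          remainder = proj₁ expansion
          e : ∀ a b → a + b - a ≡ b
          e = solve-∀
          difference : ⟦ equationP η ⟧ (λ i → ζ τ i + + p * vec v i) - ⟦ equationP η ⟧ (ζ τ) ≡ + p * (∂ (equationP η) (ζ τ) (vec v) + + p * remainder)
          difference = trans (cong (_- ⟦ equationP η ⟧ (ζ τ)) (proj₂ expansion)) (e (⟦ equationP η ⟧ (ζ τ)) (+ p * (∂ (equationP η) (ζ τ) (vec v) + + p * remainder)))

        direction : Fin t → List ℕ
        direction τ with singular? τ
        ... | yes sing = proj₁ (find sing)
        ... | no  _    = []

        direction-spec : ∀ τ → Singular τ → direction τ ∈ normalised p n × Kernel τ (direction τ)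
        direction-spec τ sing with singular? τ
        ... | yes sing' = proj₂ (find sing')
        ... | no  ¬sing = contradiction sing ¬sing

        tree : Fin t → List ℕ × List ℕ
        tree τ = x τ , direction τ

        realised : ∀ τs → AllPairs _≢_ τs → All Singular τs → Realised (configRows ρ (map tree τs)) F
        realised τs distinct sing = subst (AllPairs Separated) rows≡ separated , subst (λ rs → Sat rs F) rows≡ satisfied
          where
          blocks = map (λ τ → treeRows ρ (tree τ)) τs
          rows≡ : Data.List.concat blocks ≡ configRows ρ (map tree τs)
          rows≡ = cong Data.List.concat (Listₚ.map-∘ τs)
          within : ∀ τ → AllPairs Separated (treeRows ρ (tree τ))
          within τ = AllPairsₚ.map⁺ (upTo-pairs (upTo-unique n) (All.tabulate ∈-upTo⁻))
            where
            upTo-pairs : ∀ {ξs} → AllPairs _≢_ ξs → All (ℕ._< n) ξs → AllPairs (λ ξ ξ' → Separated (treeRow ρ (tree τ) ξ) (treeRow ρ (tree τ) ξ')) ξs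
            upTo-pairs [] [] = []
            upTo-pairs (ne ∷ un) (lt ∷ lts) = All.map (λ (ξ≢ , lt') → rows-separated {v = direction τ} {v' = direction τ} lt lt' (λ eq → ξ≢ (proj₂ eq))) (All.zip (ne , lts)) ∷ upTo-pairs un lts
          across : ∀ {τ τ'} → τ ≢ τ' → All (λ r → All (Separated r) (treeRows ρ (tree τ'))) (treeRows ρ (tree τ))
          across {τ} {τ'} τ≢τ' = Allₗ.map⁺ (All.tabulate (λ ξ∈ → Allₗ.map⁺ (All.tabulate (λ ξ'∈ → rows-separated {v = direction τ} {v' = direction τ'} (∈-upTo⁻ ξ∈) (∈-upTo⁻ ξ'∈) (λ eq → τ≢τ' (proj₁ eq))))))
          separated : AllPairs Separated (Data.List.concat blocks)
          separated = AllPairsₚ.concat⁺ (Allₗ.map⁺ (All.universal within τs)) (AllPairsₚ.map⁺ (AllPairs.map across distinct))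
          satisfied : Sat (Data.List.concat blocks) F
          satisfied = Allₗ.concat⁺ (Allₗ.map⁺ (All.map (λ {τ} sg → Allₗ.map⁺ (All.tabulate (λ {ξ} ξ∈ → treePoint-small τ ξ (∈-upTo⁻ ξ∈) ,
            singular-flat τ (direction τ) (proj₁ (∈-normalised⁻ 1<p n (proj₁ (direction-spec τ sg)))) (proj₂ (direction-spec τ sg)) ξ (∈-upTo⁻ ξ∈)))) sing))

        ρ∈ : ρ ∈ roots
        ρ∈ = subst (λ m → ρ ∈ tuples m (upTo (q ℕ.^ dim b))) (Listₚ.length-applyUpTo root s) (∈-tuples⁺ (Allₗ.applyUpTo⁺₂ root s (λ i → ∈-upTo⁺ (root-< i))))

        too-many-singular : ∀ τs → length τs ≡ T → AllPairs _≢_ τs → All Singular τs → ⊥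
        too-many-singular τs len distinct sing = ℕₚ.<⇒≱ (s≤s z≤n) (begin
          1                                                                       ≡⟨ sym (ind-yes (realised? (configRows ρ ts) F) (realised τs distinct sing)) ⟩
          ind (realised? (configRows ρ ts) F)                                     ≤⟨ ∑-term (λ ts → ind (realised? (configRows ρ ts) F)) ts∈ ⟩
          ∑ (tuples T trees) (λ ts → ind (realised? (configRows ρ ts) F))         ≤⟨ ∑-term (λ ρ → ∑ (tuples T trees) (λ ts → ind (realised? (configRows ρ ts) F))) ρ∈ ⟩
          bad F                                                                   ≡⟨ no-bad ⟩
          0 ∎)
          where
          open ℕₚ.≤-Reasoning
          ts = map tree τs
          ts∈ : ts ∈ tuples T trees
          ts∈ = subst (λ m → ts ∈ tuples m trees) (trans (Listₚ.length-map tree τs) len) (∈-tuples⁺ (Allₗ.map⁺ (All.map (λ {τ} sg → ∈-trees⁺ (x∈ τ) (proj₁ (direction-spec τ sg))) sing)))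

        -- Position 1 of path 0 lies off the root side, hence already tells trees apart.
        x-injective : ∀ {τ τ'} → (∀ ξ → get (x τ) ξ ≡ get (x τ') ξ) → τ ≡ τ'
        x-injective {τ} {τ'} h = proj₁ (N-odd τ τ' 0 0 1 1 1≤s 1≤s (s≤s z≤n) (s≤s z≤n) refl refl
          (digit-injective q (dim (not b)) _ _ (N-< τ 0 1 (s≤s z≤n)) (N-< τ' 0 1 (s≤s z≤n)) (λ β β< →
            trans (sym (vertex-X τ 0 1 β 1≤s (s≤s z≤n) β<)) (trans (h (coordinate 0 0 β)) (vertex-X τ' 0 1 β 1≤s (s≤s z≤n) β<)))))

        ζ-separated : ∀ {τ τ'} → τ ≢ τ' → ∃[ κ ] ¬ + p ∣ ζ τ κ - ζ τ' κ
        ζ-separated {τ} {τ'} τ≢ = decidable-stable (Finₚ.any? (λ κ → ¬? ((+ p) ∣? (ζ τ κ - ζ τ' κ)))) (λ none → τ≢ (x-injective (λ ξ → same none ξ)))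
          where
          same : ¬ (∃[ κ ] ¬ + p ∣ ζ τ κ - ζ τ' κ) → ∀ ξ → get (x τ) ξ ≡ get (x τ') ξ
          same none ξ = go (ξ ℕ.<? n)
            where
            go : Dec (ξ ℕ.< n) → get (x τ) ξ ≡ get (x τ') ξ
            go (yes ξ<n) = subst (λ ξ → get (x τ) ξ ≡ get (x τ') ξ) (Finₚ.toℕ-fromℕ< ξ<n) (Mod-ℕ⇒≡ (x-< τ _) (x-< τ' _)
              (modulo (decidable-stable ((+ p) ∣? (ζ τ (fromℕ< ξ<n) - ζ τ' (fromℕ< ξ<n))) (λ nd → none (fromℕ< ξ<n , nd)))))
            go (no ξ≮n) = trans (get-beyond (x τ) ξ (ℕₚ.≤-trans (ℕₚ.≤-reflexive (length-x τ)) (ℕₚ.≮⇒≥ ξ≮n))) (sym (get-beyond (x τ') ξ (ℕₚ.≤-trans (ℕₚ.≤-reflexive (length-x τ')) (ℕₚ.≮⇒≥ ξ≮n))))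

        -- The Bézout-type bound is applied to the windows: they vanish exactly modulo p, have
        -- degree at most B * R, and any kernel vector of theirs is one of the equations.
        too-many-nonsingular : ∀ τs → length τs ≡ K → AllPairs _≢_ τs → All (λ τ → ¬ Singular τ) τs → ⊥
        too-many-nonsingular τs refl distinct nonsing = nonsingular-zeros-bounded pp K-big K<p (λ ξ → window pp B (equationP ξ)) (λ ξ → deg-window pp B (equationP ξ) (deg-equationP ξ))
            (λ i → ζ (lookup τs i)) (λ i l i≢l → ζ-separated (λ e → i≢l (lookup-injective distinct i l e)))
            (λ i ξ → window-∣ pp B≤p (equationP ξ) (ζ (lookup τs i)) (small (lookup τs i) ξ))
            (λ i v ker → nonsingular (lookup τs i) (All.lookup nonsing (∈-lookup {xs = τs} i)) v (λ ξ → ∂-window pp B≤p (equationP ξ) (ζ (lookup τs i)) (small (lookup τs i) ξ) v (ker ξ)))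
          where
          small : ∀ τ ξ → (⟦ equationP ξ ⟧ (ζ τ) %ℕ p) {{prime⇒nonZero pp}} ℕ.< B
          small τ ξ = subst (λ v → (v %ℕ p) {{prime⇒nonZero pp}} ℕ.< B) (sym (⟦equationP⟧-ζ τ ξ)) (treePoint-small τ (toℕ ξ) (Finₚ.toℕ<n ξ))

      no-large-family : ⊥
      no-large-family = [ (λ (τs , len , distinct , _ , all) → too-many-nonsingular τs len distinct all) , (λ (τs , len , distinct , _ , all) → too-many-singular τs len distinct all) ]′
        (split-list singular? K T (allFin t) (Uniqueₚ.allFin⁺ t) (ℕₚ.≤-trans K+T≤t (ℕₚ.≤-reflexive (sym (Listₚ.length-tabulate id)))))

  -- The random graph and the choice of F.

  module RandomGraph {p : ℕ} (pp : Prime p) (q : ℕ) {{q≢0 : NonZero q}} (q≤p : q ℕ.≤ p)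
    (dim : Bool → ℕ) (c : ℕ) (c≤p : c ℕ.≤ p) (R B : ℕ) (B≤p : B ℕ.≤ p) (room : 2 ℕ.* c ℕ.≤ R) where

    open Sampling pp (allVars dim) R B B≤p

    edgePoint : ℕ → ℕ → ℕ → Var dim → ℕ
    edgePoint x y r (co true β)  = digit q x (toℕ β)
    edgePoint x y r (co false β) = digit q y (toℕ β)
    edgePoint x y r row          = r

    edgeRow : ℕ → ℕ → ℕ → Row
    edgeRow x y r = record { pt = edgePoint x y r ; dir = λ _ → 0 ; live = false }

    edgeRows : ℕ → ℕ → List Row
    edgeRows x y = map (edgeRow x y) (upTo c)

    edge? : ∀ F x y → Dec (All (λ r → Small F (at r)) (edgeRows x y))
    edge? F x y = All.all? (λ r → small? F (at r)) (edgeRows x y)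

    graph : Poly (Var dim) → BipGraph (q ℕ.^ dim true) (q ℕ.^ dim false)
    graph F x y = does (edge? F (toℕ x) (toℕ y))

    graph-edge : ∀ F x y → IsTrue (graph F x y) → ∀ r → r ℕ.< c → Small F (λ ι → + edgePoint (toℕ x) (toℕ y) r ι)
    graph-edge F x y h r r<c = All.lookup (from (edge? F (toℕ x) (toℕ y)) h) (∈-map⁺ (edgeRow (toℕ x) (toℕ y)) (∈-upTo⁺ r<c))
      where
      from : ∀ {A : Set} (d : Dec A) → IsTrue (does d) → A
      from (yes a) _ = a

    edgeRows-separated : ∀ x y → AllPairs Separated (edgeRows x y)
    edgeRows-separated x y = AllPairsₚ.map⁺ (pairs (upTo-unique c) (All.tabulate ∈-upTo⁻))
      where
      pairs : ∀ {rs} → AllPairs _≢_ rs → All (ℕ._< c) rs → AllPairs (λ r r' → Separated (edgeRow x y r) (edgeRow x y r')) rs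
      pairs [] [] = []
      pairs (ne ∷ un) (lt ∷ lts) = All.map (λ (r≢ , lt') → here (λ d → r≢ (Mod-ℕ⇒≡ (ℕₚ.<-≤-trans lt c≤p) (ℕₚ.<-≤-trans lt' c≤p) (modulo d)))) (All.zip (ne , lts)) ∷ pairs un lts

    edgeRows-reduced : ∀ x y → All Reduced (edgeRows x y)
    edgeRows-reduced x y = Allₗ.map⁺ (All.tabulate (λ {r} r∈ → reduced r (∈-upTo⁻ r∈)))
      where
      reduced : ∀ r → r ℕ.< c → ∀ ι → edgePoint x y r ι ℕ.< p
      reduced r r<c (co true β)  = ℕₚ.<-≤-trans (digit-< q x (toℕ β)) q≤p
      reduced r r<c (co false β) = ℕₚ.<-≤-trans (digit-< q y (toℕ β)) q≤p
      reduced r r<c row          = ℕₚ.<-≤-trans r<c c≤p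

    length-edgeRows : ∀ x y → length (edgeRows x y) ≡ c
    length-edgeRows x y = trans (Listₚ.length-map (edgeRow x y) (upTo c)) (Listₚ.length-upTo c)

    edge-probability : ∀ x y → p ℕ.^ c ℕ.* ∑ Ω (λ F → ind (edge? F x y)) ≡ B ℕ.^ c ℕ.* length Ω
    edge-probability x y = subst (λ m → p ℕ.^ m ℕ.* ∑ Ω (λ F → ind (edge? F x y)) ≡ B ℕ.^ m ℕ.* length Ω) (length-edgeRows x y)
      (sym (smalls-count (edgeRows x y) (edgeRows-separated x y) (edgeRows-reduced x y) (ℕₚ.≤-trans (ℕₚ.≤-reflexive (cong (2 ℕ.*_) (length-edgeRows x y))) room)))

    edgeCount : Poly (Var dim) → ℕ
    edgeCount F = ∑ (allFin (q ℕ.^ dim true)) (λ x → ∑ (allFin (q ℕ.^ dim false)) (λ y → ind (edge? F (toℕ x) (toℕ y))))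

    edges-graph : ∀ F → edges (graph F) ≡ edgeCount F
    edges-graph F = ∑-cong (allFin (q ℕ.^ dim true)) (λ x → ∑-cong (allFin (q ℕ.^ dim false)) (λ y → as-ind (edge? F (toℕ x) (toℕ y))))
      where
      as-ind : ∀ {A : Set} (d : Dec A) → (if does d then 1 else 0) ≡ ind d
      as-ind (yes _) = refl
      as-ind (no _)  = refl

    pairs : ℕ
    pairs = q ℕ.^ dim true ℕ.* q ℕ.^ dim false

    ∑∑-const : ∀ k → ∑ (allFin (q ℕ.^ dim true)) (λ x → ∑ (allFin (q ℕ.^ dim false)) (λ y → k)) ≡ pairs ℕ.* k
    ∑∑-const k = trans (∑-const (allFin (q ℕ.^ dim true)) _) (trans (cong₂ ℕ._*_ (Listₚ.length-tabulate {n = q ℕ.^ dim true} id) (trans (∑-const (allFin (q ℕ.^ dim false)) k) (cong (ℕ._* k) (Listₚ.length-tabulate {n = q ℕ.^ dim false} id)))) (sym (ℕₚ.*-assoc (q ℕ.^ dim true) (q ℕ.^ dim false) k)))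

    edgeCount-≤ : ∀ F → edgeCount F ℕ.≤ pairs
    edgeCount-≤ F = ℕₚ.≤-trans (∑-mono (allFin (q ℕ.^ dim true)) (λ x → ∑-mono (allFin (q ℕ.^ dim false)) (λ y → ind≤1 (edge? F (toℕ x) (toℕ y))))) (ℕₚ.≤-reflexive (trans (∑∑-const 1) (ℕₚ.*-identityʳ pairs)))

    edgeCount-average : p ℕ.^ c ℕ.* ∑ Ω edgeCount ≡ pairs ℕ.* (B ℕ.^ c ℕ.* length Ω)
    edgeCount-average = begin
      P ℕ.* ∑ Ω edgeCount
        ≡⟨ cong (P ℕ.*_) (trans (∑-swap Ω xs (λ F x → ∑ ys (λ y → ind (edge? F (toℕ x) (toℕ y))))) (∑-cong xs (λ x → ∑-swap Ω ys (λ F y → ind (edge? F (toℕ x) (toℕ y)))))) ⟩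
      P ℕ.* ∑ xs (λ x → ∑ ys (λ y → ∑ Ω (λ F → ind (edge? F (toℕ x) (toℕ y)))))
        ≡⟨ trans (sym (∑-* xs P (λ x → ∑ ys (λ y → ∑ Ω (λ F → ind (edge? F (toℕ x) (toℕ y))))))) (∑-cong xs (λ x → sym (∑-* ys P (λ y → ∑ Ω (λ F → ind (edge? F (toℕ x) (toℕ y))))))) ⟩
      ∑ xs (λ x → ∑ ys (λ y → P ℕ.* ∑ Ω (λ F → ind (edge? F (toℕ x) (toℕ y)))))
        ≡⟨ ∑-cong xs (λ x → ∑-cong ys (λ y → edge-probability (toℕ x) (toℕ y))) ⟩
      ∑ xs (λ x → ∑ ys (λ y → B ℕ.^ c ℕ.* length Ω))
        ≡⟨ ∑∑-const (B ℕ.^ c ℕ.* length Ω) ⟩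
      pairs ℕ.* (B ℕ.^ c ℕ.* length Ω) ∎
      where
      open ≡-Reasoning
      P = p ℕ.^ c
      xs = allFin (q ℕ.^ dim true)
      ys = allFin (q ℕ.^ dim false)

    -- First moment: on average the edges outweigh |M||N| times the number of bad families.
    choose : ∀ (bad₁ bad₂ : Poly (Var dim) → ℕ) C₁ C₂ D →
      p ℕ.^ suc c ℕ.* ∑ Ω bad₁ ℕ.≤ C₁ ℕ.* length Ω → p ℕ.^ suc c ℕ.* ∑ Ω bad₂ ℕ.≤ C₂ ℕ.* length Ω →
      q ℕ.^ D ℕ.* q ℕ.^ c ≡ pairs → p ℕ.≤ B ℕ.* q → 1 ℕ.≤ B → 2 ℕ.* (C₁ ℕ.+ C₂) ℕ.≤ p →
      ∃[ F ] deg F ℕ.≤ R × q ℕ.^ D ℕ.≤ 2 ℕ.* edges (graph F) × bad₁ F ≡ 0 × bad₂ F ≡ 0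
    choose bad₁ bad₂ C₁ C₂ D h₁ h₂ hD p≤Bq 1≤B big = F , All.lookup (combinations-deg p (words (allVars dim) p R) (words-deg (allVars dim) p R)) F∈ ,
        ℕₚ.≤-trans (ℕₚ.m≤m+n (q ℕ.^ D) _) (ℕₚ.≤-trans F-good (ℕₚ.≤-reflexive (cong (2 ℕ.*_) (sym (edges-graph F))))) , ℕₚ.m+n≡0⇒m≡0 (bad₁ F) none , ℕₚ.m+n≡0⇒n≡0 (bad₁ F) none
      where
      open ℕₚ.≤-Reasoning
      instance
        p≢0 : NonZero p
        p≢0 = prime⇒nonZero pp
      M = length Ω
      V = pairs
      P = p ℕ.^ suc c
      -- A single bad family is charged twice the number of all pairs, which twice the edge count
      -- can never exceed.
      penalty : Poly (Var dim) → ℕ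
      penalty F = q ℕ.^ D ℕ.+ 2 ℕ.* V ℕ.* (bad₁ F ℕ.+ bad₂ F)
      -- The window size pays for replacing q by p: B / p is at least 1 / q.
      p^c≤ : p ℕ.^ c ℕ.≤ B ℕ.^ c ℕ.* q ℕ.^ c
      p^c≤ = ℕₚ.≤-trans (ℕₚ.^-monoˡ-≤ c p≤Bq) (ℕₚ.≤-reflexive (^-*-distrib B q c))
      main-term : P ℕ.* (M ℕ.* q ℕ.^ D) ℕ.≤ p ℕ.* (V ℕ.* (B ℕ.^ c ℕ.* M))
      main-term = begin
        p ℕ.* p ℕ.^ c ℕ.* (M ℕ.* q ℕ.^ D) ≡⟨ e p (p ℕ.^ c) M (q ℕ.^ D) ⟩
        p ℕ.* (M ℕ.* (q ℕ.^ D ℕ.* p ℕ.^ c)) ≤⟨ ℕₚ.*-monoʳ-≤ p (ℕₚ.*-monoʳ-≤ M (ℕₚ.*-monoʳ-≤ (q ℕ.^ D) p^c≤)) ⟩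
        p ℕ.* (M ℕ.* (q ℕ.^ D ℕ.* (B ℕ.^ c ℕ.* q ℕ.^ c))) ≡⟨ e' p M (q ℕ.^ D) (B ℕ.^ c) (q ℕ.^ c) ⟩
        p ℕ.* (q ℕ.^ D ℕ.* q ℕ.^ c ℕ.* (B ℕ.^ c ℕ.* M)) ≡⟨ cong (λ v → p ℕ.* (v ℕ.* (B ℕ.^ c ℕ.* M))) hD ⟩
        p ℕ.* (V ℕ.* (B ℕ.^ c ℕ.* M)) ∎
        where
        e : ∀ p c M D → p ℕ.* c ℕ.* (M ℕ.* D) ≡ p ℕ.* (M ℕ.* (D ℕ.* c))
        e = ℕSolver.solve-∀
        e' : ∀ p M D b c → p ℕ.* (M ℕ.* (D ℕ.* (b ℕ.* c))) ≡ p ℕ.* (D ℕ.* c ℕ.* (b ℕ.* M))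
        e' = ℕSolver.solve-∀
      -- The bad families are rarer than an edge by one more factor p, which absorbs the constants
      -- C₁ and C₂.
      bad-term : P ℕ.* (2 ℕ.* V ℕ.* (∑ Ω bad₁ ℕ.+ ∑ Ω bad₂)) ℕ.≤ p ℕ.* (V ℕ.* (B ℕ.^ c ℕ.* M))
      bad-term = begin
        P ℕ.* (2 ℕ.* V ℕ.* (∑ Ω bad₁ ℕ.+ ∑ Ω bad₂)) ≡⟨ e P V (∑ Ω bad₁) (∑ Ω bad₂) ⟩
        2 ℕ.* V ℕ.* (P ℕ.* ∑ Ω bad₁ ℕ.+ P ℕ.* ∑ Ω bad₂) ≤⟨ ℕₚ.*-monoʳ-≤ (2 ℕ.* V) (ℕₚ.+-mono-≤ h₁ h₂) ⟩
        2 ℕ.* V ℕ.* (C₁ ℕ.* M ℕ.+ C₂ ℕ.* M) ≡⟨ e' V C₁ C₂ M ⟩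
        2 ℕ.* (C₁ ℕ.+ C₂) ℕ.* (V ℕ.* M) ≤⟨ ℕₚ.*-monoˡ-≤ (V ℕ.* M) big ⟩
        p ℕ.* (V ℕ.* M) ≤⟨ ℕₚ.*-monoʳ-≤ p (ℕₚ.*-monoʳ-≤ V (ℕₚ.m≤n*m M (B ℕ.^ c) {{ℕₚ.m^n≢0 B c {{ℕ.>-nonZero 1≤B}}}})) ⟩
        p ℕ.* (V ℕ.* (B ℕ.^ c ℕ.* M)) ∎
        where
        e : ∀ P V x y → P ℕ.* (2 ℕ.* V ℕ.* (x ℕ.+ y)) ≡ 2 ℕ.* V ℕ.* (P ℕ.* x ℕ.+ P ℕ.* y)
        e = ℕSolver.solve-∀
        e' : ∀ V a b M → 2 ℕ.* V ℕ.* (a ℕ.* M ℕ.+ b ℕ.* M) ≡ 2 ℕ.* (a ℕ.+ b) ℕ.* (V ℕ.* M)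
        e' = ℕSolver.solve-∀
      average : ∑ Ω penalty ℕ.≤ ∑ Ω (λ F → 2 ℕ.* edgeCount F)
      average = ℕₚ.*-cancelˡ-≤ P {{ℕₚ.m^n≢0 p (suc c)}} (begin
        P ℕ.* ∑ Ω penalty ≡⟨ cong (P ℕ.*_) (trans (∑-+ Ω (λ _ → q ℕ.^ D) (λ F → 2 ℕ.* V ℕ.* (bad₁ F ℕ.+ bad₂ F))) (cong₂ ℕ._+_ (∑-const Ω (q ℕ.^ D)) (trans (∑-* Ω (2 ℕ.* V) (λ F → bad₁ F ℕ.+ bad₂ F)) (cong (2 ℕ.* V ℕ.*_) (∑-+ Ω bad₁ bad₂))))) ⟩
        P ℕ.* (M ℕ.* q ℕ.^ D ℕ.+ 2 ℕ.* V ℕ.* (∑ Ω bad₁ ℕ.+ ∑ Ω bad₂)) ≡⟨ ℕₚ.*-distribˡ-+ P (M ℕ.* q ℕ.^ D) _ ⟩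
        P ℕ.* (M ℕ.* q ℕ.^ D) ℕ.+ P ℕ.* (2 ℕ.* V ℕ.* (∑ Ω bad₁ ℕ.+ ∑ Ω bad₂)) ≤⟨ ℕₚ.+-mono-≤ main-term bad-term ⟩
        p ℕ.* (V ℕ.* (B ℕ.^ c ℕ.* M)) ℕ.+ p ℕ.* (V ℕ.* (B ℕ.^ c ℕ.* M)) ≡⟨ cong (λ z → p ℕ.* z ℕ.+ p ℕ.* z) (sym edgeCount-average) ⟩
        p ℕ.* (p ℕ.^ c ℕ.* ∑ Ω edgeCount) ℕ.+ p ℕ.* (p ℕ.^ c ℕ.* ∑ Ω edgeCount) ≡⟨ e p (p ℕ.^ c) (∑ Ω edgeCount) ⟩
        P ℕ.* (2 ℕ.* ∑ Ω edgeCount) ≡⟨ cong (P ℕ.*_) (sym (∑-* Ω 2 edgeCount)) ⟩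
        P ℕ.* ∑ Ω (λ F → 2 ℕ.* edgeCount F) ∎)
        where
        e : ∀ p c E → p ℕ.* (c ℕ.* E) ℕ.+ p ℕ.* (c ℕ.* E) ≡ p ℕ.* c ℕ.* (2 ℕ.* E)
        e = ℕSolver.solve-∀
      chosen : ∃[ F ] F ∈ Ω × penalty F ℕ.≤ 2 ℕ.* edgeCount F
      chosen = ∑≤∑⇒∃ Ω penalty (λ F → 2 ℕ.* edgeCount F) (combinations-nonempty p (ℕ.>-nonZero⁻¹ p) (words (allVars dim) p R)) average
      F = proj₁ chosen
      F∈ = proj₁ (proj₂ chosen)
      F-good : penalty F ℕ.≤ 2 ℕ.* edgeCount F
      F-good = proj₂ (proj₂ chosen)
      none : bad₁ F ℕ.+ bad₂ F ≡ 0
      -- The positive term q ^ D makes the comparison with 2 V strict, so not even one bad family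
      -- fits.
      none = vanish (bad₁ F ℕ.+ bad₂ F) (ℕₚ.≤-trans (ℕₚ.+-monoˡ-≤ (2 ℕ.* V ℕ.* (bad₁ F ℕ.+ bad₂ F)) (ℕₚ.m^n>0 q D)) (ℕₚ.≤-trans F-good (ℕₚ.*-monoʳ-≤ 2 (edgeCount-≤ F))))
        where
        vanish : ∀ x → 1 ℕ.+ 2 ℕ.* V ℕ.* x ℕ.≤ 2 ℕ.* V → x ≡ 0
        vanish zero    _ = refl
        vanish (suc x) h = contradiction (ℕₚ.≤-trans (s≤s (ℕₚ.m≤m*n (2 ℕ.* V) (suc x))) h) (ℕₚ.<⇒≱ (ℕₚ.n<1+n (2 ℕ.* V)))

  -- Reading an embedded subdivision as a family of trees.

  sideOf : ∀ {m n} → Fin m ⊎ Fin n → Bool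
  sideOf (inj₁ _) = true
  sideOf (inj₂ _) = false

  number : ∀ {m n} → Fin m ⊎ Fin n → ℕ
  number (inj₁ x) = toℕ x
  number (inj₂ y) = toℕ y

  number-injective : ∀ {m n} (u w : Fin m ⊎ Fin n) → sideOf u ≡ sideOf w → number u ≡ number w → u ≡ w
  number-injective (inj₁ x) (inj₁ x') _ e = cong inj₁ (Finₚ.toℕ-injective e)
  number-injective (inj₂ y) (inj₂ y') _ e = cong inj₂ (Finₚ.toℕ-injective e)

  adjacent-sides : ∀ {m n} (G : BipGraph m n) u w → BipAdj G u w → sideOf w ≡ not (sideOf u)
  adjacent-sides G (inj₁ _) (inj₂ _) _ = refl
  adjacent-sides G (inj₂ _) (inj₁ _) _ = refl

  module _ (H : EdgeGraph) (k : ℕ) where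
    open EdgeGraph H

    -- Turns the comparison hidden in `pathVtx` into constructors, so that equations between path
    -- vertices can be settled by matching.
    data PathView (e : E) : ℕ → SubVertex H k → Set where
      start  : PathView e 0 (inj₁ (src e))
      inner  : ∀ {j} (j<k : j ℕ.< k) → PathView e (suc j) (inj₂ (e , fromℕ< j<k))
      finish : PathView e (suc k) (inj₁ (tgt e))

    pathView : ∀ e j → j ℕ.≤ suc k → PathView e j (pathVtx H k e j)
    pathView e zero _ = start
    pathView e (suc j) (s≤s j≤k) with j ℕ.<? k
    ... | yes j<k = inner j<k
    ... | no j≮k with ℕₚ.≤-antisym j≤k (ℕₚ.≮⇒≥ j≮k)
    ...   | refl = finish

  mod-toℕ : ∀ {i s} .{{_ : NonZero s}} → i ℕ.< s → toℕ (i mod s) ≡ i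
  mod-toℕ {i} {s} i<s = trans (Finₚ.toℕ-fromℕ< (m%n<n i s)) (m<n⇒m%n≡m i<s)

  module NoEmbedding {p : ℕ} (pp : Prime p) (q : ℕ) {{q≢0 : NonZero q}} (q≤p : q ℕ.≤ p) (1<p : 1 ℕ.< p)
    (dim : Bool → ℕ) (s k' c : ℕ) {{s≢0 : NonZero s}} {{c≢0 : NonZero c}} (c≤p : c ℕ.≤ p) (c≤dim : ∀ b' → c ℕ.≤ dim b')
    (a₀ : Bool → ℕ) (a₀≢0 : ∀ b → NonZero (a₀ b)) (split : ∀ b → dim b ≡ s ℕ.* a₀ b)
    (fits : ∀ b → Tree.Λ dim b s k' c (a₀ b) {{c≢0}} {{a₀≢0 b}} ℕ.≤ suc (Tree.last dim b s k' c (a₀ b) {{c≢0}} {{a₀≢0 b}}) ℕ.* c)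
    (R B T : ℕ) (B≤p : B ℕ.≤ p)
    (room : ∀ b → 2 ℕ.* (T ℕ.* Tree.n dim b s k' c (a₀ b) {{c≢0}} {{a₀≢0 b}}) ℕ.≤ R) (room-c : 2 ℕ.* c ℕ.≤ R)
    {Z : ℕ} (Z-big : ∀ b → suc (Tree.n dim b s k' c (a₀ b) {{c≢0}} {{a₀≢0 b}} ℕ.* (B ℕ.* R)) ℕ.^ Tree.n dim b s k' c (a₀ b) {{c≢0}} {{a₀≢0 b}} ℕ.< Z) (Z<p : Z ℕ.< p) where

    open RandomGraph pp q q≤p dim c c≤p R B B≤p room-c public

    badOn : Bool → Poly (Var dim) → ℕ
    badOn b = BadTrees.bad pp q q≤p 1<p dim b s k' c (a₀ b) {{c≢0}} {{a₀≢0 b}} c≤p c≤dim (split b) (fits b) R B T B≤p (room b)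

    last : ℕ
    last = suc (2 ℕ.* k')

    module _ (F : Poly (Var dim)) (deg-F : deg F ℕ.≤ R) (no-bad : ∀ b → badOn b F ≡ 0) {t : ℕ} (Z+T≤t : Z ℕ.+ T ℕ.≤ t)
      (f : SubVertex (K s t) last → Fin (q ℕ.^ dim true) ⊎ Fin (q ℕ.^ dim false))
      (f-injective : ∀ x y → f x ≡ f y → x ≡ y)
      (f-adjacent : ∀ x y → SubAdj (K s t) last x y → BipAdj (graph F) (f x) (f y)) where

      open Sampling pp (allVars dim) R B B≤p using (Small)

      private
        -- Path numbers are wrapped modulo s because the tree layout indexes paths by all of ℕ.
        W : Fin t → ℕ → ℕ → Fin (q ℕ.^ dim true) ⊎ Fin (q ℕ.^ dim false)
        W τ i j = f (pathVtx (K s t) last (i mod s , τ) j)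

        adjacent : ∀ τ i j → j ℕ.≤ last → BipAdj (graph F) (W τ i j) (W τ i (suc j))
        adjacent τ i j j≤ = f-adjacent _ _ ((i mod s , τ) , j , j≤ , inj₁ (refl , refl))

        number-< : ∀ (u : Fin (q ℕ.^ dim true) ⊎ Fin (q ℕ.^ dim false)) → number u ℕ.< q ℕ.^ dim (sideOf u)
        number-< (inj₁ x) = Finₚ.toℕ<n x
        number-< (inj₂ y) = Finₚ.toℕ<n y

        centre-vertex : ∀ τ i → W τ i (suc last) ≡ f (inj₁ (inj₂ τ))
        centre-vertex τ i = go (pathView (K s t) last (i mod s , τ) (suc last) ℕₚ.≤-refl)
          where
          go : ∀ {v} → PathView (K s t) last (i mod s , τ) (suc last) v → f v ≡ f (inj₁ (inj₂ τ))
          go (inner j<k) = contradiction j<k (ℕₚ.<-irrefl refl)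
          go finish = refl

        pointOf : (Bool → ℕ) → ℕ → Var dim → ℕ
        pointOf π r (co b' β) = digit q (π b') (toℕ β)
        pointOf π r row       = r

        adjacent-small : ∀ u w → BipAdj (graph F) u w → ∀ r → r ℕ.< c → ∀ π → π (sideOf u) ≡ number u → π (sideOf w) ≡ number w → Small F (λ ι → + pointOf π r ι)
        adjacent-small (inj₁ x) (inj₂ y) adj r r<c π e e' = subst (λ v → (v %ℕ p) {{prime⇒nonZero pp}} ℕ.< B) (⟦⟧-cong F (λ { (co true β) → cong (λ z → + digit q z (toℕ β)) (sym e) ; (co false β) → cong (λ z → + digit q z (toℕ β)) (sym e') ; row → refl })) (graph-edge F x y adj r r<c)
        adjacent-small (inj₂ y) (inj₁ x) adj r r<c π e e' = subst (λ v → (v %ℕ p) {{prime⇒nonZero pp}} ℕ.< B) (⟦⟧-cong F (λ { (co true β) → cong (λ z → + digit q z (toℕ β)) (sym e') ; (co false β) → cong (λ z → + digit q z (toℕ β)) (sym e) ; row → refl })) (graph-edge F x y adj r r<c)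

        path-injective : ∀ e j j' → j ℕ.≤ suc last → j' ℕ.≤ suc last → pathVtx (K s t) last e j ≡ pathVtx (K s t) last e j' → j ≡ j'
        path-injective e j j' h h' = go (pathView (K s t) last e j h) (pathView (K s t) last e j' h')
          where
          go : ∀ {v w} → PathView (K s t) last e j v → PathView (K s t) last e j' w → v ≡ w → j ≡ j'
          go start start _ = refl
          go start (inner _) ()
          go start finish ()
          go (inner _) start ()
          go (inner {j} j<k) (inner {j'} j'<k) eq = cong suc (Finₚ.fromℕ<-injective j j' j<k j'<k (cong proj₂ (Sumₚ.inj₂-injective eq)))
          go (inner _) finish ()
          go finish start ()
          go finish (inner _) ()
          go finish finish _ = refl

        module OnSide (b : Bool) (root-side : ∀ τ i → sideOf (W τ i 0) ≡ b) (τ₀ : Fin t) where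
          instance
            a₀≢0-b : NonZero (a₀ b)
            a₀≢0-b = a₀≢0 b
          open Tree dim b s k' c (a₀ b) using (side; side-last; pick)

          W-side : ∀ τ i j → j ℕ.≤ suc last → sideOf (W τ i j) ≡ side j
          W-side τ i zero    _       = root-side τ i
          W-side τ i (suc j) (s≤s j≤) = trans (adjacent-sides (graph F) (W τ i j) (W τ i (suc j)) (adjacent τ i j j≤)) (cong not (W-side τ i j (ℕₚ.≤-trans j≤ (ℕₚ.n≤1+n last))))

          N : Fin t → ℕ → ℕ → ℕ
          N τ i j = number (W τ i j)

          pick-this : ∀ e → pick (side e) e ≡ e
          pick-this e with side e Bool.≟ side e
          ... | yes _ = refl
          ... | no ne = contradiction refl ne

          pick-next : ∀ e → pick (not (side e)) e ≡ suc e
          pick-next e with side e Bool.≟ not (side e)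
          ... | yes eq = contradiction eq (not-¬ refl)
          ... | no _ = refl

          N-edge : ∀ τ i e r → i ℕ.< s → e ℕ.≤ last → r ℕ.< c → Small F (λ ι → + pointOf (λ b' → N τ i (pick b' e)) r ι)
          N-edge τ i e r _ e≤ r<c = adjacent-small (W τ i e) (W τ i (suc e)) (adjacent τ i e e≤) r r<c (λ b' → N τ i (pick b' e))
            (cong (N τ i) (trans (cong (λ b' → pick b' e) (W-side τ i e (ℕₚ.≤-trans e≤ (ℕₚ.n≤1+n last)))) (pick-this e)))
            (cong (N τ i) (trans (cong (λ b' → pick b' e) (W-side τ i (suc e) (s≤s e≤))) (pick-next e)))

          N-equal : ∀ τ τ' i i' j j' → j ℕ.≤ suc last → j' ℕ.≤ suc last → side j ≡ side j' → N τ i j ≡ N τ' i' j' →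
            pathVtx (K s t) last (i mod s , τ) j ≡ pathVtx (K s t) last (i' mod s , τ') j'
          N-equal τ τ' i i' j j' h h' sides eq = f-injective _ _ (number-injective (W τ i j) (W τ' i' j') (trans (W-side τ i j h) (trans sides (sym (W-side τ' i' j' h')))) eq)

          -- Positions 0 and suc last lie on side b, so only inner vertices remain, and an inner
          -- vertex remembers the edge of K s t that it subdivides, that is, both i and τ.
          N-odd : ∀ τ τ' i i' j j' → i ℕ.< s → i' ℕ.< s → j ℕ.≤ suc last → j' ℕ.≤ suc last → side j ≡ not b → side j' ≡ not b →
            N τ i j ≡ N τ' i' j' → τ ≡ τ' × i ≡ i' × j ≡ j'
          N-odd τ τ' i i' j j' i<s i'<s h h' odd odd' eq = go (pathView (K s t) last (i mod s , τ) j h) (pathView (K s t) last (i' mod s , τ') j' h') odd odd' (N-equal τ τ' i i' j j' h h' (trans odd (sym odd')) eq)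
            where
            go : ∀ {j j' v w} → PathView (K s t) last (i mod s , τ) j v → PathView (K s t) last (i' mod s , τ') j' w → side j ≡ not b → side j' ≡ not b → v ≡ w → τ ≡ τ' × i ≡ i' × j ≡ j'
            go start _ o _ _ = contradiction o (not-¬ refl)
            go finish _ o _ _ = contradiction (trans (sym side-last) o) (not-¬ refl)
            go (inner _) start _ o _ = contradiction o (not-¬ refl)
            go (inner _) finish _ o _ = contradiction (trans (sym side-last) o) (not-¬ refl)
            go (inner {j} j<k) (inner {j'} j'<k) _ _ e = cong (proj₂ ∘ proj₁) e₂ , trans (sym (mod-toℕ i<s)) (trans (cong (toℕ ∘ proj₁ ∘ proj₁) e₂) (mod-toℕ i'<s)) , cong suc (Finₚ.fromℕ<-injective j j' j<k j'<k (cong proj₂ e₂))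
              where e₂ = Sumₚ.inj₂-injective e

          N-even : ∀ τ i j j' → j ℕ.≤ suc last → j' ℕ.≤ suc last → side j ≡ b → side j' ≡ b → N τ i j ≡ N τ i j' → j ≡ j'
          N-even τ i j j' h h' even even' eq = path-injective (i mod s , τ) j j' h h' (N-equal τ τ i i j j' h h' (trans even (sym even')) eq)

          impossible : ⊥
          impossible = FreeTrees.no-large-family pp q q≤p 1<p dim b s k' c (a₀ b) c≤p c≤dim (split b) (fits b) R B T B≤p (room b)
            (ℕ.>-nonZero⁻¹ s) (Z-big b) Z<p F deg-F (no-bad b) Z+T≤t N (λ i → N τ₀ i 0)
            (λ i → subst (λ z → N τ₀ i 0 ℕ.< q ℕ.^ dim z) (root-side τ₀ i) (number-< (W τ₀ i 0)))
            (λ τ i → refl)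
            (λ τ i i' → cong number (trans (centre-vertex τ i) (sym (centre-vertex τ i'))))
            (λ τ i j h → subst (λ z → N τ i j ℕ.< q ℕ.^ dim z) (W-side τ i j h) (number-< (W τ i j)))
            N-odd N-even (λ τ i e r → pointOf (λ b' → N τ i (pick b' e)) r) (λ τ i e r b' β → refl) (λ τ i e r → refl) N-edge

        τ₀ : Fin t
        τ₀ = fromℕ< (ℕₚ.<-≤-trans (ℕₚ.≤-<-trans z≤n (Z-big true)) (ℕₚ.≤-trans (ℕₚ.m≤m+n Z T) Z+T≤t))

        flips : ∀ τ i → sideOf (W τ i (suc last)) ≡ sideOf (W τ i 0)
        flips τ i = trans (cong (λ j → sideOf (W τ i j)) (sym (ℕₚ.*-suc 2 k'))) (even-side (suc k') (ℕₚ.≤-reflexive (ℕₚ.*-suc 2 k')))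
          where
          step : ∀ j → j ℕ.≤ last → sideOf (W τ i (suc j)) ≡ not (sideOf (W τ i j))
          step j j≤ = adjacent-sides (graph F) (W τ i j) (W τ i (suc j)) (adjacent τ i j j≤)
          even-side : ∀ h → 2 ℕ.* h ℕ.≤ suc last → sideOf (W τ i (2 ℕ.* h)) ≡ sideOf (W τ i 0)
          even-side zero    _ = refl
          even-side (suc h) le = trans (cong (λ j → sideOf (W τ i j)) (ℕₚ.*-suc 2 h)) (trans (step (suc (2 ℕ.* h)) (ℕₚ.≤-pred le')) (trans (cong not (step (2 ℕ.* h) (ℕₚ.≤-trans (ℕₚ.n≤1+n _) (ℕₚ.≤-pred le')))) (trans (not-involutive _) (even-side h (ℕₚ.≤-trans (ℕₚ.n≤1+n _) (ℕₚ.≤-trans (ℕₚ.n≤1+n _) le'))))))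
            where
            le' : suc (suc (2 ℕ.* h)) ℕ.≤ suc last
            le' = ℕₚ.≤-trans (ℕₚ.≤-reflexive (sym (ℕₚ.*-suc 2 h))) le

      no-embedding : ⊥
      no-embedding = OnSide.impossible (sideOf (W τ₀ 0 0)) roots-aligned τ₀
        where
        -- Every root is joined to the centre τ₀ by a path of even length.
        roots-aligned : ∀ τ i → sideOf (W τ i 0) ≡ sideOf (W τ₀ 0 0)
        roots-aligned τ i = trans (sym (flips τ₀ i)) (trans (cong sideOf (trans (centre-vertex τ₀ i) (sym (centre-vertex τ₀ 0)))) (flips τ₀ 0))

open import Defs
open import Data.Nat as ℕ using (ℕ; zero; suc; z≤n; s≤s; NonZero; _+_; _*_; _∸_; _^_; _≤_)
import Data.Nat.Properties as ℕₚ
import Data.Nat.Tactic.RingSolver as ℕSolver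
open import Data.Nat.Divisibility using (divides)
open import Data.Nat.Primality using (Prime; prime⇒nonZero; prime⇒nonTrivial)
open import Data.List using (length)
open import Data.Product using (Σ; ∃-syntax; _×_; _,_; proj₁; proj₂)
open import Data.Bool using (Bool; true; false; not)
open import Data.Bool.Properties using (not-involutive)
open import Data.Empty using (⊥)
open import Relation.Nullary using (contradiction)
open import Relation.Binary.PropositionalEquality
open PrimeGaps using (prime-in-[q,36q])
open NonsingularZeros
open RandomPolynomials
open TreeLayout
open TreeGraphs

-- Dimensions, density and the final count.

module _ (dim : Bool → ℕ) (b : Bool) (s k' c a₀ : ℕ) {{c≢0 : NonZero c}} {{a₀≢0 : NonZero a₀}} where
  open Tree dim b s k' c a₀

  -- Positions 1 to `last` alternate between the sides and both begin and end opposite to the roots: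
  -- k' pairs and one more.
  off-last : off last ≡ k' * (dim b + dim (not b)) + dim (not b)
  off-last = cong₂ (λ o x → o + dim (not x)) (proj₁ (even k')) (proj₂ (even k'))
    where
    r : ∀ o x y → o + x + y ≡ y + x + o
    r = ℕSolver.solve-∀
    even : ∀ h → off (2 * h) ≡ h * (dim b + dim (not b)) × side (2 * h) ≡ b
    even zero    = refl , refl
    even (suc h) = trans (cong off (ℕₚ.*-suc 2 h)) (trans (cong₂ (λ o x → o + dim (not x) + dim (not (not x))) (proj₁ (even h)) (proj₂ (even h)))
        (trans (cong (λ x → h * (dim b + dim (not b)) + dim (not b) + dim x) (not-involutive b)) (r (h * (dim b + dim (not b))) (dim (not b)) (dim b))))
      , trans (cong side (ℕₚ.*-suc 2 h)) (trans (not-involutive (side (2 * h))) (proj₂ (even h)))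

-- |M| = q ^ (2ksμ), |N| = q ^ (2ksν) and edge density q ^ (-c); k = suc k' and s = suc s'.
module Parameters (k' s' μ ν : ℕ) (1≤ν : 1 ≤ ν) (μ≤ν : μ ≤ ν) (ν≤μ : ν * (suc k' * suc s') ≤ μ * (suc k' * suc s' + s')) where

  k s c : ℕ
  k = suc k'
  s = suc s'
  -- Forced by the required number of edges: dim true + dim false - c must equal μ (k s + s - 1) + ν
  -- k s.
  c = μ * (s * k' + 1) + ν * (k * s)

  dim a₀ : Bool → ℕ
  dim true  = μ * (2 * k * s)
  dim false = ν * (2 * k * s)
  a₀ true  = 2 * k * μ
  a₀ false = 2 * k * ν

  1≤c : 1 ≤ c
  1≤c = ℕₚ.≤-trans (ℕₚ.*-mono-≤ 1≤ν (s≤s z≤n)) (ℕₚ.m≤n+m (ν * (k * s)) (μ * (s * k' + 1)))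

  1≤μ : 1 ≤ μ
  1≤μ = ℕₚ.n≢0⇒n>0 (λ μ≡0 → contradiction (subst (λ x → ν * (k * s) ≤ x * (k * s + s')) μ≡0 ν≤μ) (ℕₚ.<⇒≱ (ℕₚ.*-mono-≤ 1≤ν (s≤s z≤n))))

  instance
    c≢0 : NonZero c
    c≢0 = ℕ.>-nonZero 1≤c

  a₀≢0 : ∀ b → NonZero (a₀ b)
  a₀≢0 true  = ℕ.>-nonZero (ℕₚ.*-mono-≤ {1} {2 * k} (s≤s z≤n) 1≤μ)
  a₀≢0 false = ℕ.>-nonZero (ℕₚ.*-mono-≤ {1} {2 * k} (s≤s z≤n) 1≤ν)

  split : ∀ b → dim b ≡ s * a₀ b
  split true  = r μ k s
    where
    r : ∀ μ k s → μ * (2 * k * s) ≡ s * (2 * k * μ)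
    r = ℕSolver.solve-∀
  split false = r ν k s
    where
    r : ∀ μ k s → μ * (2 * k * s) ≡ s * (2 * k * μ)
    r = ℕSolver.solve-∀

  -- With α = μ / ν, the bound for M is exactly the lower bound on α, and the bound for N comes from
  -- α ≤ 1.
  c≤dim : ∀ b → c ≤ dim b
  c≤dim true = ℕₚ.≤-trans (ℕₚ.+-monoʳ-≤ (μ * (s * k' + 1)) ν≤μ) (ℕₚ.≤-reflexive (r μ k' s'))
    where
    r : ∀ μ k' s' → μ * (suc s' * k' + 1) + μ * (suc k' * suc s' + s') ≡ μ * (2 * suc k' * suc s')
    r = ℕSolver.solve-∀
  c≤dim false = ℕₚ.≤-trans (ℕₚ.+-monoˡ-≤ (ν * (k * s)) (ℕₚ.*-mono-≤ μ≤ν (ℕₚ.+-monoʳ-≤ (s * k') (s≤s (z≤n {s'}))))) (ℕₚ.≤-reflexive (r ν k' s'))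
    where
    r : ∀ ν k' s' → ν * (suc s' * k' + suc s') + ν * (suc k' * suc s') ≡ ν * (2 * suc k' * suc s')
    r = ℕSolver.solve-∀

  -- With roots in M each path has exactly as many equations as unknowns. With roots in N there is a
  -- surplus of 2 k (s - 1) (ν - μ) equations, nonnegative because α ≤ 1.
  fits : ∀ b → Tree.Λ dim b s k' c (a₀ b) {{c≢0}} {{a₀≢0 b}} ≤ suc (Tree.last dim b s k' c (a₀ b) {{c≢0}} {{a₀≢0 b}}) * c
  fits true = ℕₚ.≤-reflexive (trans (cong (_+ a₀ true) (off-last dim true s k' c (a₀ true) {{c≢0}} {{a₀≢0 true}})) (r k' s' μ ν))
    where
    r : ∀ k' s' μ ν → k' * (μ * (2 * suc k' * suc s') + ν * (2 * suc k' * suc s')) + ν * (2 * suc k' * suc s') + 2 * suc k' * μ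
      ≡ suc (suc (2 * k')) * (μ * (suc s' * k' + 1) + ν * (suc k' * suc s'))
    r = ℕSolver.solve-∀
  fits false = ℕₚ.≤-trans (ℕₚ.≤-reflexive (cong (_+ a₀ false) (off-last dim false s k' c (a₀ false) {{c≢0}} {{a₀≢0 false}})))
      (ℕₚ.≤-trans (ℕₚ.m≤m+n _ (2 * suc k' * s' * (ν ∸ μ))) (ℕₚ.≤-reflexive (subst (λ ν' → k' * (ν' * (2 * suc k' * suc s') + μ * (2 * suc k' * suc s')) + μ * (2 * suc k' * suc s') + 2 * suc k' * ν' + 2 * suc k' * s' * (ν ∸ μ)
      ≡ suc (suc (2 * k')) * (μ * (suc s' * k' + 1) + ν' * (suc k' * suc s'))) (ℕₚ.m+[n∸m]≡n μ≤ν) (r k' s' μ (ν ∸ μ)))))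
    where
    r : ∀ k' s' μ δ → k' * ((μ + δ) * (2 * suc k' * suc s') + μ * (2 * suc k' * suc s')) + μ * (2 * suc k' * suc s') + 2 * suc k' * (μ + δ) + 2 * suc k' * s' * δ
      ≡ suc (suc (2 * k')) * (μ * (suc s' * k' + 1) + (μ + δ) * (suc k' * suc s'))
    r = ℕSolver.solve-∀

  unknowns : Bool → ℕ
  unknowns b = Tree.n dim b s k' c (a₀ b) {{c≢0}} {{a₀≢0 b}}

  -- T pays for all choices of roots on either side and leaves a factor p ^ -(c + 1). R provides two
  -- interpolation letters for each row of T trees and for each equation of an edge. Z exceeds the
  -- Bézout bound for windows of degree B * R. D is the exponent of the guaranteed edge count. None
  -- depends on q.
  B T R Z D : ℕ
  B = 36
  T = s * (dim true + dim false) + suc c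
  R = 2 * (T * (unknowns true + unknowns false)) + 2 * c
  Z = suc (suc (unknowns true * (B * R)) ^ unknowns true + suc (unknowns false * (B * R)) ^ unknowns false)
  D = dim true + dim false ∸ c

  C : Bool → ℕ
  C b = (2 * B) ^ (T * unknowns b)

  q₀ t₀ : ℕ
  q₀ = c + (2 * (C true + C false) + (suc Z + (B + 4 ^ 6)))
  t₀ = Z + T

  room : ∀ b → 2 * (T * unknowns b) ≤ R
  room true  = ℕₚ.≤-trans (ℕₚ.*-monoʳ-≤ 2 (ℕₚ.*-monoʳ-≤ T (ℕₚ.m≤m+n (unknowns true) (unknowns false)))) (ℕₚ.m≤m+n _ (2 * c))
  room false = ℕₚ.≤-trans (ℕₚ.*-monoʳ-≤ 2 (ℕₚ.*-monoʳ-≤ T (ℕₚ.m≤n+m (unknowns false) (unknowns true)))) (ℕₚ.m≤m+n _ (2 * c))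

  room-c : 2 * c ≤ R
  room-c = ℕₚ.m≤n+m (2 * c) (2 * (T * (unknowns true + unknowns false)))

  Z-big : ∀ b → suc (unknowns b * (B * R)) ^ unknowns b ℕ.< Z
  Z-big true  = s≤s (ℕₚ.m≤m+n _ _)
  Z-big false = s≤s (ℕₚ.m≤n+m _ (suc (unknowns true * (B * R)) ^ unknowns true))

  dim*s≤ : ∀ b → dim b * s + suc c ≤ T
  dim*s≤ true  = ℕₚ.+-monoˡ-≤ (suc c) (ℕₚ.≤-trans (ℕₚ.≤-reflexive (ℕₚ.*-comm (dim true) s)) (ℕₚ.*-monoʳ-≤ s (ℕₚ.m≤m+n (dim true) (dim false))))
  dim*s≤ false = ℕₚ.+-monoˡ-≤ (suc c) (ℕₚ.≤-trans (ℕₚ.≤-reflexive (ℕₚ.*-comm (dim false) s)) (ℕₚ.*-monoʳ-≤ s (ℕₚ.m≤n+m (dim false) (dim true))))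

  module _ (q : ℕ) (q≥q₀ : q₀ ≤ q) where

    private
      rest₁ : 2 * (C true + C false) + (suc Z + (B + 4 ^ 6)) ≤ q
      rest₁ = ℕₚ.≤-trans (ℕₚ.m≤n+m (2 * (C true + C false) + (suc Z + (B + 4 ^ 6))) c) q≥q₀

      rest₂ : suc Z + (B + 4 ^ 6) ≤ q
      rest₂ = ℕₚ.≤-trans (ℕₚ.m≤n+m (suc Z + (B + 4 ^ 6)) (2 * (C true + C false))) rest₁

      rest₃ : B + 4 ^ 6 ≤ q
      rest₃ = ℕₚ.≤-trans (ℕₚ.m≤n+m (B + 4 ^ 6) (suc Z)) rest₂

      4^6≤q : 4 ^ 6 ≤ q
      4^6≤q = ℕₚ.≤-trans (ℕₚ.m≤n+m (4 ^ 6) B) rest₃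

      prime-near = prime-in-[q,36q] q 4^6≤q
      p = proj₁ prime-near

      pp : Prime p
      pp = proj₁ (proj₂ prime-near)

      q≤p : q ≤ p
      q≤p = proj₁ (proj₂ (proj₂ prime-near))

      p≤Bq : p ≤ B * q
      p≤Bq = proj₂ (proj₂ (proj₂ prime-near))

      instance
        q≢0 : NonZero q
        q≢0 = ℕ.>-nonZero (ℕₚ.≤-trans (s≤s z≤n) rest₂)
        p≢0 : NonZero p
        p≢0 = prime⇒nonZero pp

      1<p : 1 ℕ.< p
      1<p = ℕ.nonTrivial⇒n>1 p {{prime⇒nonTrivial pp}}

      c≤p : c ≤ p
      c≤p = ℕₚ.≤-trans (ℕₚ.m≤m+n c (2 * (C true + C false) + (suc Z + (B + 4 ^ 6)))) (ℕₚ.≤-trans q≥q₀ q≤p)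

      B≤p : B ≤ p
      B≤p = ℕₚ.≤-trans (ℕₚ.m≤m+n B (4 ^ 6)) (ℕₚ.≤-trans rest₃ q≤p)

      Z<p : Z ℕ.< p
      Z<p = ℕₚ.≤-trans (ℕₚ.m≤m+n (suc Z) (B + 4 ^ 6)) (ℕₚ.≤-trans rest₂ q≤p)

      2C≤p : 2 * (C true + C false) ≤ p
      2C≤p = ℕₚ.≤-trans (ℕₚ.m≤m+n (2 * (C true + C false)) (suc Z + (B + 4 ^ 6))) (ℕₚ.≤-trans rest₁ q≤p)

    open NoEmbedding pp q q≤p 1<p dim s k' c c≤p c≤dim a₀ a₀≢0 split fits R B T B≤p room room-c Z-big Z<p
    open Sampling pp (allVars dim) R B B≤p using (Ω)

    private
      -- Since q ≤ p, the number of root tuples is at most p ^ (dim b * s), and T exceeds that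
      -- exponent by at least c + 1.
      bad-small : ∀ b → p ^ suc c * ∑ Ω (badOn b) ≤ C b * length Ω
      bad-small b = ℕₚ.*-cancelˡ-≤ Q {{ℕₚ.m^n≢0 (q ^ dim b) s {{ℕₚ.m^n≢0 q (dim b)}}}} (begin
        Q * (p ^ suc c * X)           ≡⟨ sym (ℕₚ.*-assoc Q (p ^ suc c) X) ⟩
        Q * p ^ suc c * X             ≤⟨ ℕₚ.*-monoˡ-≤ X Q*p≤ ⟩
        p ^ T * X                     ≤⟨ BadTrees.bad-bound pp q q≤p 1<p dim b s k' c (a₀ b) {{c≢0}} {{a₀≢0 b}} c≤p c≤dim (split b) (fits b) R B T B≤p (room b) ⟩
        Q * C b * length Ω            ≡⟨ ℕₚ.*-assoc Q (C b) (length Ω) ⟩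
        Q * (C b * length Ω) ∎)
        where
        open ℕₚ.≤-Reasoning
        Q = (q ^ dim b) ^ s
        X = ∑ Ω (badOn b)
        Q*p≤ : Q * p ^ suc c ≤ p ^ T
        Q*p≤ = begin
          (q ^ dim b) ^ s * p ^ suc c   ≤⟨ ℕₚ.*-monoˡ-≤ (p ^ suc c) (ℕₚ.^-monoˡ-≤ s (ℕₚ.^-monoˡ-≤ (dim b) q≤p)) ⟩
          (p ^ dim b) ^ s * p ^ suc c   ≡⟨ cong (_* p ^ suc c) (ℕₚ.^-*-assoc p (dim b) s) ⟩
          p ^ (dim b * s) * p ^ suc c   ≡⟨ sym (ℕₚ.^-distribˡ-+-* p (dim b * s) (suc c)) ⟩
          p ^ (dim b * s + suc c)       ≤⟨ ℕₚ.^-monoʳ-≤ p (dim*s≤ b) ⟩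
          p ^ T ∎

      chosen : ∃[ F ] deg F ≤ R × q ^ D ≤ 2 * edges (graph F) × badOn true F ≡ 0 × badOn false F ≡ 0
      chosen = choose (badOn true) (badOn false) (C true) (C false) D (bad-small true) (bad-small false)
        (trans (sym (ℕₚ.^-distribˡ-+-* q D c)) (trans (cong (q ^_) (ℕₚ.m∸n+n≡m (ℕₚ.≤-trans (c≤dim true) (ℕₚ.m≤m+n (dim true) (dim false))))) (ℕₚ.^-distribˡ-+-* q (dim true) (dim false))))
        p≤Bq (s≤s z≤n) 2C≤p

      F = proj₁ chosen

      no-bad : ∀ b → badOn b F ≡ 0
      no-bad true  = proj₁ (proj₂ (proj₂ (proj₂ chosen)))
      no-bad false = proj₂ (proj₂ (proj₂ (proj₂ chosen)))

    theGraph : BipGraph (q ^ dim true) (q ^ dim false)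
    theGraph = graph F

    theGraph-edges : q ^ D ≤ 2 * edges theGraph
    theGraph-edges = proj₁ (proj₂ (proj₂ chosen))

    theGraph-free : ∀ t → t₀ ≤ t → Free (subdivide (K s t) (2 * k)) (asGraph theGraph)
    -- The path length 2 * k ∸ 1 equals suc (2 * k') only propositionally, so it is abstracted
    -- before matching.
    theGraph-free t t≥t₀ = go (2 * k ∸ 1) (ℕₚ.+-suc k' (k' + 0))
      where
      go : ∀ L → L ≡ suc (2 * k') → Contains (asGraph theGraph) (record { V = SubVertex (K s t) L ; Adj = SubAdj (K s t) L }) → ⊥
      go .(suc (2 * k')) refl (f , f-injective , f-adjacent) = no-embedding F (proj₁ (proj₂ chosen)) no-bad t≥t₀ f f-injective f-adjacent

    -- Raising to the power 2 k s clears the fractional exponents; the choice of c makes the two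
    -- powers of q coincide.
    theGraph-many-edges : (q ^ dim true) ^ (k * s + s ∸ 1) * (q ^ dim false) ^ (k * s) ≤ (2 * edges theGraph) ^ (2 * k * s)
    theGraph-many-edges = begin
      (q ^ dim true) ^ (k * s + s ∸ 1) * (q ^ dim false) ^ (k * s)     ≡⟨ cong (λ e → (q ^ dim true) ^ e * (q ^ dim false) ^ (k * s)) (ℕₚ.+-∸-assoc (k * s) {s} {1} (s≤s z≤n)) ⟩
      (q ^ dim true) ^ (k * s + s') * (q ^ dim false) ^ (k * s)        ≡⟨ cong₂ _*_ (ℕₚ.^-*-assoc q (dim true) (k * s + s')) (ℕₚ.^-*-assoc q (dim false) (k * s)) ⟩
      q ^ (dim true * (k * s + s')) * q ^ (dim false * (k * s))        ≡⟨ sym (ℕₚ.^-distribˡ-+-* q (dim true * (k * s + s')) _) ⟩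
      q ^ (dim true * (k * s + s') + dim false * (k * s))              ≡⟨ cong (q ^_) exponents ⟩
      q ^ (D * (2 * k * s))                                            ≡⟨ sym (ℕₚ.^-*-assoc q D (2 * k * s)) ⟩
      (q ^ D) ^ (2 * k * s)                                            ≤⟨ ℕₚ.^-monoˡ-≤ (2 * k * s) theGraph-edges ⟩
      (2 * edges theGraph) ^ (2 * k * s) ∎
      where
      open ℕₚ.≤-Reasoning
      r : ∀ k' s' μ ν → μ * (2 * suc k' * suc s') * (suc k' * suc s' + s') + ν * (2 * suc k' * suc s') * (suc k' * suc s') + (μ * (suc s' * k' + 1) + ν * (suc k' * suc s')) * (2 * suc k' * suc s')
        ≡ (μ * (2 * suc k' * suc s') + ν * (2 * suc k' * suc s')) * (2 * suc k' * suc s')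
      r = ℕSolver.solve-∀
      exponents : dim true * (k * s + s') + dim false * (k * s) ≡ D * (2 * k * s)
      exponents = ℕₚ.+-cancelʳ-≡ (c * (2 * k * s)) _ _ (trans (r k' s' μ ν) (trans (cong (_* (2 * k * s)) (sym (ℕₚ.m∸n+n≡m (ℕₚ.≤-trans (c≤dim true) (ℕₚ.m≤m+n (dim true) (dim false)))))) (ℕₚ.*-distribʳ-+ (2 * k * s) D c)))

theorem5p10 : (k s a b : ℕ) → 1 ≤ k → 1 ≤ s → 1 ≤ b → a ≤ b →
    k * s * b ≤ a * (k * s + s ∸ 1) →
    (ℓ : ℕ) → IsSmallestL k s a b ℓ →
    (m : ℕ) → m * b ≡ a * ℓ →
    ∃[ t₀ ] ∃[ q₀ ] ((t : ℕ) → t₀ ≤ t → (q : ℕ) → IsPrimePower q → q₀ ≤ q →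
    Σ (BipGraph (q ^ m) (q ^ ℓ)) λ G →
    Free (subdivide (K s t) (2 * k)) (asGraph G) ×
    (q ^ m) ^ (k * s + s ∸ 1) * (q ^ ℓ) ^ (k * s) ≤ (2 * edges G) ^ (2 * k * s))
theorem5p10 (suc k') (suc s') a b _ _ 1≤b a≤b α-large ℓ ((1≤ℓ , divides ν refl , divides μ aℓ≡) , _) m mb≡aℓ = by-exponent m m≡
  where
  k s : ℕ
  k = suc k'
  s = suc s'
  instance
    b≢0 : NonZero b
    b≢0 = ℕ.>-nonZero 1≤b
    2ks≢0 : NonZero (2 * k * s)
    2ks≢0 = _
  -- The quotients ν and μ of the two divisibilities are ℓ / (2 k s) and α ℓ / (2 k s), the integers
  -- on which all parameters are built.
  m≡ : m ≡ μ * (2 * k * s)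
  m≡ = ℕₚ.*-cancelʳ-≡ m (μ * (2 * k * s)) b (trans mb≡aℓ (trans aℓ≡ (sym (ℕₚ.*-assoc μ (2 * k * s) b))))
  1≤ν : 1 ≤ ν
  1≤ν = ℕ.>-nonZero⁻¹ ν {{ℕₚ.m*n≢0⇒m≢0 ν {{ℕ.>-nonZero 1≤ℓ}}}}
  μ≤ν : μ ≤ ν
  μ≤ν = ℕₚ.*-cancelʳ-≤ μ ν (2 * k * s) (ℕₚ.*-cancelʳ-≤ (μ * (2 * k * s)) (ν * (2 * k * s)) b (begin
    μ * (2 * k * s) * b ≡⟨ cong (_* b) (sym m≡) ⟩
    m * b               ≡⟨ mb≡aℓ ⟩
    a * ℓ               ≤⟨ ℕₚ.*-monoˡ-≤ ℓ a≤b ⟩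
    b * ℓ               ≡⟨ ℕₚ.*-comm b ℓ ⟩
    ℓ * b ∎))
    where open ℕₚ.≤-Reasoning
  ν≤μ : ν * (k * s) ≤ μ * (k * s + s')
  ν≤μ = ℕₚ.*-cancelʳ-≤ (ν * (k * s)) (μ * (k * s + s')) (2 * k * s) (ℕₚ.*-cancelʳ-≤ (ν * (k * s) * (2 * k * s)) (μ * (k * s + s') * (2 * k * s)) b (begin
    ν * (k * s) * (2 * k * s) * b             ≡⟨ r₁ ν (k * s) (2 * k * s) b ⟩
    k * s * b * ℓ                             ≤⟨ ℕₚ.*-monoˡ-≤ ℓ α-large ⟩
    a * (k * s + s ∸ 1) * ℓ                   ≡⟨ cong (λ e → a * e * ℓ) (ℕₚ.+-∸-assoc (k * s) {s} {1} (s≤s z≤n)) ⟩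
    a * (k * s + s') * ℓ                      ≡⟨ r₂ a (k * s + s') ℓ ⟩
    a * ℓ * (k * s + s')                      ≡⟨ cong (_* (k * s + s')) (trans (sym mb≡aℓ) (cong (_* b) m≡)) ⟩
    μ * (2 * k * s) * b * (k * s + s')        ≡⟨ r₃ μ (2 * k * s) b (k * s + s') ⟩
    μ * (k * s + s') * (2 * k * s) * b ∎))
    where
    open ℕₚ.≤-Reasoning
    r₁ : ∀ ν x y b → ν * x * y * b ≡ x * b * (ν * y)
    r₁ = ℕSolver.solve-∀
    r₂ : ∀ a e ℓ → a * e * ℓ ≡ a * ℓ * e
    r₂ = ℕSolver.solve-∀
    r₃ : ∀ μ x b e → μ * x * b * e ≡ μ * e * x * b
    r₃ = ℕSolver.solve-∀
  open Parameters k' s' μ ν 1≤ν μ≤ν ν≤μ using (t₀; q₀; theGraph; theGraph-free; theGraph-many-edges)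
  -- The exponent m occurs in the type of the graph, so it is generalised in order to be replaced by
  -- μ * (2 * k * s).
  by-exponent : ∀ m → m ≡ μ * (2 * k * s) → ∃[ t₀ ] ∃[ q₀ ] ((t : ℕ) → t₀ ≤ t → (q : ℕ) → IsPrimePower q → q₀ ≤ q →
    Σ (BipGraph (q ^ m) (q ^ ℓ)) λ G →
    Free (subdivide (K s t) (2 * k)) (asGraph G) ×
    (q ^ m) ^ (k * s + s ∸ 1) * (q ^ ℓ) ^ (k * s) ≤ (2 * edges G) ^ (2 * k * s))
  by-exponent .(μ * (2 * k * s)) refl = t₀ , q₀ , λ t t≥t₀ q _ q≥q₀ → theGraph q q≥q₀ , theGraph-free q q≥q₀ t t≥t₀ , theGraph-many-edges q q≥q₀
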